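{- The coproduct $\Delta$ on $\mathbf{PQSym}^{(l)}$ is an algebra homomorphism, so that $\mathbf{PQSym}^{(l)}$ is a graded bialgebra. Moreover, it is a Hopf algebra.
   Context: A parking function of length $n\ge0$ is a word $\mathbf a=a_1\cdots a_n$ of length $n$ on $[n]=\{1,\dots,n\}$ whose nondecreasing rearrangement $a'_1\cdots a'_n$ satisfies $a'_i\le i$ for all $i$. An integer $0\le b\le n$ is a breakpoint of $\mathbf a$ if $|\{i:a_i\le b\}|=b$; $BP(\mathbf a)$ denotes the set of breakpoints ($0$ and $n$ always belong to it). Parkization: for a word $w=w_1\cdots w_n$ over the positive integers, let $d(w)=\min\{i\ge1:|\{j:w_j\le i\}|<i\}$. If $d(w)=n+1$, then $w$ is a parking function and $\mathrm{Park}(w)=w$; otherwise let $w'$ be the word obtained from $w$ by decreasing by $1$ all letters greater than $d(w)$, and set $\mathrm{Park}(w)=\mathrm{Park}(w')$ (this terminates). The convolution $\mathbf a'*\mathbf a''$ of two parking functions is the set of parking functions $\mathbf a$ of length $|\mathbf a'|+|\mathbf a''|$ such that the parkization of the first $|\mathbf a'|$ letters of $\mathbf a$ is $\mathbf a'$ and the parkization of the remaining letters is $\mathbf a''$. Fix $l\ge1$. A colored parking function of level $l$ and size $n$ is a pair $(\mathbf a,u)$ of a parking function $\mathbf a$ of length $n$ and a word $u$ of length $n$ on $[l]$. $\mathbf{PQSym}^{(l)}$ is the $\mathbb C$-vector space with basis $(\mathbf G_{(\mathbf a,u)})$ indexed by all colored parking functions of level $l$, graded by size, with product $$\mathbf G_{(\mathbf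 a',u')}\mathbf G_{(\mathbf a'',u'')}=\sum_{\mathbf a\in\mathbf a'*\mathbf a''}\mathbf G_{(\mathbf a,u'\cdot u'')}$$ ($u'\cdot u''$ is concatenation), unit $\mathbf G_{(\emptyset,\emptyset)}$, coproduct $$\Delta\mathbf G_{(\mathbf a,u)}=\sum_{i\in BP(\mathbf a)}\mathbf G_{(\mathbf a,u)_{[1,i]}}\otimes\mathbf G_{(\mathbf a,u)_{[i+1,n]}},$$ where $n$ is the size of $\mathbf a$ and $(\mathbf a,u)_{[a,b]}=(\mathrm{Park}(\mathbf a'),u')$ with $\mathbf a'$ the subword of $\mathbf a$ consisting of the letters (values) in $[a,b]$ and $u'$ the subword of $u$ at the same positions, and counit the projection onto degree $0$. -}

module Defs where

open import Level as Level using (Level; _⊔_) renaming (suc to lsuc)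
open import Algebra.Bundles using (CommutativeRing)
open import Algebra.Module.Bundles using (Module)
open import Algebra.Module.Construct.TensorUnit using (⟨module⟩)
open import Algebra.Module.Morphism.Structures using (IsModuleHomomorphism)
open import Algebra.Module.Structures.Biased using (IsModuleFromLeft)
open import Algebra.Structures using (IsRing)
import Algebra.Properties.CommutativeMonoid.Sum as Sum
open import Data.Bool.Base using (if_then_else_)
open import Data.Fin.Base as Fin using (Fin; zero; suc; toℕ)
import Data.Fin.Properties as Fin
open import Data.List.Base as List using (List; []; _∷_)
open import Data.List.Properties using (filter-accept; filter-reject; filter-none)
import Data.List.Relation.Unary.All as ListAll
import Data.List.Relation.Unary.All.Properties as ListAll
open import Data.List.Relation.Unary.AllPairs using (AllPairs; []; _∷_)
open import Data.List.Relation.Unary.Sorted.TotalOrder.Properties using (Sorted⇒AllPairs)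
open import Data.List.Relation.Binary.Permutation.Propositional.Properties using (↭-length; filter-↭)
open import Data.Maybe.Base using (Maybe; just; nothing)
open import Data.Nat.Base using (ℕ; zero; suc; pred; z≤n; s≤s; s≤s⁻¹; _<_; _≤_; _+_)
open import Data.Nat.Properties
open import Data.Nat.Induction using (<-wellFounded)
open import Data.Product.Base using (_×_; _,_; proj₁; proj₂; ∃-syntax)
open import Data.Sum.Base using (inj₁; inj₂)
open import Data.Vec.Base as Vec using (Vec; []; _∷_)
import Data.Vec.Properties as Vec
open import Data.Vec.Relation.Unary.All as All using (All; []; _∷_)
open import Data.List.Sort ≤-decTotalOrder using (sort; sort-↭; sort-↗)
open import Function.Base using (flip)
open import Induction.WellFounded using (Acc; acc)
open import Relation.Binary.Core using (Rel)
open import Relation.Binary.PropositionalEquality using (_≡_; _≢_; refl; sym; trans; cong; subst)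
open import Relation.Nullary using (Dec; yes; no; ¬_; does; contradiction)
open import Relation.Nullary.Decidable using (_×-dec_)
open import Relation.Unary using (Pred; _∈_; Decidable)
open import Data.Empty.Polymorphic using (⊥)

private variable
  c ℓ g r m ℓm n ℓn p : Level

data Combination (R : Set c) (G : Set g) : Set (c ⊔ g) where
  gen  : G → Combination R G
  0ᶜ   : Combination R G
  _+ᶜ_ : Combination R G → Combination R G → Combination R G
  -ᶜ_  : Combination R G → Combination R G
  _•_  : R → Combination R G → Combination R G

module _ (K : CommutativeRing c ℓ) where
  private module K = CommutativeRing K

  -- The least K-module congruence containing the given relation.
  data Congruence {G : Set g} (rel : Rel (Combination K.Carrier G) r) :
                  Rel (Combination K.Carrier G) (c ⊔ ℓ ⊔ g ⊔ r) where
    relation     : ∀ {x y} → rel x y → Congruence rel x y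
    ≈-refl       : ∀ {x} → Congruence rel x x
    ≈-sym        : ∀ {x y} → Congruence rel x y → Congruence rel y x
    ≈-trans      : ∀ {x y z} → Congruence rel x y → Congruence rel y z → Congruence rel x z
    +ᶜ-cong      : ∀ {x x′ y y′} → Congruence rel x x′ → Congruence rel y y′ →
                   Congruence rel (x +ᶜ y) (x′ +ᶜ y′)
    -ᶜ‿cong      : ∀ {x y} → Congruence rel x y → Congruence rel (-ᶜ x) (-ᶜ y)
    •-cong       : ∀ {k k′ x x′} → k K.≈ k′ → Congruence rel x x′ →
                   Congruence rel (k • x) (k′ • x′)
    +ᶜ-assoc     : ∀ x y z → Congruence rel ((x +ᶜ y) +ᶜ z) (x +ᶜ (y +ᶜ z))
    +ᶜ-comm      : ∀ x y → Congruence rel (x +ᶜ y) (y +ᶜ x)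
    +ᶜ-identityˡ : ∀ x → Congruence rel (0ᶜ +ᶜ x) x
    -ᶜ‿inverseˡ  : ∀ x → Congruence rel ((-ᶜ x) +ᶜ x) 0ᶜ
    •-zeroˡ      : ∀ x → Congruence rel (K.0# • x) 0ᶜ
    •-zeroʳ      : ∀ k → Congruence rel (k • 0ᶜ) 0ᶜ
    •-distribʳ   : ∀ x k k′ → Congruence rel ((k K.+ k′) • x) ((k • x) +ᶜ (k′ • x))
    •-distribˡ   : ∀ k x y → Congruence rel (k • (x +ᶜ y)) ((k • x) +ᶜ (k • y))
    •-identityˡ  : ∀ x → Congruence rel (K.1# • x) x
    •-assoc      : ∀ k k′ x → Congruence rel ((k K.* k′) • x) (k • (k′ • x))

  Presented : (G : Set g) → Rel (Combination K.Carrier G) r → Module K (c ⊔ g) (c ⊔ ℓ ⊔ g ⊔ r)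
  Presented G rel = record
    { Carrierᴹ = Combination K.Carrier G
    ; _≈ᴹ_     = Congruence rel
    ; _+ᴹ_     = _+ᶜ_
    ; _*ₗ_     = _•_
    ; _*ᵣ_     = flip _•_
    ; 0ᴹ       = 0ᶜ
    ; -ᴹ_      = -ᶜ_
    ; isModule = IsModuleFromLeft.isModule {commutativeRing = K} record
      { isLeftModule = record
        { isLeftSemimodule = record
          { +ᴹ-isCommutativeMonoid = record
            { isMonoid = record
              { isSemigroup = record
                { isMagma = record
                  { isEquivalence = record { refl = ≈-refl ; sym = ≈-sym ; trans = ≈-trans }
                  ; ∙-cong        = +ᶜ-cong
                  }
                ; assoc = +ᶜ-assoc
                }
              ; identity = +ᶜ-identityˡ , λ x → ≈-trans (+ᶜ-comm x 0ᶜ) (+ᶜ-identityˡ x)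
              }
            ; comm = +ᶜ-comm
            }
          ; isPreleftSemimodule = record
            { *ₗ-cong      = •-cong
            ; *ₗ-zeroˡ     = •-zeroˡ
            ; *ₗ-distribʳ  = •-distribʳ
            ; *ₗ-identityˡ = •-identityˡ
            ; *ₗ-assoc     = •-assoc
            ; *ₗ-zeroʳ     = •-zeroʳ
            ; *ₗ-distribˡ  = •-distribˡ
            }
          }
        ; -ᴹ‿cong    = -ᶜ‿cong
        ; -ᴹ‿inverse = -ᶜ‿inverseˡ , λ x → ≈-trans (+ᶜ-comm x (-ᶜ x)) (-ᶜ‿inverseˡ x)
        }
      }
    }

  -- No relations beyond the module axioms, so the generators form a basis.
  Free : Set g → Module K (c ⊔ g) (c ⊔ ℓ ⊔ g)
  Free G = Presented G (λ _ _ → ⊥ {Level.zero})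

module _ {K : CommutativeRing c ℓ} where
  private module K = CommutativeRing K

  -- Linear extension of a map defined on generators.  It respects the
  -- congruence of a presented module whenever f respects its relations.
  lift : {G : Set g} (N : Module K n ℓn) → (G → Module.Carrierᴹ N) →
         Combination K.Carrier G → Module.Carrierᴹ N
  lift N f (gen x)  = f x
  lift N f 0ᶜ       = Module.0ᴹ N
  lift N f (x +ᶜ y) = Module._+ᴹ_ N (lift N f x) (lift N f y)
  lift N f (-ᶜ x)   = Module.-ᴹ_ N (lift N f x)
  lift N f (k • x)  = Module._*ₗ_ N k (lift N f x)

  sumOver : {I : Set g} (N : Module K n ℓn) → List I → (I → Module.Carrierᴹ N) → Module.Carrierᴹ N
  sumOver N is f = List.foldr (λ i s → Module._+ᴹ_ N (f i) s) (Module.0ᴹ N) is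

  IsLinear : (M : Module K m ℓm) (N : Module K n ℓn) →
             (Module.Carrierᴹ M → Module.Carrierᴹ N) → Set (c ⊔ m ⊔ ℓm ⊔ ℓn)
  IsLinear M N = IsModuleHomomorphism (Module.rawModule M) (Module.rawModule N)

infixr 6 _⊗_

_⊗_ : {R : Set c} {X : Set m} {Y : Set n} → X → Y → Combination R (X × Y)
x ⊗ y = gen (x , y)

module _ {K : CommutativeRing c ℓ} where
  private module K = CommutativeRing K

  module _ (M : Module K m ℓm) (N : Module K n ℓn) where
    private
      module M = Module M
      module N = Module N

    data Bilinearity : Rel (Combination K.Carrier (M.Carrierᴹ × N.Carrierᴹ))
                           (c ⊔ m ⊔ n ⊔ ℓm ⊔ ℓn) where
      ⊗-cong      : ∀ {x x′ y y′} → x M.≈ᴹ x′ → y N.≈ᴹ y′ → Bilinearity (x ⊗ y) (x′ ⊗ y′)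
      ⊗-distribʳ  : ∀ x x′ y → Bilinearity ((x M.+ᴹ x′) ⊗ y) ((x ⊗ y) +ᶜ (x′ ⊗ y))
      ⊗-distribˡ  : ∀ x y y′ → Bilinearity (x ⊗ (y N.+ᴹ y′)) ((x ⊗ y) +ᶜ (x ⊗ y′))
      ⊗-*ₗ-assocˡ : ∀ k x y → Bilinearity ((k M.*ₗ x) ⊗ y) (k • (x ⊗ y))
      ⊗-*ₗ-assocʳ : ∀ k x y → Bilinearity (x ⊗ (k N.*ₗ y)) (k • (x ⊗ y))

    infixr 6 _⊗ᴹ_

    _⊗ᴹ_ : Module K (c ⊔ m ⊔ n) (c ⊔ ℓ ⊔ m ⊔ n ⊔ ℓm ⊔ ℓn)
    _⊗ᴹ_ = Presented K (M.Carrierᴹ × N.Carrierᴹ) Bilinearity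

record RawAlgebra (K : CommutativeRing c ℓ) m ℓm : Set (c ⊔ ℓ ⊔ lsuc (m ⊔ ℓm)) where
  infixl 7 _·_
  field
    space : Module K m ℓm
  open Module space public
  field
    _·_ : Carrierᴹ → Carrierᴹ → Carrierᴹ
    𝟙   : Carrierᴹ

module _ {K : CommutativeRing c ℓ} where
  private module K = CommutativeRing K

  groundAlgebra : RawAlgebra K c ℓ
  groundAlgebra = record { space = ⟨module⟩ {R = K} ; _·_ = K._*_ ; 𝟙 = K.1# }

  -- The product determined by (x ⊗ y) · (x′ ⊗ y′) = (x · x′) ⊗ (y · y′).
  tensorAlgebra : RawAlgebra K m ℓm → RawAlgebra K n ℓn →
                  RawAlgebra K (c ⊔ m ⊔ n) (c ⊔ ℓ ⊔ m ⊔ n ⊔ ℓm ⊔ ℓn)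
  tensorAlgebra A B = record
    { space = A⊗B
    ; _·_   = λ s t → lift A⊗B (λ (x , y) → lift A⊗B (λ (x′ , y′) → (x A.· x′) ⊗ (y B.· y′)) t) s
    ; 𝟙     = A.𝟙 ⊗ B.𝟙
    }
    where
    module A = RawAlgebra A
    module B = RawAlgebra B
    A⊗B = A.space ⊗ᴹ B.space

  record IsAlgebra (A : RawAlgebra K m ℓm) : Set (c ⊔ m ⊔ ℓm) where
    open RawAlgebra A
    field
      isRing     : IsRing _≈ᴹ_ _+ᴹ_ _·_ -ᴹ_ 0ᴹ 𝟙
      *ₗ-·-assoc : ∀ k x y → ((k *ₗ x) · y) ≈ᴹ (k *ₗ (x · y))
      ·-*ₗ-comm  : ∀ k x y → (x · (k *ₗ y)) ≈ᴹ (k *ₗ (x · y))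

  record IsAlgebraHomomorphism (A : RawAlgebra K m ℓm) (B : RawAlgebra K n ℓn)
           (f : RawAlgebra.Carrierᴹ A → RawAlgebra.Carrierᴹ B) : Set (c ⊔ m ⊔ ℓm ⊔ ℓn) where
    private
      module A = RawAlgebra A
      module B = RawAlgebra B
    field
      isLinear : IsLinear A.space B.space f
      ·-homo   : ∀ x y → f (x A.· y) B.≈ᴹ (f x B.· f y)
      𝟙-homo   : f A.𝟙 B.≈ᴹ B.𝟙

  record IsCoalgebra (C : Module K m ℓm)
           (Δ : Module.Carrierᴹ C → Module.Carrierᴹ (C ⊗ᴹ C))
           (ε : Module.Carrierᴹ C → K.Carrier) : Set (c ⊔ ℓ ⊔ m ⊔ ℓm) where
    open Module C
    private
      C⊗C   = C ⊗ᴹ C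
      C⊗C⊗C = C ⊗ᴹ C⊗C
      module C⊗C⊗C = Module C⊗C⊗C

    -- (Δ ⊗ id), followed by the associator (C ⊗ C) ⊗ C → C ⊗ (C ⊗ C)
    Δ⊗id : Module.Carrierᴹ C⊗C → C⊗C⊗C.Carrierᴹ
    Δ⊗id = lift C⊗C⊗C (λ (x , y) → lift C⊗C⊗C (λ (x₁ , x₂) → x₁ ⊗ (x₂ ⊗ y)) (Δ x))

    id⊗Δ : Module.Carrierᴹ C⊗C → C⊗C⊗C.Carrierᴹ
    id⊗Δ = lift C⊗C⊗C (λ (x , y) → x ⊗ Δ y)

    field
      Δ-isLinear : IsLinear C C⊗C Δ
      ε-isLinear : IsLinear C (⟨module⟩ {R = K}) ε
      coassoc    : ∀ x → Δ⊗id (Δ x) C⊗C⊗C.≈ᴹ id⊗Δ (Δ x)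
      counitˡ    : ∀ x → lift C (λ (x₁ , x₂) → ε x₁ *ₗ x₂) (Δ x) ≈ᴹ x
      counitʳ    : ∀ x → lift C (λ (x₁ , x₂) → ε x₂ *ₗ x₁) (Δ x) ≈ᴹ x

record RawBialgebra (K : CommutativeRing c ℓ) m ℓm : Set (c ⊔ ℓ ⊔ lsuc (m ⊔ ℓm)) where
  field
    algebra : RawAlgebra K m ℓm
  open RawAlgebra algebra public
  algebra² : RawAlgebra K (c ⊔ m) (c ⊔ ℓ ⊔ m ⊔ ℓm)
  algebra² = tensorAlgebra algebra algebra
  field
    Δ : Carrierᴹ → RawAlgebra.Carrierᴹ algebra²
    ε : Carrierᴹ → CommutativeRing.Carrier K

module _ {K : CommutativeRing c ℓ} where
  private module K = CommutativeRing K

  record IsBialgebra (B : RawBialgebra K m ℓm) : Set (c ⊔ ℓ ⊔ m ⊔ ℓm) where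
    open RawBialgebra B
    field
      isAlgebra               : IsAlgebra algebra
      isCoalgebra             : IsCoalgebra space Δ ε
      Δ-isAlgebraHomomorphism : IsAlgebraHomomorphism algebra algebra² Δ
      ε-isAlgebraHomomorphism : IsAlgebraHomomorphism algebra groundAlgebra ε

  data Span (M : Module K m ℓm) (S : Pred (Module.Carrierᴹ M) p) :
            Pred (Module.Carrierᴹ M) (c ⊔ m ⊔ ℓm ⊔ p) where
    member : ∀ {x} → x ∈ S → x ∈ Span M S
    0-Span : Module.0ᴹ M ∈ Span M S
    +-Span : ∀ {x y} → x ∈ Span M S → y ∈ Span M S → Module._+ᴹ_ M x y ∈ Span M S
    *-Span : ∀ k {x} → x ∈ Span M S → Module._*ₗ_ M k x ∈ Span M S
    ≈-Span : ∀ {x y} → Module._≈ᴹ_ M x y → x ∈ Span M S → y ∈ Span M S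

  record IsSubmodule (M : Module K m ℓm) (S : Pred (Module.Carrierᴹ M) p) : Set (c ⊔ m ⊔ ℓm ⊔ p) where
    open Module M
    field
      0-closed : 0ᴹ ∈ S
      +-closed : ∀ {x y} → x ∈ S → y ∈ S → (x +ᴹ y) ∈ S
      *-closed : ∀ k {x} → x ∈ S → (k *ₗ x) ∈ S
      ≈-closed : ∀ {x y} → x ≈ᴹ y → x ∈ S → y ∈ S

  -- M is the direct sum of the submodules Deg 0, Deg 1, Deg 2, …
  record IsGrading (M : Module K m ℓm) (Deg : ℕ → Pred (Module.Carrierᴹ M) p) :
                   Set (c ⊔ m ⊔ ℓm ⊔ p) where
    open Module M
    open Sum +ᴹ-commutativeMonoid using (sum)
    field
      isSubmodule : ∀ d → IsSubmodule M (Deg d)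
      spanning    : ∀ x → ∃[ N ] ∃[ xs ] (∀ (i : Fin N) → xs i ∈ Deg (toℕ i)) × x ≈ᴹ sum xs
      independent : ∀ N (xs : Fin N → Carrierᴹ) → (∀ i → xs i ∈ Deg (toℕ i)) →
                    sum xs ≈ᴹ 0ᴹ → ∀ i → xs i ≈ᴹ 0ᴹ

  -- The image in M ⊗ M of the sum of the Deg i ⊗ Deg j over i + j = d.
  TensorDegree : (M : Module K m ℓm) → (ℕ → Pred (Module.Carrierᴹ M) p) →
                 ℕ → Pred (Module.Carrierᴹ (M ⊗ᴹ M)) (c ⊔ ℓ ⊔ m ⊔ ℓm ⊔ p)
  TensorDegree M Deg d = Span (M ⊗ᴹ M) λ t →
    ∃[ i ] ∃[ j ] ∃[ x ] ∃[ y ] i + j ≡ d × x ∈ Deg i × y ∈ Deg j × t ≡ x ⊗ y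

  record IsGradedBialgebra (B : RawBialgebra K m ℓm)
           (Deg : ℕ → Pred (RawBialgebra.Carrierᴹ B) p) : Set (c ⊔ ℓ ⊔ m ⊔ ℓm ⊔ p) where
    open RawBialgebra B
    field
      isBialgebra : IsBialgebra B
      isGrading   : IsGrading space Deg
      ·-graded    : ∀ {i j x y} → x ∈ Deg i → y ∈ Deg j → (x · y) ∈ Deg (i + j)
      𝟙-graded    : 𝟙 ∈ Deg 0
      Δ-graded    : ∀ {d x} → x ∈ Deg d → Δ x ∈ TensorDegree space Deg d
      ε-graded    : ∀ {d x} → d ≢ 0 → x ∈ Deg d → ε x K.≈ K.0#

  record IsAntipode (B : RawBialgebra K m ℓm)
           (S : RawBialgebra.Carrierᴹ B → RawBialgebra.Carrierᴹ B) : Set (c ⊔ m ⊔ ℓm) where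
    open RawBialgebra B
    field
      isLinear : IsLinear space space S
      inverseˡ : ∀ x → lift space (λ (x₁ , x₂) → S x₁ · x₂) (Δ x) ≈ᴹ (ε x *ₗ 𝟙)
      inverseʳ : ∀ x → lift space (λ (x₁ , x₂) → x₁ · S x₂) (Δ x) ≈ᴹ (ε x *ₗ 𝟙)

  record IsHopfAlgebra (B : RawBialgebra K m ℓm) : Set (c ⊔ ℓ ⊔ m ⊔ ℓm) where
    field
      isBialgebra : IsBialgebra B
      antipode    : RawBialgebra.Carrierᴹ B → RawBialgebra.Carrierᴹ B
      isAntipode  : IsAntipode B antipode

private variable
  k : ℕ

IsParking : Vec ℕ k → Set
IsParking {k} w = All (λ x → 1 ≤ x × x ≤ k) w ×
  (∀ (i : Fin (List.length (sort (Vec.toList w)))) →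
     List.lookup (sort (Vec.toList w)) i ≤ suc (toℕ i))

isParking? : (w : Vec ℕ k) → Dec (IsParking w)
isParking? {k} w =
  All.all? (λ x → (1 ≤? x) ×-dec (x ≤? k)) w ×-dec
  Fin.all? (λ i → List.lookup (sort (Vec.toList w)) i ≤? suc (toℕ i))

-- The proof is irrelevant, so that parking functions with the same word
-- are propositionally equal.
record ParkingFunction (k : ℕ) : Set where
  constructor parking
  field
    word       : Vec ℕ k
    .isParking : IsParking word

lettersUpTo : ℕ → Vec ℕ k → ℕ
lettersUpTo b w = Vec.count (_≤? b) w

breakpoints : Vec ℕ k → List ℕ
breakpoints {k} w = List.filter (λ b → lettersUpTo b w ≟ b) (List.upTo (suc k))

module _ (w : Vec ℕ k) where

  firstDeficit : (fuel start : ℕ) → ℕ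
  firstDeficit zero    i = i
  firstDeficit (suc f) i with lettersUpTo i w <? i
  ... | yes _ = i
  ... | no  _ = firstDeficit f (suc i)

  -- The least i ≥ 1 with lettersUpTo i w < i.  The search stops at k + 1,
  -- which always satisfies the condition; see d-deficit and d-least.
  d : ℕ
  d = firstDeficit k 1

  private
    deficit : ∀ f i → f + i ≡ suc k → lettersUpTo (firstDeficit f i) w < firstDeficit f i
    deficit zero    i refl = s≤s (Vec.count≤n (_≤? i) w)
    deficit (suc f) i eq with lettersUpTo i w <? i
    ... | yes lt = lt
    ... | no  _  = deficit f (suc i) (trans (+-suc f i) eq)

    least : ∀ f i j → i ≤ j → j < firstDeficit f i → j ≤ lettersUpTo j w
    least zero    i j i≤j j<d = contradiction j<d (≤⇒≯ i≤j)
    least (suc f) i j i≤j j<d with lettersUpTo i w <? i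
    ... | yes _  = contradiction j<d (≤⇒≯ i≤j)
    ... | no i≮ with m≤n⇒m<n∨m≡n i≤j
    ...   | inj₁ i<j  = least f (suc i) j i<j j<d
    ...   | inj₂ refl = ≮⇒≥ i≮

    bound : ∀ f i → firstDeficit f i ≤ f + i
    bound zero    i = ≤-refl
    bound (suc f) i with lettersUpTo i w <? i
    ... | yes _ = m≤n+m i (suc f)
    ... | no  _ = subst (firstDeficit f (suc i) ≤_) (+-suc f i) (bound f (suc i))

    positive : ∀ f i → i ≤ firstDeficit f i
    positive zero    i = ≤-refl
    positive (suc f) i with lettersUpTo i w <? i
    ... | yes _ = ≤-refl
    ... | no  _ = ≤-trans (n≤1+n i) (positive f (suc i))

  d-deficit : lettersUpTo d w < d
  d-deficit = deficit k 1 (trans (+-suc k 0) (cong suc (+-identityʳ k)))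

  d-least : ∀ j → 1 ≤ j → j < d → j ≤ lettersUpTo j w
  d-least = least k 1

  d-bound : d ≤ suc k
  d-bound = subst (d ≤_) (+-comm k 1) (bound k 1)

  d-positive : 1 ≤ d
  d-positive = positive k 1

count-accept : {P : Pred ℕ p} (P? : Decidable P) {x : ℕ} (w : Vec ℕ k) → P x →
               Vec.count P? (x ∷ w) ≡ suc (Vec.count P? w)
count-accept P? {x} _ px with P? x
... | yes _  = refl
... | no ¬px = contradiction px ¬px

count-reject : {P : Pred ℕ p} (P? : Decidable P) {x : ℕ} (w : Vec ℕ k) → ¬ P x →
               Vec.count P? (x ∷ w) ≡ Vec.count P? w
count-reject P? {x} _ ¬px with P? x
... | yes px = contradiction px ¬px
... | no _   = refl

lowerAbove : ℕ → ℕ → ℕ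
lowerAbove e x with e <? x
... | yes _ = pred x
... | no  _ = x

lower : ℕ → Vec ℕ k → Vec ℕ k
lower e = Vec.map (lowerAbove e)

lower-≤ : ∀ e (w : Vec ℕ k) → Vec.sum (lower e w) ≤ Vec.sum w
lower-≤ e []      = z≤n
lower-≤ e (x ∷ w) = +-mono-≤ (step x) (lower-≤ e w)
  where
  step : ∀ x → lowerAbove e x ≤ x
  step x with e <? x
  ... | yes _ = pred[n]≤n
  ... | no  _ = ≤-refl

lower-< : ∀ e (w : Vec ℕ k) → lettersUpTo e w < k → Vec.sum (lower e w) < Vec.sum w
lower-< e (x ∷ w) lt with e <? x
... | yes (s≤s _) = s≤s (+-monoʳ-≤ _ (lower-≤ e w))
... | no  e≮x     = +-monoʳ-< x (lower-< e w (s≤s⁻¹ (subst (_< _) (count-accept (_≤? e) w (≮⇒≥ e≮x)) lt)))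

lower-d-< : (w : Vec ℕ k) → d w ≢ suc k → Vec.sum (lower (d w) w) < Vec.sum w
lower-d-< w d≢1+k =
  lower-< (d w) w (<-≤-trans (d-deficit w) (s≤s⁻¹ (≤∧≢⇒< (d-bound w) d≢1+k)))

parkAcc : (w : Vec ℕ k) → Acc _<_ (Vec.sum w) → Vec ℕ k
parkAcc {k} w (acc rs) with d w ≟ suc k
... | yes _  = w
... | no d≢1+k = parkAcc (lower (d w) w) (rs (lower-d-< w d≢1+k))

Park : Vec ℕ k → Vec ℕ k
Park w = parkAcc w (<-wellFounded (Vec.sum w))

sorted-count : ∀ j (xs : List ℕ) → AllPairs _≤_ xs → (i : Fin (List.length xs)) →
               j < List.lookup xs i → List.length (List.filter (_≤? j) xs) ≤ toℕ i
sorted-count j (x ∷ xs) (x≤xs ∷ _) zero j<x =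
  ≤-reflexive (cong List.length (filter-none (_≤? j)
    (<⇒≱ j<x ListAll.∷ ListAll.map (λ x≤y → <⇒≱ (<-≤-trans j<x x≤y)) x≤xs)))
sorted-count j (x ∷ xs) (_ ∷ sorted) (suc i) j<y with x ≤? j
... | yes x≤j = subst (_≤ suc (toℕ i)) (sym (cong List.length (filter-accept (_≤? j) x≤j)))
                  (s≤s (sorted-count j xs sorted i j<y))
... | no  x≰j = subst (_≤ suc (toℕ i)) (sym (cong List.length (filter-reject (_≤? j) x≰j)))
                  (m≤n⇒m≤1+n (sorted-count j xs sorted i j<y))

count-toList : ∀ j (w : Vec ℕ k) → List.length (List.filter (_≤? j) (Vec.toList w)) ≡ lettersUpTo j w
count-toList j []      = refl
count-toList j (x ∷ w) with x ≤? j
... | yes x≤j = trans (cong List.length (filter-accept (_≤? j) x≤j))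
                  (trans (cong suc (count-toList j w)) (sym (count-accept (_≤? j) w x≤j)))
... | no  x≰j = trans (cong List.length (filter-reject (_≤? j) x≰j))
                  (trans (count-toList j w) (sym (count-reject (_≤? j) w x≰j)))

count-full : ∀ j (w : Vec ℕ k) → k ≤ lettersUpTo j w → All (_≤ j) w
count-full j []      _  = []
count-full j (x ∷ w) le with x ≤? j
... | yes x≤j = x≤j ∷ count-full j w (s≤s⁻¹ (subst (_ ≤_) (count-accept (_≤? j) w x≤j) le))
... | no  x≰j = contradiction (≤-trans (subst (_ ≤_) (count-reject (_≤? j) w x≰j) le) (Vec.count≤n (_≤? j) w)) 1+n≰n

letters-≤ : (w : Vec ℕ k) → d w ≡ suc k → All (_≤ k) w
letters-≤ []        _  = []
letters-≤ w@(_ ∷ _) eq = count-full _ w (d-least w _ (s≤s z≤n) (subst (_ <_) (sym eq) ≤-refl))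

d≡1+k⇒isParking : (w : Vec ℕ k) → All (1 ≤_) w → d w ≡ suc k → IsParking w
d≡1+k⇒isParking {k} w pos eq = All.zip (pos , letters-≤ w eq) , λ i → ≮⇒≥ (λ lt →
  let s     = sort (Vec.toList w)
      perm  = sort-↭ (Vec.toList w)
      i<k   = subst (toℕ i <_) (trans (↭-length perm) (Vec.length-toList w)) (Fin.toℕ<n i)
      count = trans (↭-length (filter-↭ (_≤? suc (toℕ i)) perm)) (count-toList _ w)
      few   = sorted-count _ s (Sorted⇒AllPairs ≤-totalOrder (sort-↗ (Vec.toList w))) i lt
      many  = d-least w (suc (toℕ i)) (s≤s z≤n) (subst (suc (toℕ i) <_) (sym eq) (s≤s i<k))
  in contradiction many (<⇒≱ (s≤s (subst (_≤ toℕ i) count few))))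

lower-positive : ∀ {e} → 1 ≤ e → (w : Vec ℕ k) → All (1 ≤_) w → All (1 ≤_) (lower e w)
lower-positive         1≤e []      []          = []
lower-positive {e = e} 1≤e (x ∷ w) (1≤x ∷ 1≤w) = step ∷ lower-positive 1≤e w 1≤w
  where
  step : 1 ≤ lowerAbove e x
  step with e <? x
  ... | yes e<x = ≤-trans 1≤e (<⇒≤pred e<x)
  ... | no  _   = 1≤x

parkAcc-isParking : (w : Vec ℕ k) (a : Acc _<_ (Vec.sum w)) → All (1 ≤_) w → IsParking (parkAcc w a)
parkAcc-isParking {k} w (acc rs) pos with d w ≟ suc k
... | yes eq = d≡1+k⇒isParking w pos eq
... | no d≢1+k = parkAcc-isParking _ (rs (lower-d-< w d≢1+k)) (lower-positive (d-positive w) w pos)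

Park-isParking : (w : Vec ℕ k) → All (1 ≤_) w → IsParking (Park w)
Park-isParking w = parkAcc-isParking w (<-wellFounded (Vec.sum w))

words : ∀ k → List ℕ → List (Vec ℕ k)
words zero    alphabet = [] ∷ []
words (suc k) alphabet = List.cartesianProductWith _∷_ alphabet (words k alphabet)

toParkingFunction : Vec ℕ k → Maybe (ParkingFunction k)
toParkingFunction w with isParking? w
... | yes isParking = just (parking w isParking)
... | no  _         = nothing

-- Each parking function of length k occurs exactly once.
parkingFunctions : ∀ k → List (ParkingFunction k)
parkingFunctions k = List.mapMaybe toParkingFunction (words k (List.map suc (List.upTo k)))

infixl 7 _✶_

_✶_ : ∀ {i j} → ParkingFunction i → ParkingFunction j → List (ParkingFunction (i + j))
_✶_ {i} {j} a′ a″ = List.filter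
  (λ a → Vec.≡-dec _≟_ (Park (Vec.take i (word a))) (word a′) ×-dec
         Vec.≡-dec _≟_ (Park (Vec.drop i (word a))) (word a″))
  (parkingFunctions (i + j))
  where open ParkingFunction

record ColouredParkingFunction (l : ℕ) : Set where
  constructor coloured
  field
    size            : ℕ
    parkingFunction : ParkingFunction size
    colours         : Vec (Fin l) size
  open ParkingFunction parkingFunction public

module _ {l : ℕ} where

  -- The pairs (letter , colour) whose letter has a value in [i , j].
  subword : ℕ → ℕ → Vec ℕ k → Vec (Fin l) k → List (ℕ × Fin l)
  subword i j a u = List.filter (λ (x , _) → (i ≤? x) ×-dec (x ≤? j)) (Vec.toList (Vec.zip a u))

  zip-positive : (a : Vec ℕ k) (u : Vec (Fin l) k) → All (1 ≤_) a →
                 ListAll.All (λ (x , _) → 1 ≤ x) (Vec.toList (Vec.zip a u))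
  zip-positive []      []      []          = ListAll.[]
  zip-positive (x ∷ a) (_ ∷ u) (1≤x ∷ 1≤a) = 1≤x ListAll.∷ zip-positive a u 1≤a

  letters-positive : (v : List (ℕ × Fin l)) → ListAll.All (λ (x , _) → 1 ≤ x) v →
                     All (1 ≤_) (Vec.map proj₁ (Vec.fromList v))
  letters-positive []      ListAll.[]          = []
  letters-positive (_ ∷ v) (1≤x ListAll.∷ 1≤v) = 1≤x ∷ letters-positive v 1≤v

  subword-positive : ∀ i j (a : Vec ℕ k) (u : Vec (Fin l) k) → All (1 ≤_) a →
                     All (1 ≤_) (Vec.map proj₁ (Vec.fromList (subword i j a u)))
  subword-positive i j a u 1≤a =
    letters-positive _ (ListAll.filter⁺ _ (zip-positive a u 1≤a))

  restrict : ℕ → ℕ → ColouredParkingFunction l → ColouredParkingFunction l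
  restrict i j (coloured n (parking a isParking) u) = record
    { size            = List.length v
    ; parkingFunction = parking (Park (Vec.map proj₁ (Vec.fromList v)))
        (Park-isParking _ (subword-positive i j a u (All.map proj₁ (proj₁ isParking))))
    ; colours         = Vec.map proj₂ (Vec.fromList v)
    }
    where v = subword i j a u

  ∅ : ColouredParkingFunction l
  ∅ = coloured 0 (parking [] (d≡1+k⇒isParking [] [] refl)) []

module _ (K : CommutativeRing c ℓ) (l : ℕ) where
  private
    module K = CommutativeRing K
    B = ColouredParkingFunction l

  PQSymSpace : Module K c (c ⊔ ℓ)
  PQSymSpace = Free K B

  open Module PQSymSpace using (Carrierᴹ)

  𝐆 : B → Carrierᴹ
  𝐆 = gen

  𝐆-product : B → B → Carrierᴹ
  𝐆-product (coloured _ a′ u′) (coloured _ a″ u″) =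
    sumOver PQSymSpace (a′ ✶ a″) (λ a → 𝐆 (coloured _ a (u′ Vec.++ u″)))

  𝐆-coproduct : B → Module.Carrierᴹ (PQSymSpace ⊗ᴹ PQSymSpace)
  𝐆-coproduct b = sumOver (PQSymSpace ⊗ᴹ PQSymSpace) (breakpoints word)
    (λ i → 𝐆 (restrict 1 i b) ⊗ 𝐆 (restrict (suc i) size b))
    where open ColouredParkingFunction b

  𝐆-counit : B → K.Carrier
  𝐆-counit b = if does (ColouredParkingFunction.size b ≟ 0) then K.1# else K.0#

  PQSym : RawBialgebra K c (c ⊔ ℓ)
  PQSym = record
    { algebra = record
      { space = PQSymSpace
      ; _·_   = λ x y → lift PQSymSpace (λ b′ → lift PQSymSpace (λ b″ → 𝐆-product b′ b″) y) x
      ; 𝟙     = 𝐆 ∅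
      }
    ; Δ = lift (PQSymSpace ⊗ᴹ PQSymSpace) 𝐆-coproduct
    ; ε = lift (⟨module⟩ {R = K}) 𝐆-counit
    }

  PQSymDegree : ℕ → Pred Carrierᴹ (c ⊔ ℓ)
  PQSymDegree n = Span PQSymSpace (λ x → ∃[ b ] ColouredParkingFunction.size b ≡ n × x ≡ 𝐆 b)

{-# OPTIONS --safe #-}
module Submission where

open import Defs
open import Algebra.Bundles using (CommutativeMonoid; CommutativeRing)
open import Algebra.Module.Bundles using (Module)
open import Algebra.Module.Construct.TensorUnit using (⟨module⟩)
import Algebra.Properties.AbelianGroup as AbelianGroupProperties
import Algebra.Properties.CommutativeMonoid.Sum as FinSum
import Algebra.Properties.CommutativeSemigroup as CommutativeSemigroupProperties
import Algebra.Properties.Group as GroupProperties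
import Algebra.Properties.Ring as RingProperties
open import Data.Bool.Base using (Bool; true; false; not; if_then_else_)
open import Data.Fin.Base as Fin using (Fin; zero; suc; toℕ; fromℕ<)
open import Data.Fin.Properties using (toℕ-injective; toℕ-fromℕ<)
open import Data.List.Base
  using (List; []; _∷_; _++_; concatMap; drop; filter; length; lookup; map; mapMaybe; replicate; take; upTo)
open import Data.List.Membership.Propositional using (_∈_; find; lose)
open import Data.List.Membership.Propositional.Properties
open import Data.List.Membership.Propositional.Properties.WithK using (unique∧set⇒bag)
open import Data.List.Properties
  using (++-assoc; ++-identityʳ; filter-accept; filter-reject; length-++; length-map; length-replicate;
         map-++; map-cong; map-id; map-∘; take++drop≡id; take-all)
open import Data.List.Relation.Binary.BagAndSetEquality using (∼bag⇒↭)
open import Data.List.Relation.Binary.Permutation.Propositional as Perm using (_↭_)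
open import Data.List.Relation.Binary.Permutation.Propositional.Properties using (↭-length; filter-↭)
open import Data.List.Relation.Unary.All as All using (All; []; _∷_)
import Data.List.Relation.Unary.All.Properties as All
open import Data.List.Relation.Unary.AllPairs using ([]; _∷_)
open import Data.List.Relation.Unary.Any using (here; there)
open import Data.List.Relation.Unary.Unique.Propositional using (Unique)
import Data.List.Relation.Unary.Unique.Propositional.Properties as Unique
open import Data.Maybe.Base using (Maybe; just; nothing; maybe′)
open import Data.Nat.Base as ℕ
  using (ℕ; zero; suc; pred; _+_; _∸_; _≤_; _<_; _≤ᵇ_; z≤n; s≤s; s≤s⁻¹)
open import Data.Nat.Induction using (<-wellFounded)
open import Data.Nat.Properties
open import Data.Nat.Solver using (module +-*-Solver)
open import Data.List.Sort ≤-decTotalOrder using (sort; sort-↭)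
open import Data.Product.Base using (_×_; _,_; proj₁; proj₂; ∃-syntax)
open import Data.Sum.Base using (inj₁; inj₂)
open import Data.Vec.Base as Vec using (Vec; []; _∷_; toList)
import Data.Vec.Properties as Vec
import Data.Vec.Relation.Unary.All as VecAll
import Data.Vec.Relation.Unary.All.Properties as VecAll
open import Function.Base using (_∘_; id)
open import Function.Bundles using (mk⇔)
open import Induction.WellFounded using (Acc; acc)
open import Level using (Level; _⊔_)
open import Relation.Binary.Core using (Rel)
open import Relation.Binary.Definitions using (tri<; tri≈; tri>)
open import Relation.Binary.PropositionalEquality hiding ([_])
import Relation.Binary.Reasoning.Setoid as SetoidReasoning
open import Relation.Nullary using (Dec; yes; no; ¬_; ¬?; does; contradiction; ofʸ; ofⁿ)
open import Relation.Nullary.Decidable using (dec-true; dec-false; does-⇔; recompute; _×-dec_)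
open import Relation.Unary using (Pred)
import Relation.Unary as Unary

-- Let cars with preferences w₁, w₂, … park along an unbounded street: parkization deletes the
-- spots that stay empty.  Deleting them one at a time is confluent, and a spot that stays empty
-- for w stays empty for every subword of w.  Hence parkization commutes with the selection of
-- positions, which makes the product associative.  If no car with preference at most k parks
-- beyond k, then the letters up to k and the letters above k park independently of each other.
-- So a word e of the convolution a ∗ b together with a breakpoint k of e amounts to a breakpoint
-- i of a, a breakpoint j of b, and words in the convolutions of the letters of a up to i with
-- those of b up to j, and of the letters of a above i with those of b above j: e is recovered by
-- interleaving the two words along the positions prescribed by a and b.  This bijection matches
-- the terms of Δ (x · y) with those of Δ x · Δ y.  The antipode is the geometric series of
-- unit ∘ counit − id for the convolution product, which is finite on each basis element.

-- The choice made by `Park`, always the first empty spot, does not pass to subwords, whose first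
-- empty spot may come earlier; hence the detour through a relation. Emptiness of a spot `e` is a
-- family of upper bounds, one for each interval of spots ending at `e`, on the number of letters in
-- it, and passing to a subword can only lower these numbers. What survives parkization is not a
-- threshold but the set of positions of the letters up to it. This is why a product word with a
-- breakpoint can be recovered: those positions are read off from the breakpoints of the two factors
-- alone. Words are handled as lists, because the lengths of selected subwords agree with sizes only
-- propositionally; a coloured parking function is compared through its lists of letters and
-- colours. A bijection of index sets becomes a permutation of duplicate-free lists, the form in
-- which a sum can be reindexed. Counting inequalities are kept additive, which avoids truncated
-- subtraction.

private variable
  a c ℓ g m ℓm o ℓo r : Level
  X Y : Set a
  κ : ℕ
  w v z : List ℕ

-- Masks, selection of positions, and counting

-- A mask marks a set of positions; sel b s x keeps the letters of x at the positions marked b.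
sel : Bool → List Bool → List X → List X
sel b     []          _       = []
sel b     (_ ∷ _)     []      = []
sel true  (true ∷ s)  (x ∷ w) = x ∷ sel true s w
sel true  (false ∷ s) (x ∷ w) = sel true s w
sel false (true ∷ s)  (x ∷ w) = sel false s w
sel false (false ∷ s) (x ∷ w) = x ∷ sel false s w

-- Inverse to the two selections by one mask. The clauses that stop early make the function total;
-- the inverse laws assume lengths that exclude them.
merge : List Bool → List X → List X → List X
merge []          _       _       = []
merge (true ∷ s)  []      _       = []
merge (true ∷ s)  (x ∷ v) w       = x ∷ merge s v w
merge (false ∷ s) _       []      = []
merge (false ∷ s) v       (x ∷ w) = x ∷ merge s v w

trues : List Bool → ℕ
trues []          = 0
trues (true ∷ s)  = suc (trues s)
trues (false ∷ s) = trues s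

falses : List Bool → ℕ
falses []          = 0
falses (true ∷ s)  = falses s
falses (false ∷ s) = suc (falses s)

-- Parkization changes letters but not positions, so a threshold is remembered through the positions
-- of the letters up to it.
mask : ℕ → List ℕ → List Bool
mask i = map (_≤ᵇ i)

cnt : ℕ → List ℕ → ℕ
cnt i w = trues (mask i w)

trues+falses : ∀ s → trues s + falses s ≡ length s
trues+falses []          = refl
trues+falses (true ∷ s)  = cong suc (trues+falses s)
trues+falses (false ∷ s) = trans (+-suc _ _) (cong suc (trues+falses s))

trues-++ : ∀ s t → trues (s ++ t) ≡ trues s + trues t
trues-++ []          t = refl
trues-++ (true ∷ s)  t = cong suc (trues-++ s t)
trues-++ (false ∷ s) t = trues-++ s t

falses-++ : ∀ s t → falses (s ++ t) ≡ falses s + falses t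
falses-++ []          t = refl
falses-++ (true ∷ s)  t = falses-++ s t
falses-++ (false ∷ s) t = cong suc (falses-++ s t)

trues≤length : ∀ s → trues s ≤ length s
trues≤length s = subst (trues s ≤_) (trues+falses s) (m≤m+n _ _)

cnt-++ : ∀ i v w → cnt i (v ++ w) ≡ cnt i v + cnt i w
cnt-++ i v w = trans (cong trues (map-++ _ v w)) (trues-++ (mask i v) _)

cnt≤length : ∀ i w → cnt i w ≤ length w
cnt≤length i w = subst (cnt i w ≤_) (length-map _ w) (trues≤length (mask i w))

mask-length : ∀ i w → length (mask i w) ≡ length w
mask-length i w = length-map _ w

length-sel-true : ∀ s (w : List X) → length s ≡ length w → length (sel true s w) ≡ trues s
length-sel-true []          []      _  = refl
length-sel-true (true ∷ s)  (x ∷ w) eq = cong suc (length-sel-true s w (suc-injective eq))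
length-sel-true (false ∷ s) (x ∷ w) eq = length-sel-true s w (suc-injective eq)

length-sel-false : ∀ s (w : List X) → length s ≡ length w → length (sel false s w) ≡ falses s
length-sel-false []          []      _  = refl
length-sel-false (true ∷ s)  (x ∷ w) eq = length-sel-false s w (suc-injective eq)
length-sel-false (false ∷ s) (x ∷ w) eq = cong suc (length-sel-false s w (suc-injective eq))

sel-map : ∀ b s (f : X → Y) w → sel b s (map f w) ≡ map f (sel b s w)
sel-map b     []          f w       = refl
sel-map b     (_ ∷ _)     f []      = refl
sel-map true  (true ∷ s)  f (x ∷ w) = cong (f x ∷_) (sel-map true s f w)
sel-map true  (false ∷ s) f (x ∷ w) = sel-map true s f w
sel-map false (true ∷ s)  f (x ∷ w) = sel-map false s f w
sel-map false (false ∷ s) f (x ∷ w) = cong (f x ∷_) (sel-map false s f w)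

sel-++ : ∀ b s t (v w : List X) → length s ≡ length v →
         sel b (s ++ t) (v ++ w) ≡ sel b s v ++ sel b t w
sel-++ b     []          t []      w _  = refl
sel-++ true  (true ∷ s)  t (x ∷ v) w eq = cong (x ∷_) (sel-++ true s t v w (suc-injective eq))
sel-++ true  (false ∷ s) t (x ∷ v) w eq = sel-++ true s t v w (suc-injective eq)
sel-++ false (true ∷ s)  t (x ∷ v) w eq = sel-++ false s t v w (suc-injective eq)
sel-++ false (false ∷ s) t (x ∷ v) w eq = cong (x ∷_) (sel-++ false s t v w (suc-injective eq))

sel-all : ∀ b (w : List X) → sel b (replicate (length w) b) w ≡ w
sel-all true  []      = refl
sel-all false []      = refl
sel-all true  (x ∷ w) = cong (x ∷_) (sel-all true w)
sel-all false (x ∷ w) = cong (x ∷_) (sel-all false w)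

sel-none : ∀ b (w : List X) → sel b (replicate (length w) (not b)) w ≡ []
sel-none true  []      = refl
sel-none false []      = refl
sel-none true  (x ∷ w) = sel-none true w
sel-none false (x ∷ w) = sel-none false w

merge-sel : ∀ s (w : List X) → length s ≡ length w → merge s (sel true s w) (sel false s w) ≡ w
merge-sel []          []      _  = refl
merge-sel (true ∷ s)  (x ∷ w) eq = cong (x ∷_) (merge-sel s w (suc-injective eq))
merge-sel (false ∷ s) (x ∷ w) eq = cong (x ∷_) (merge-sel s w (suc-injective eq))

sel-true-merge : ∀ s (v w : List X) → trues s ≡ length v → falses s ≡ length w →
                 sel true s (merge s v w) ≡ v
sel-true-merge []          []      w       p q = refl
sel-true-merge (true ∷ s)  (x ∷ v) w       p q = cong (x ∷_) (sel-true-merge s v w (suc-injective p) q)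
sel-true-merge (false ∷ s) v       (x ∷ w) p q = sel-true-merge s v w p (suc-injective q)

sel-false-merge : ∀ s (v w : List X) → trues s ≡ length v → falses s ≡ length w →
                  sel false s (merge s v w) ≡ w
sel-false-merge []          v       []      p q = refl
sel-false-merge (true ∷ s)  (x ∷ v) w       p q = sel-false-merge s v w (suc-injective p) q
sel-false-merge (false ∷ s) v       (x ∷ w) p q = cong (x ∷_) (sel-false-merge s v w p (suc-injective q))

length-merge : ∀ s (v w : List X) → trues s ≡ length v → falses s ≡ length w →
               length (merge s v w) ≡ length s
length-merge []          v       w       p q = refl
length-merge (true ∷ s)  (x ∷ v) w       p q = cong suc (length-merge s v w (suc-injective p) q)
length-merge (false ∷ s) v       (x ∷ w) p q = cong suc (length-merge s v w p (suc-injective q))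

All-sel : ∀ {p} {P : X → Set p} b s {w : List X} → All P w → All P (sel b s w)
All-sel b     []          _         = []
All-sel b     (_ ∷ _)     []        = []
All-sel true  (true ∷ s)  (px ∷ pw) = px ∷ All-sel true s pw
All-sel true  (false ∷ s) (px ∷ pw) = All-sel true s pw
All-sel false (true ∷ s)  (px ∷ pw) = All-sel false s pw
All-sel false (false ∷ s) (px ∷ pw) = px ∷ All-sel false s pw

All-merge : ∀ {p} {P : X → Set p} s {v w : List X} → All P v → All P w → All P (merge s v w)
All-merge []          _         _         = []
All-merge (true ∷ s)  []        _         = []
All-merge (true ∷ s)  (px ∷ pv) pw        = px ∷ All-merge s pv pw
All-merge (false ∷ s) _         []        = []
All-merge (false ∷ s) pv        (px ∷ pw) = px ∷ All-merge s pv pw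

cnt-sel : ∀ i s w → length s ≡ length w → cnt i w ≡ cnt i (sel true s w) + cnt i (sel false s w)
cnt-sel i []          []      _  = refl
cnt-sel i (true ∷ s)  (x ∷ w) eq with does (x ≤? i)
... | true  = cong suc (cnt-sel i s w (suc-injective eq))
... | false = cnt-sel i s w (suc-injective eq)
cnt-sel i (false ∷ s) (x ∷ w) eq with does (x ≤? i)
... | true  = trans (cong suc (cnt-sel i s w (suc-injective eq))) (sym (+-suc _ _))
... | false = cnt-sel i s w (suc-injective eq)

low-cong : ∀ {x i y j} → (x ≤ i → y ≤ j) → (y ≤ j → x ≤ i) → does (x ≤? i) ≡ does (y ≤? j)
low-cong f g = does-⇔ (mk⇔ f g) (_ ≤? _) (_ ≤? _)

mask-cong : ∀ {i j} w (f : ℕ → ℕ) → All (λ x → (f x ≤ i → x ≤ j) × (x ≤ j → f x ≤ i)) w →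
            mask i (map f w) ≡ mask j w
mask-cong []      f []             = refl
mask-cong (x ∷ w) f ((p , q) ∷ pq) = cong₂ _∷_ (low-cong p q) (mask-cong w f pq)

-- Raising the threshold can only switch positions on; if the count does not grow, no letter lies in
-- (i , j].
cnt-≤⇒mask-≡ : ∀ {i j} w → i ≤ j → cnt j w ≤ cnt i w → mask i w ≡ mask j w
cnt-≤⇒mask-≡ {i} {j} w i≤j le = go w (≤-antisym (mono w) le)
  where
  mono : ∀ w → cnt i w ≤ cnt j w
  mono []      = z≤n
  mono (x ∷ w) with x ≤ᵇ i | ≤ᵇ-reflects-≤ x i | x ≤ᵇ j | ≤ᵇ-reflects-≤ x j
  ... | true | ofʸ p | true | ofʸ q = s≤s (mono w)
  ... | true | ofʸ p | false | ofⁿ ¬q = contradiction (≤-trans p i≤j) ¬q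
  ... | false | ofⁿ ¬p | true | ofʸ q = m≤n⇒m≤1+n (mono w)
  ... | false | ofⁿ ¬p | false | ofⁿ ¬q = mono w
  go : ∀ w → cnt i w ≡ cnt j w → mask i w ≡ mask j w
  go []      _  = refl
  go (x ∷ w) eq with x ≤ᵇ i | ≤ᵇ-reflects-≤ x i | x ≤ᵇ j | ≤ᵇ-reflects-≤ x j
  ... | true | ofʸ p | true | ofʸ q = cong (true ∷_) (go w (suc-injective eq))
  ... | true | ofʸ p | false | ofⁿ ¬q = contradiction (≤-trans p i≤j) ¬q
  ... | false | ofⁿ ¬p | true | ofʸ q = contradiction (≤-trans (≤-reflexive (sym eq)) (mono w)) 1+n≰n
  ... | false | ofⁿ ¬p | false | ofⁿ ¬q = cong (false ∷_) (go w eq)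

cnt-mono : ∀ {i j} w → i ≤ j → cnt i w ≤ cnt j w
cnt-mono {i} {j} []      i≤j = z≤n
cnt-mono {i} {j} (x ∷ w) i≤j with x ≤ᵇ i | ≤ᵇ-reflects-≤ x i | x ≤ᵇ j | ≤ᵇ-reflects-≤ x j
... | true | ofʸ p | true | ofʸ q = s≤s (cnt-mono w i≤j)
... | true | ofʸ p | false | ofⁿ ¬q = contradiction (≤-trans p i≤j) ¬q
... | false | ofⁿ ¬p | true | ofʸ q = m≤n⇒m≤1+n (cnt-mono w i≤j)
... | false | ofⁿ ¬p | false | ofⁿ ¬q = cnt-mono w i≤j

cnt-0 : All (1 ≤_) w → cnt 0 w ≡ 0
cnt-0 []            = refl
cnt-0 (s≤s _ ∷ pos) = cnt-0 pos

cnt-All-≤ : ∀ {i} → All (_≤ i) w → cnt i w ≡ length w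
cnt-All-≤ []        = refl
cnt-All-≤ {x ∷ w} {i} (p ∷ ps) rewrite dec-true (x ≤? i) p = cong suc (cnt-All-≤ ps)

cnt-full⇒All : ∀ {i} w → length w ≤ cnt i w → All (_≤ i) w
cnt-full⇒All []      _  = []
cnt-full⇒All {i} (x ∷ w) le with x ≤ᵇ i | ≤ᵇ-reflects-≤ x i
... | true | ofʸ p = p ∷ cnt-full⇒All w (s≤s⁻¹ le)
... | false | ofⁿ ¬p = contradiction (≤-trans le (cnt≤length i w)) 1+n≰n

cnt-All-> : ∀ {i} → All (i <_) w → cnt i w ≡ 0
cnt-All-> []        = refl
cnt-All-> {x ∷ w} {i} (p ∷ ps) rewrite dec-false (x ≤? i) (<⇒≱ p) = cnt-All-> ps

sel-mask-≤ : ∀ i w → All (_≤ i) (sel true (mask i w) w)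
sel-mask-≤ i []      = []
sel-mask-≤ i (x ∷ w) with x ≤ᵇ i | ≤ᵇ-reflects-≤ x i
... | true | ofʸ p = p ∷ sel-mask-≤ i w
... | false | ofⁿ ¬p = sel-mask-≤ i w

sel-mask-> : ∀ i w → All (i <_) (sel false (mask i w) w)
sel-mask-> i []      = []
sel-mask-> i (x ∷ w) with x ≤ᵇ i | ≤ᵇ-reflects-≤ x i
... | true | ofʸ p = sel-mask-> i w
... | false | ofⁿ ¬p = ≰⇒> ¬p ∷ sel-mask-> i w

-- Deleting a spot

lowerAbove-≤ : ∀ {e x} → x ≤ e → lowerAbove e x ≡ x
lowerAbove-≤ {e} {x} x≤e with e <? x
... | yes p = contradiction p (≤⇒≯ x≤e)
... | no _  = refl

lowerAbove-> : ∀ {e x} → e < x → lowerAbove e x ≡ pred x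
lowerAbove-> {e} {x} e<x with e <? x
... | yes _ = refl
... | no ¬p = contradiction e<x ¬p

-- Once `e` is deleted, the former spot `suc i` is numbered `i`. Letters up to `e` keep their value
-- and stay below both thresholds.
mask-lower-≥ : ∀ {e i} w → e ≤ i → mask i (map (lowerAbove e) w) ≡ mask (suc i) w
mask-lower-≥ {e} {i} w e≤i = mask-cong w _ (All.universal low w)
  where
  low : ∀ x → (lowerAbove e x ≤ i → x ≤ suc i) × (x ≤ suc i → lowerAbove e x ≤ i)
  low x with e <? x
  ... | yes (s≤s _) = s≤s , s≤s⁻¹
  ... | no  e≮x     = m≤n⇒m≤1+n , λ _ → ≤-trans (≮⇒≥ e≮x) e≤i

mask-lower-< : ∀ {e i} w → i < e → mask i (map (lowerAbove e) w) ≡ mask i w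
mask-lower-< {e} {i} w i<e = mask-cong w _ (All.universal low w)
  where
  low : ∀ x → (lowerAbove e x ≤ i → x ≤ i) × (x ≤ i → lowerAbove e x ≤ i)
  low x with e <? x
  ... | yes e<x = (λ p → contradiction (≤-trans (<⇒≤pred e<x) p) (<⇒≱ i<e))
                , (λ p → contradiction (<-trans i<e e<x) (≤⇒≯ p))
  ... | no  _   = id , id

cnt-lower-≥ : ∀ {e i} w → e ≤ i → cnt i (map (lowerAbove e) w) ≡ cnt (suc i) w
cnt-lower-≥ w e≤i = cong trues (mask-lower-≥ w e≤i)

cnt-lower-< : ∀ {e i} w → i < e → cnt i (map (lowerAbove e) w) ≡ cnt i w
cnt-lower-< w i<e = cong trues (mask-lower-< w i<e)

-- Deleting the earlier spot `e` first renumbers the later spot `suc f` as `f`, so the two orders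
-- use different indices.
lower-comm : ∀ {e f} w → e ≤ f →
  map (lowerAbove f) (map (lowerAbove e) w) ≡ map (lowerAbove e) (map (lowerAbove (suc f)) w)
lower-comm {e} {f} w e≤f = trans (sym (map-∘ w)) (trans (map-cong comm w) (map-∘ w))
  where
  comm : ∀ x → lowerAbove f (lowerAbove e x) ≡ lowerAbove e (lowerAbove (suc f) x)
  comm x with e <? x | suc f <? x
  ... | yes (s≤s e<x) | yes (s≤s f<x) = trans (lowerAbove-> f<x) (sym (lowerAbove-> (≤-<-trans e≤f f<x)))
  ... | yes (s≤s e<x) | no f≮x  = trans (lowerAbove-≤ (s≤s⁻¹ (≮⇒≥ f≮x))) (sym (lowerAbove-> (s≤s e<x)))
  ... | no e≮x        | yes f<x = contradiction (≤-<-trans (m≤n⇒m≤1+n e≤f) f<x) e≮x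
  ... | no e≮x        | no f≮x  = trans (lowerAbove-≤ (≤-trans (≮⇒≥ e≮x) e≤f)) (sym (lowerAbove-≤ (≮⇒≥ e≮x)))

private
  open +-*-Solver using (solve; _:=_; _:+_; con)

  cancel : ∀ {m n x y} k → m ≤ n → m ≡ x + k → n ≡ y + k → x ≤ y
  cancel k m≤n refl refl = +-cancelʳ-≤ k _ _ m≤n

  regroup : ∀ p p′ r s → (r + s) + (p + p′) ≡ (p + r) + (s + p′)
  regroup p p′ r s = solve 4 (λ p p′ r s → (r :+ s) :+ (p :+ p′) := (p :+ r) :+ (s :+ p′)) refl p p′ r s

  regroup′ : ∀ q p′ q′ s → (p′ + q′) + (q + s) ≡ (q + q′) + (s + p′)
  regroup′ q p′ q′ s = solve 4 (λ q p′ q′ s → (p′ :+ q′) :+ (q :+ s) := (q :+ q′) :+ (s :+ p′)) refl q p′ q′ s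

  transfer : ∀ p q {p′ q′ r s} → r + s ≤ p′ + q′ → p + p′ ≤ q + s → p + r ≤ q + q′
  transfer p q {p′} {q′} {r} {s} g h =
    cancel (s + p′) (+-mono-≤ g h) (regroup p p′ r s) (regroup′ q p′ q′ s)

  regroup″ : ∀ s j e ce ci → suc ((j + ce) + (s + e + ci)) ≡ (s + j + ci) + suc (ce + e)
  regroup″ s j e ce ci = solve 5 (λ s j e ce ci → con 1 :+ ((j :+ ce) :+ (s :+ e :+ ci)) :=
      (s :+ j :+ ci) :+ (con 1 :+ (ce :+ e))) refl s j e ce ci

  regroup‴ : ∀ e i cj ce → (e + cj) + (suc i + ce) ≡ (i + cj) + suc (ce + e)
  regroup‴ e i cj ce = solve 4 (λ e i cj ce → (e :+ cj) :+ ((con 1 :+ i) :+ ce) := (i :+ cj) :+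
      (con 1 :+ (ce :+ e))) refl e i cj ce

  -- Adds a bound for (j , e] to one for (e , i + 1]. The unit to spare in the first pays for the
  -- spot that deletion removes.
  chain : ∀ s j e i {cj ce ci} → suc j + ce ≤ e + cj → s + e + ci ≤ suc i + ce → s + j + ci ≤ i + cj
  chain s j e i {cj} {ce} {ci} g h =
    cancel (suc (ce + e)) (+-mono-≤ g h) (regroup″ s j e ce ci) (regroup‴ e i cj ce)

-- Empty spots, and parkization as a confluent relation

-- The letters of w are the preferred spots of cars that park along an unbounded
-- street, each in the first free spot at or after its preference.  Room 0 i w says
-- that no car with preference at most i parks beyond spot i, and Room 1 e w that
-- moreover spot e stays empty; each interval (j , i] is tested.
record Room (s i : ℕ) (w : List ℕ) : Set where
  constructor mkRoom
  field
    slack : ∀ j → j < i → s + j + cnt i w ≤ i + cnt j w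
open Room

Room-lower-< : ∀ {s e i} → i < e → Room s i w → Room s i (map (lowerAbove e) w)
Room-lower-< {w} {s} {e} {i} i<e r = mkRoom go
  where
  go : ∀ j → j < i → s + j + cnt i (map (lowerAbove e) w) ≤ i + cnt j (map (lowerAbove e) w)
  go j j<i rewrite cnt-lower-< w i<e | cnt-lower-< w (<-trans j<i i<e) = slack r j j<i

-- An interval that begins below `e` loses the spot `e`; it is cut there, and the empty spot makes
-- up for the loss. An interval that begins at `e` or later is merely translated by one.
Room-lower-> : ∀ {s e i} → e ≤ i → Room 1 e w → Room s (suc i) w → Room s i (map (lowerAbove e) w)
Room-lower-> {w} {s} {e} {i} e≤i free r = mkRoom go
  where
  go : ∀ j → j < i → s + j + cnt i (map (lowerAbove e) w) ≤ i + cnt j (map (lowerAbove e) w)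
  go j j<i with j <? e
  ... | yes j<e rewrite cnt-lower-≥ w e≤i | cnt-lower-< w j<e = chain s j e i (slack free j j<e)
      (slack r e (s≤s e≤i))
  ... | no  j≮e rewrite cnt-lower-≥ w e≤i | cnt-lower-≥ w (≮⇒≥ j≮e) =
    s≤s⁻¹ (subst (λ n → n + cnt (suc i) w ≤ suc i + cnt (suc j) w) (+-suc s j) (slack r (suc j) (s≤s j<i)))

-- The interval (j , i] contains no more letters of a subword than of the word; both differences of
-- counts are moved across the inequality.
cnt-sel-diff : ∀ {i j} b s w → j ≤ i →
               cnt i (sel b s w) + cnt j w ≤ cnt i w + cnt j (sel b s w)
cnt-sel-diff {i} {j} b s w j≤i = go b s w
  where
  bump : ∀ {p q r t} → p + q ≤ r + t → p + suc q ≤ suc r + t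
  bump {p} {q} {r} {t} le = subst (_≤ suc r + t) (sym (+-suc p q)) (s≤s le)
  bump₂ : ∀ {p q r t} → p + q ≤ r + t → suc p + suc q ≤ suc r + suc t
  bump₂ {p} {q} {r} {t} le = s≤s (subst₂ _≤_ (sym (+-suc p q)) (sym (+-suc r t)) (s≤s le))
  go : ∀ b s w → cnt i (sel b s w) + cnt j w ≤ cnt i w + cnt j (sel b s w)
  skip : ∀ b s x w → cnt i (sel b s w) + cnt j (x ∷ w) ≤ cnt i (x ∷ w) + cnt j (sel b s w)
  keep : ∀ b s x w → cnt i (x ∷ sel b s w) + cnt j (x ∷ w) ≤ cnt i (x ∷ w) + cnt j (x ∷ sel b s w)
  go b     []          w       = subst (cnt j w ≤_) (sym (+-identityʳ _)) (cnt-mono w j≤i)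
  go b     (_ ∷ s)     []      = z≤n
  go true  (true ∷ s)  (x ∷ w) = keep true s x w
  go true  (false ∷ s) (x ∷ w) = skip true s x w
  go false (true ∷ s)  (x ∷ w) = skip false s x w
  go false (false ∷ s) (x ∷ w) = keep false s x w
  skip b s x w with x ≤ᵇ i | ≤ᵇ-reflects-≤ x i | x ≤ᵇ j | ≤ᵇ-reflects-≤ x j
  ... | true | ofʸ p | true | ofʸ q = bump {cnt i (sel b s w)} {cnt j w} {cnt i w}
      {cnt j (sel b s w)} (go b s w)
  ... | true | ofʸ p | false | ofⁿ ¬q = m≤n⇒m≤1+n (go b s w)
  ... | false | ofⁿ ¬p | true | ofʸ q = contradiction (≤-trans q j≤i) ¬p
  ... | false | ofⁿ ¬p | false | ofⁿ ¬q = go b s w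
  keep b s x w with x ≤ᵇ i | ≤ᵇ-reflects-≤ x i | x ≤ᵇ j | ≤ᵇ-reflects-≤ x j
  ... | true | ofʸ p | true | ofʸ q = bump₂ {cnt i (sel b s w)} {cnt j w} {cnt i w}
      {cnt j (sel b s w)} (go b s w)
  ... | true | ofʸ p | false | ofⁿ ¬q = s≤s (go b s w)
  ... | false | ofⁿ ¬p | true | ofʸ q = contradiction (≤-trans q j≤i) ¬p
  ... | false | ofⁿ ¬p | false | ofⁿ ¬q = go b s w

-- `Room` only bounds numbers of letters in intervals from above, and these numbers do not grow
-- under selection.
Room-sel : ∀ {k i} b s → Room k i w → Room k i (sel b s w)
Room-sel {w} {k} {i} b s r = mkRoom λ j j<i →
  transfer (k + j) i (cnt-sel-diff b s w (<⇒≤ j<i)) (slack r j j<i)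

-- Parkization always lowers at the first empty spot.  Allowing every empty spot makes
-- the relation stable under the selection of positions.
infix 4 _↠_

data _↠_ : List ℕ → List ℕ → Set where
  done : w ↠ w
  step : ∀ e → 1 ≤ e → Room 1 e w → map (lowerAbove e) w ↠ z → w ↠ z

↠-trans : w ↠ v → v ↠ z → w ↠ z
↠-trans done              t = t
↠-trans (step e 1≤e r s) t = step e 1≤e r (↠-trans s t)

-- The same spots are deleted in the same order. They remain empty for the subword, although they
-- need not be its first empty spots.
↠-sel : ∀ b s → w ↠ z → sel b s w ↠ sel b s z
↠-sel b s done = done
↠-sel {w} b s (step e 1≤e r t) =
  step e 1≤e (Room-sel b s r) (subst (_↠ _) (sel-map b s (lowerAbove e) w) (↠-sel b s t))

↠-length : w ↠ z → length z ≡ length w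
↠-length done                = refl
↠-length {w} (step e _ _ t) = trans (↠-length t) (length-map (lowerAbove e) w)

-- Counts replace the sorted rearrangement, since they are compatible with selecting positions.
record Parking (w : List ℕ) : Set where
  constructor mkParking
  field
    positive : All (1 ≤_) w
    filled   : ∀ j → j ≤ length w → j ≤ cnt j w
open Parking public

bounded : Parking w → All (_≤ length w) w
bounded {w} pw = cnt-full⇒All w (filled pw _ ≤-refl)

-- An empty spot of a parking word lies beyond its length, hence beyond all its letters. So parking
-- words are fixed points of `_↠_`, not normal forms: trivial steps remain possible.
parking-fixed : ∀ {e} → Parking w → 1 ≤ e → Room 1 e w → map (lowerAbove e) w ≡ w
parking-fixed {w} {e} pw 1≤e r with e ≤? length w
... | yes e≤k = contradiction (≤-trans (slack r 0 1≤e)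
    (≤-reflexive (trans (cong (e +_) (cnt-0 (positive pw))) (+-identityʳ e))))
                              (<⇒≱ (s≤s (filled pw e e≤k)))
... | no  e≰k = trans (go (bounded pw)) (map-id w)
  where
  go : ∀ {k} → All (_≤ length w) k → map (lowerAbove e) k ≡ map id k
  go []       = refl
  go (p ∷ ps) = cong₂ _∷_ (lowerAbove-≤ (≤-trans p (<⇒≤ (≰⇒> e≰k)))) (go ps)

-- Lowering at two empty spots e < f can be done in either order, the spot f being
-- renumbered f − 1 once e is deleted; and a parking word is fixed.
↠-step : ∀ {e} → w ↠ z → Parking z → 1 ≤ e → Room 1 e w → map (lowerAbove e) w ↠ z
↠-step done pz 1≤e r = subst (_↠ _) (sym (parking-fixed pz 1≤e r)) done
↠-step {w} {z} {e} (step f 1≤f r′ t) pz 1≤e r with <-cmp e f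
... | tri≈ _ refl _ = t
... | tri< e<f@(s≤s {n = f₀} e≤f₀) _ _ =
      step f₀ (≤-trans 1≤e e≤f₀) (Room-lower-> e≤f₀ r r′)
        (subst (_↠ z) (sym (lower-comm w e≤f₀)) (↠-step t pz 1≤e (Room-lower-< e<f r)))
... | tri> _ _ f<e@(s≤s {n = e₀} f≤e₀) =
      step f 1≤f (Room-lower-< f<e r′)
        (subst (_↠ z) (lower-comm w f≤e₀)
          (↠-step t pz (≤-trans 1≤f f≤e₀) (Room-lower-> f≤e₀ r′ r)))

-- Confluence: a reduction to a parking word can be resumed after any other reduction of the same
-- word.
absorb : w ↠ v → w ↠ z → Parking z → v ↠ z
absorb done              t pz = t
absorb (step e 1≤e r s) t pz = absorb s (↠-step t pz 1≤e r) pz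

parking-↠ : Parking w → w ↠ z → w ≡ z
parking-↠ pw done = refl
parking-↠ pw (step e 1≤e r t) rewrite parking-fixed pw 1≤e r = parking-↠ pw t

-- Parkization as a relation: any sequence of deletions that ends in a parking word counts, not only
-- the one that `Park` follows.
record Parks (w z : List ℕ) : Set where
  constructor _,ᵖ_
  field
    reduces : w ↠ z
    parked  : Parking z
open Parks public

Parks-unique : ∀ {z′} → Parks w z → Parks w z′ → z ≡ z′
Parks-unique (s ,ᵖ pz) (t ,ᵖ pz′) = parking-↠ pz (absorb s t pz′)

Parks-refl : Parking w → Parks w w
Parks-refl pw = done ,ᵖ pw

-- Each deletion at a spot up to `i` lowers the threshold by one, whereas the positions of the
-- letters up to it never change.
Room-↠ : ∀ {i} → w ↠ z → Room 0 i w → ∃[ i′ ] Room 0 i′ z × mask i′ z ≡ mask i w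
Room-↠ {i = i} done r = i , r , refl
Room-↠ {w} {i = i} (step e 1≤e free t) r with i <? e
... | yes i<e = let i′ , r′ , eq = Room-↠ t (Room-lower-< i<e r) in i′ , r′ , trans eq (mask-lower-< w i<e)
... | no  i≮e with m≤n⇒m<n∨m≡n (≮⇒≥ i≮e)
...   | inj₁ (s≤s {n = i₀} e≤i₀) =
        let i′ , r′ , eq = Room-↠ t (Room-lower-> e≤i₀ free r) in i′ , r′ , trans eq (mask-lower-≥ w e≤i₀)
-- Here the spot `suc i₀` is itself deleted. Being empty, it is no letter of `w`, so the threshold
-- may be lowered to `i₀` before the deletion.
Room-↠ {w} {i = suc i₀} (step _ 1≤e free t) r | no  i≮e | inj₂ refl =
        let i′ , r′ , eq = Room-↠ t (Room-lower-< ≤-refl room₀) in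
        i′ , r′ , trans eq (trans (mask-lower-< w ≤-refl) same)
  where
  same : mask i₀ w ≡ mask (suc i₀) w
  same = cnt-≤⇒mask-≡ w (n≤1+n i₀) (+-cancelˡ-≤ (suc i₀) _ _ (slack free i₀ ≤-refl))
  room₀ : Room 0 i₀ w
  room₀ = mkRoom λ j j<i₀ → s≤s⁻¹ (subst (λ n → suc j + n ≤ suc i₀ + cnt j w)
      (sym (cong trues same)) (slack free j (m≤n⇒m≤1+n j<i₀)))

-- Up to the length, `filled` and the room at `i` squeeze `cnt i w` to `i`. Beyond it every letter
-- is counted, and the mask no longer depends on the threshold.
Room-parking : ∀ {i} → Parking w → Room 0 i w → mask (cnt i w) w ≡ mask i w
Room-parking {w} {i} pw r with i ≤? length w
... | yes i≤k = cong (λ n → mask n w) (≤-antisym (upper i r) (filled pw i i≤k))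
  where
  upper : ∀ i → Room 0 i w → cnt i w ≤ i
  upper zero    _ = ≤-reflexive (cnt-0 (positive pw))
  upper (suc i) r = ≤-trans (slack r 0 (s≤s z≤n))
      (≤-reflexive (trans (cong (suc i +_) (cnt-0 (positive pw))) (+-identityʳ _)))
... | no  i≰k = begin
  mask (cnt i w) w   ≡⟨ cong (λ n → mask n w) (cnt-All-≤ (All.map (λ p → ≤-trans p k≤i) (bounded pw))) ⟩
  mask (length w) w  ≡⟨ cnt-≤⇒mask-≡ w k≤i (≤-trans (cnt≤length i w) (filled pw _ ≤-refl)) ⟩
  mask i w           ∎
  where
  open ≡-Reasoning
  k≤i = <⇒≤ (≰⇒> i≰k)

-- The threshold that marks the same positions after parkization is their number, because that is
-- where the parking word breaks.
mask-Parks : ∀ {i} → Parks w z → Room 0 i w → mask (cnt i w) z ≡ mask i w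
mask-Parks {z = z} (t ,ᵖ pz) r =
  let i′ , r′ , eq = Room-↠ t r
  in trans (cong (λ s → mask (trues s) z) (sym eq)) (trans (Room-parking pz r′) eq)

-- Breakpoints

-- At a breakpoint `i` of a parking word these are the two factors of the corresponding coproduct
-- term: the low letters are parked already, and the high ones only need to be shifted down by `i`.
lowPart highPart : ℕ → List ℕ → List ℕ
lowPart  i w = sel true (mask i w) w
highPart i w = map (_∸ i) (sel false (mask i w) w)

mask-∸ : ∀ i j w → mask j (map (_∸ i) w) ≡ mask (i + j) w
mask-∸ i j w = mask-cong w (_∸ i) (All.universal
  (λ x → (λ p → ≤-trans (m≤n+m∸n x i) (+-monoʳ-≤ i p)) , m≤n+o⇒m∸n≤o x i) w)

mask-+ : ∀ i j w → mask (i + j) (map (i +_) w) ≡ mask j w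
mask-+ i j w = mask-cong w (i +_) (All.universal (λ x → +-cancelˡ-≤ i x j , +-monoʳ-≤ i) w)

mask-merge : ∀ {i} s {v w} → All (_≤ i) v → All (i <_) w → trues s ≡ length v → falses s ≡ length w →
             mask i (merge s v w) ≡ s
mask-merge []          _        _        p q = refl
mask-merge {i} (true ∷ s)  {x ∷ v} {w} (x≤i ∷ v≤i) w>i p q with x ≤ᵇ i | ≤ᵇ-reflects-≤ x i
... | true  | _       = cong (true ∷_) (mask-merge s v≤i w>i (suc-injective p) q)
... | false | ofⁿ x≰i = contradiction x≤i x≰i
mask-merge {i} (false ∷ s) {v} {x ∷ w} v≤i (i<x ∷ w>i) p q with x ≤ᵇ i | ≤ᵇ-reflects-≤ x i
... | true  | ofʸ x≤i = contradiction x≤i (<⇒≱ i<x)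
... | false | _       = cong (false ∷_) (mask-merge s v≤i w>i p (suc-injective q))

+-∸-inverse : ∀ i → All (i ≤_) w → map (i +_) (map (_∸ i) w) ≡ w
+-∸-inverse i []       = refl
+-∸-inverse i (p ∷ ps) = cong₂ _∷_ (m+[n∸m]≡n p) (+-∸-inverse i ps)

∸-+-inverse : ∀ i w → map (_∸ i) (map (i +_) w) ≡ w
∸-+-inverse i w = trans (sym (map-∘ w)) (trans (map-cong (λ x → m+n∸m≡n i x) w) (map-id w))

highPart-+ : ∀ i w → map (i +_) (highPart i w) ≡ sel false (mask i w) w
highPart-+ i w = +-∸-inverse i (All.map <⇒≤ (sel-mask-> i w))

above-positive : ∀ i → All (1 ≤_) w → All (i <_) (map (i +_) w)
above-positive i pos = All.map⁺ (All.map (m<m+n i) pos)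

-- Spot 1 is deleted `i` times; as long as a positive shift remains, every letter exceeds 1 and that
-- spot is empty.
shift-↠ : ∀ i → All (1 ≤_) w → map (i +_) w ↠ w
shift-↠ {w} zero    pos = subst (_↠ w) (sym (map-id w)) done
shift-↠ {w} (suc i) pos = step 1 ≤-refl free (subst (_↠ w) (sym (lowered pos)) (shift-↠ i pos))
  where
  lowered : ∀ {v} → All (1 ≤_) v → map (lowerAbove 1) (map (suc i +_) v) ≡ map (i +_) v
  lowered []       = refl
  lowered (p ∷ ps) = cong₂ _∷_ (lowerAbove-> (s≤s (≤-trans p (m≤n+m _ i)))) (lowered ps)
  free : Room 1 1 (map (suc i +_) w)
  free = mkRoom λ { zero _ → s≤s (≤-trans (≤-reflexive (cnt-All->
    (All.map (≤-trans (s≤s (s≤s z≤n))) (above-positive (suc i) pos)))) z≤n) ; (suc j) (s≤s ()) }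

record Breakpoint (i : ℕ) (w : List ℕ) : Set where
  constructor mkBreakpoint
  field
    break : cnt i w ≡ i
open Breakpoint public

module _ {i} (pw : Parking w) (bp : Breakpoint i w) where
  break≤length : i ≤ length w
  break≤length = subst (_≤ length w) (break bp) (cnt≤length i w)

  -- Of the `i` letters up to `i`, at least `j` are at most `j` by `filled`; so at most i - j of
  -- them lie in (j , i].
  Breakpoint⇒Room : Room 0 i w
  Breakpoint⇒Room = mkRoom λ j j<i → subst (λ n → j + n ≤ i + cnt j w) (sym (break bp))
    (≤-trans (≤-reflexive (+-comm j i)) (+-monoʳ-≤ i (filled pw j (≤-trans (<⇒≤ j<i) break≤length))))

  length-lowPart : length (lowPart i w) ≡ i
  length-lowPart = trans (length-sel-true (mask i w) w (mask-length i w)) (break bp)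

  length-sel+highPart : i + length (sel false (mask i w) w) ≡ length w
  length-sel+highPart = trans (cong₂ _+_ (sym (break bp)) (length-sel-false (mask i w) w (mask-length i w)))
    (trans (trues+falses (mask i w)) (mask-length i w))

  length-highPart : i + length (highPart i w) ≡ length w
  length-highPart = trans (cong (i +_) (length-map _ (sel false (mask i w) w))) length-sel+highPart

  cnt-lowPart : ∀ {j} → j ≤ i → cnt j (lowPart i w) ≡ cnt j w
  cnt-lowPart {j} j≤i = sym (trans (cnt-sel j (mask i w) w (mask-length i w))
    (trans (cong (cnt j (lowPart i w) +_) (cnt-All-> (All.map (≤-<-trans j≤i) (sel-mask-> i w))))
        (+-identityʳ _)))

  cnt-highPart : ∀ j → i + cnt j (highPart i w) ≡ cnt (i + j) w
  cnt-highPart j = sym (trans (cnt-sel (i + j) (mask i w) w (mask-length i w))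
    (cong₂ _+_ (trans (cnt-All-≤ (All.map (λ p → ≤-trans p (m≤m+n i j)) (sel-mask-≤ i w))) length-lowPart)
               (sym (cong trues (mask-∸ i j (sel false (mask i w) w))))))

  lowPart-parking : Parking (lowPart i w)
  lowPart-parking = mkParking (All-sel true (mask i w) (positive pw)) λ j j≤ →
    let j≤i = subst (j ≤_) length-lowPart j≤ in
    subst (j ≤_) (sym (cnt-lowPart j≤i)) (filled pw j (≤-trans j≤i break≤length))

  highPart-parking : Parking (highPart i w)
  highPart-parking = mkParking (All.map⁺ (All.map m<n⇒0<n∸m (sel-mask-> i w))) λ j j≤ →
    +-cancelˡ-≤ i j _ (subst (i + j ≤_) (sym (cnt-highPart j))
      (filled pw (i + j) (subst (i + j ≤_) length-highPart (+-monoʳ-≤ i j≤))))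

  highPart-Parks : Parks (sel false (mask i w) w) (highPart i w)
  highPart-Parks = subst (_↠ highPart i w) (highPart-+ i w) (shift-↠ i (positive highPart-parking))
      ,ᵖ highPart-parking

-- Inverse to w ↦ (lowPart i w , highPart i w) on words with a given mask.
module _ {c c′ : List ℕ} (pc : Parking c) (pc′ : Parking c′) (s : List Bool)
         (ts : trues s ≡ length c) (fs : falses s ≡ length c′) where
  private
    i = length c
    c″ = map (i +_) c′
    fs″ = trans fs (sym (length-map (i +_) c′))

  join : List ℕ
  join = merge s c c″

  length-join : length join ≡ length s
  length-join = length-merge s c c″ ts fs″

  sel-true-join : sel true s join ≡ c
  sel-true-join = sel-true-merge s c c″ ts fs″

  sel-false-join : sel false s join ≡ c″
  sel-false-join = sel-false-merge s c c″ ts fs″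

  mask-join : mask i join ≡ s
  mask-join = mask-merge s (bounded pc) (above-positive i (positive pc′)) ts fs″

  join-break : Breakpoint i join
  join-break = mkBreakpoint (trans (cong trues mask-join) ts)

  lowPart-join : lowPart i join ≡ c
  lowPart-join = trans (cong (λ m → sel true m join) mask-join) sel-true-join

  highPart-join : highPart i join ≡ c′
  highPart-join = trans (cong (λ m → map (_∸ i) (sel false m join)) mask-join)
    (trans (cong (map (_∸ i)) sel-false-join) (∸-+-inverse i c′))

  -- Up to `i` the letters of `c` alone fill the spots. Beyond `i` all of them count, and `c′` fills
  -- the spots shifted by `i`.
  join-parking : Parking join
  join-parking = mkParking
    (All-merge s (positive pc) (All.map (≤-trans (s≤s z≤n)) (above-positive i (positive pc′)))) fill
    where
    cnt-join : ∀ j → cnt j join ≡ cnt j c + cnt j c″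
    cnt-join j = trans (cnt-sel j s join (sym length-join))
        (cong₂ (λ x y → cnt j x + cnt j y) sel-true-join sel-false-join)
    fill : ∀ j → j ≤ length join → j ≤ cnt j join
    fill j j≤ with ≤-total j i
    ... | inj₁ j≤i = ≤-trans (filled pc j j≤i) (subst (cnt j c ≤_) (sym (cnt-join j)) (m≤m+n _ _))
    ... | inj₂ i≤j = subst₂ _≤_ (m+[n∸m]≡n i≤j) (trans eq (cong (λ n → cnt n join) (m+[n∸m]≡n i≤j)))
                       (+-monoʳ-≤ i (filled pc′ k (+-cancelˡ-≤ i k _ k≤)))
      where
      k = j ∸ i
      k≤ : i + k ≤ i + length c′
      k≤ = subst₂ _≤_ (sym (m+[n∸m]≡n i≤j)) (trans length-join
          (trans (sym (trues+falses s)) (cong₂ _+_ ts fs))) j≤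
      eq : i + cnt k c′ ≡ cnt (i + k) join
      eq = sym (trans (cnt-join (i + k)) (cong₂ _+_
        (cnt-All-≤ (All.map (λ p → ≤-trans p (m≤m+n i k)) (bounded pc))) (cong trues (mask-+ i k c′))))

module _ {i x a} (px : Parks x a) (room : Room 0 i x) where
  private
    j = cnt i x
    mask-eq : mask j a ≡ mask i x
    mask-eq = mask-Parks px room

  Parks-break : Breakpoint j a
  Parks-break = mkBreakpoint (cong trues mask-eq)

  -- The masks of `x` and `a` agree, so the same positions are selected at both ends of the
  -- reduction.
  Parks-lowPart : Parks (lowPart i x) (lowPart j a)
  Parks-lowPart = subst (λ s → sel true (mask i x) x ↠ sel true s a) (sym mask-eq)
      (↠-sel true (mask i x) (reduces px))
    ,ᵖ lowPart-parking (parked px) Parks-break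

  Parks-sel-highPart : Parks (sel false (mask i x) x) (highPart j a)
  Parks-sel-highPart = ↠-trans
      (subst (λ s → sel false (mask i x) x ↠ sel false s a) (sym mask-eq)
          (↠-sel false (mask i x) (reduces px)))
      (reduces (highPart-Parks (parked px) Parks-break))
    ,ᵖ highPart-parking (parked px) Parks-break

  -- Subtracting `i` from the high letters is itself a sequence of deletions, so by confluence it
  -- does not affect their parkization.
  Parks-highPart : Parks (highPart i x) (highPart j a)
  Parks-highPart = absorb (subst (_↠ highPart i x) (highPart-+ i x)
      (shift-↠ i (All.map⁺ (All.map m<n⇒0<n∸m (sel-mask-> i x))))) (reduces Parks-sel-highPart)
          (parked Parks-sel-highPart)
    ,ᵖ parked Parks-sel-highPart

-- A parking word is determined by a mask of a breakpoint together with both parts.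
Parks-from-parts : ∀ {i j x a a′} → Parks x a′ → Room 0 i x → Parking a → Breakpoint j a → mask i x
    ≡ mask j a →
  Parks (lowPart i x) (lowPart j a) → Parks (sel false (mask i x) x) (highPart j a) → Parks x a
Parks-from-parts {i} {j} {x} {a} {a′} px room pa bp m lo hi = subst (Parks x) same px
  where
  j′ : cnt i x ≡ j
  j′ = trans (cong trues m) (break bp)
  ma′ : mask j a′ ≡ mask j a
  ma′ = trans (cong (λ n → mask n a′) (sym j′)) (trans (mask-Parks px room) m)
  lows : sel true (mask j a) a′ ≡ sel true (mask j a) a
  lows = trans (cong (λ s → sel true s a′) (sym ma′))
    (Parks-unique (subst (λ n → Parks (lowPart i x) (lowPart n a′)) j′ (Parks-lowPart px room)) lo)
  highs : sel false (mask j a) a′ ≡ sel false (mask j a) a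
  highs = trans (cong (λ s → sel false s a′) (sym ma′)) (trans (sym (highPart-+ j a′))
    (trans (cong (map (j +_)) (Parks-unique
       (subst (λ n → Parks (sel false (mask i x) x) (highPart n a′)) j′ (Parks-sel-highPart px room)) hi))
     (highPart-+ j a)))
  len : length (mask j a) ≡ length a′
  len = trans (cong length (sym ma′)) (mask-length j a′)
  same : a′ ≡ a
  same = trans (sym (merge-sel (mask j a) a′ len))
    (trans (cong₂ (merge (mask j a)) lows highs) (merge-sel (mask j a) a (mask-length j a)))

-- Prefixes and suffixes

merge-++ : ∀ s t (v v′ w w′ : List X) → trues s ≡ length v → falses s ≡ length w →
           merge (s ++ t) (v ++ v′) (w ++ w′) ≡ merge s v w ++ merge t v′ w′
merge-++ []          t []      v′ []      w′ p q = refl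
merge-++ (true ∷ s)  t (x ∷ v) v′ w       w′ p q = cong (x ∷_) (merge-++ s t v v′ w w′ (suc-injective p) q)
merge-++ (false ∷ s) t v       v′ (x ∷ w) w′ p q = cong (x ∷_) (merge-++ s t v v′ w w′ p (suc-injective q))

Room-++ˡ : ∀ {k i} x y → Room k i (x ++ y) → Room k i x
Room-++ˡ {k} {i} x y r = subst (Room k i)
  (trans (sel-++ true (replicate (length x) true) (replicate (length y) false) x y (length-replicate _))
    (trans (cong₂ _++_ (sel-all true x) (sel-none true y)) (++-identityʳ x)))
  (Room-sel true (replicate (length x) true ++ replicate (length y) false) r)

Room-++ʳ : ∀ {k i} x y → Room k i (x ++ y) → Room k i y
Room-++ʳ {k} {i} x y r = subst (Room k i)
  (trans (sel-++ true (replicate (length x) false) (replicate (length y) true) x y (length-replicate _))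
    (cong₂ _++_ (sel-none true x) (sel-all true y)))
  (Room-sel true (replicate (length x) false ++ replicate (length y) true) r)

take-sel : ∀ n (w : List X) → sel true (replicate n true) w ≡ take n w
take-sel zero    w       = refl
take-sel (suc n) []      = refl
take-sel (suc n) (x ∷ w) = cong (x ∷_) (take-sel n w)

-- The run of trues may be longer than necessary, so that a mask built from one word also serves
-- another of the same length.
drop-sel : ∀ n k (w : List X) → length w ≤ k → sel true (replicate n false ++ replicate k true) w ≡ drop n w
drop-sel zero    zero    []      _        = refl
drop-sel zero    (suc k) []      _        = refl
drop-sel zero    (suc k) (x ∷ w) (s≤s le) = cong (x ∷_) (drop-sel zero k w le)
drop-sel (suc n) k       []      _        = refl
drop-sel (suc n) k       (x ∷ w) le       = drop-sel n k w (<⇒≤ le)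

↠-take : ∀ n → w ↠ v → take n w ↠ take n v
↠-take n t = subst₂ _↠_ (take-sel n _) (take-sel n _) (↠-sel true (replicate n true) t)

↠-drop : ∀ n → w ↠ v → drop n w ↠ drop n v
↠-drop {w} {v} n t = subst₂ _↠_ (drop-sel n _ w ≤-refl) (drop-sel n _ v (≤-reflexive (↠-length t)))
  (↠-sel true (replicate n false ++ replicate (length w) true) t)

↠-Parks : w ↠ v → Parks v z → Parks w z
↠-Parks t (t′ ,ᵖ pz) = ↠-trans t t′ ,ᵖ pz

-- Coloured parking functions as pairs of lists

length-filter≡cnt : ∀ j w → length (filter (_≤? j) w) ≡ cnt j w
length-filter≡cnt j []      = refl
length-filter≡cnt j (x ∷ w) with x ≤ᵇ j
... | true  = cong suc (length-filter≡cnt j w)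
... | false = length-filter≡cnt j w

lettersUpTo≡cnt : ∀ j (w : Vec ℕ κ) → lettersUpTo j w ≡ cnt j (toList w)
lettersUpTo≡cnt j w = trans (sym (count-toList j w)) (length-filter≡cnt j (toList w))

length-toList : (w : Vec X κ) → length (toList w) ≡ κ
length-toList w = Vec.length-toList w

initial-≤⇒≤cnt : ∀ {j} n s → n ≤ length s → (∀ i → toℕ i < n → lookup s i ≤ j) → n ≤ cnt j s
initial-≤⇒≤cnt zero    s       _        _ = z≤n
initial-≤⇒≤cnt {j} (suc n) (x ∷ s) (s≤s le) f with x ≤ᵇ j | ≤ᵇ-reflects-≤ x j
... | true  | _       = s≤s (initial-≤⇒≤cnt n s le (λ i lt → f (suc i) (s≤s lt)))
... | false | ofⁿ x≰j = contradiction (f zero (s≤s z≤n)) x≰j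

IsParking⇒Parking : (w : Vec ℕ κ) → IsParking w → Parking (toList w)
IsParking⇒Parking w (range , sorted) = mkParking (VecAll.toList⁺ (VecAll.map proj₁ range)) fill
  where
  s = sort (toList w)
  perm = sort-↭ (toList w)
  fill : ∀ j → j ≤ length (toList w) → j ≤ cnt j (toList w)
  fill j j≤ = subst (j ≤_)
    (trans (sym (length-filter≡cnt j s)) (trans (↭-length (filter-↭ (_≤? j) perm))
        (length-filter≡cnt j (toList w))))
    (initial-≤⇒≤cnt j s (subst (j ≤_) (sym (↭-length perm)) j≤) (λ i i<j → ≤-trans (sorted i) i<j))

-- The spot chosen by `Park` is empty: fewer than `d w` letters are at most `d w`, while by
-- minimality each smaller `j` has at least `j` letters up to it.
d-Room : (w : Vec ℕ κ) → Room 1 (d w) (toList w)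
d-Room w = mkRoom λ j j<d → subst₂ _≤_ (cong suc (trans (+-comm _ j) (cong (j +_) (lettersUpTo≡cnt (d w) w))))
    (cong (d w +_) (lettersUpTo≡cnt j w)) (+-mono-≤ (d-deficit w) (few j j<d))
  where
  few : ∀ j → j < d w → j ≤ lettersUpTo j w
  few zero    _   = z≤n
  few (suc j) j<d = d-least w (suc j) (s≤s z≤n) j<d

parkAcc-↠ : (w : Vec ℕ κ) (a : Acc _<_ (Vec.sum w)) → toList w ↠ toList (parkAcc w a)
parkAcc-↠ {κ} w (acc rs) with d w ≟ suc κ
... | yes _    = done
... | no d≢1+k = step (d w) (d-positive w) (d-Room w)
  (subst (_↠ toList (parkAcc (lower (d w) w) (rs (lower-d-< w d≢1+k)))) (Vec.toList-map (lowerAbove (d w)) w)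
    (parkAcc-↠ (lower (d w) w) (rs (lower-d-< w d≢1+k))))

Park-Parks : (w : Vec ℕ κ) → VecAll.All (1 ≤_) w → Parks (toList w) (toList (Park w))
Park-Parks w pos = parkAcc-↠ w (<-wellFounded _) ,ᵖ IsParking⇒Parking (Park w) (Park-isParking w pos)

toList-fromList : (w : List X) → toList (Vec.fromList w) ≡ w
toList-fromList = Vec.toList∘fromList

fromList-All : ∀ {p} {P : X → Set p} (w : List X) → All P w → VecAll.All P (Vec.fromList w)
fromList-All {P = P} w pw = VecAll.toList⁻ (subst (All P) (sym (toList-fromList w)) pw)

park : (w : List ℕ) → All (1 ≤_) w → ∃[ z ] Parks w z
park w pos = toList (Park (Vec.fromList w)) ,
  subst (λ v → Parks v (toList (Park (Vec.fromList w)))) (toList-fromList w)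
      (Park-Parks (Vec.fromList w) (fromList-All w pos))

toList-injective : (v w : Vec X κ) → toList v ≡ toList w → v ≡ w
toList-injective v w eq = trans (sym (Vec.cast-is-id refl v)) (Vec.toList-injective refl v w eq)

-- Sorting is avoided: by uniqueness `w` is its own parkization, and the values of `Park` are known
-- to satisfy `IsParking`.
Parking⇒IsParking : (w : Vec ℕ κ) → Parking (toList w) → IsParking w
Parking⇒IsParking {κ} w pw = subst IsParking (toList-injective (Park w) w
    (sym (Parks-unique (Parks-refl pw) (Park-Parks w pos)))) (Park-isParking w pos)
  where
  pos = VecAll.toList⁻ (positive pw)

toList-take : ∀ m {n} (w : Vec X (m + n)) → toList (Vec.take m w) ≡ take m (toList w)
toList-take zero    w       = refl
toList-take (suc m) (x ∷ w) = cong (x ∷_) (toList-take m w)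

toList-drop : ∀ m {n} (w : Vec X (m + n)) → toList (Vec.drop m w) ≡ drop m (toList w)
toList-drop zero    w       = refl
toList-drop (suc m) (x ∷ w) = toList-drop m w

module _ {l : ℕ} where
  private
    B = ColouredParkingFunction l
    A = Fin l
  open ColouredParkingFunction using (size; parkingFunction; word; colours)

  letters : B → List ℕ
  letters b = toList (word b)

  hues : B → List A
  hues b = toList (colours b)

  length-letters : ∀ b → length (letters b) ≡ size b
  length-letters b = length-toList (word b)

  length-hues : ∀ b → length (hues b) ≡ length (letters b)
  length-hues b = trans (length-toList (colours b)) (sym (length-letters b))

  -- The proof stored in a parking function is irrelevant; decidability of `IsParking` makes it
  -- usable again.
  letters-parking : ∀ b → Parking (letters b)
  letters-parking (coloured _ (parking w p) _) = IsParking⇒Parking w (recompute (isParking? w) p)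

  -- The size indexes both vectors, which blocks a direct comparison; equal lists have equal
  -- lengths, and this first identifies the sizes.
  coloured-≡ : ∀ {b b′} → letters b ≡ letters b′ → hues b ≡ hues b′ → b ≡ b′
  coloured-≡ {coloured n (parking w p) u} {coloured n′ (parking w′ p′) u′} eq eq′
    with trans (sym (length-toList w)) (trans (cong length eq) (length-toList w′))
  ... | refl with toList-injective w w′ eq | toList-injective u u′ eq′
  ...   | refl | refl = refl

  fromLists : (w : List ℕ) (u : List A) → length u ≡ length w → Parking w → B
  fromLists w u eq pw = coloured (length w)
    (parking (Vec.fromList w) (Parking⇒IsParking (Vec.fromList w)
        (subst Parking (sym (toList-fromList w)) pw)))
    (Vec.cast eq (Vec.fromList u))

  letters-fromLists : ∀ w u eq pw → letters (fromLists w u eq pw) ≡ w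
  letters-fromLists w u eq pw = toList-fromList w

  hues-fromLists : ∀ w u eq pw → hues (fromLists w u eq pw) ≡ u
  hues-fromLists w u eq pw = trans (Vec.toList-cast eq (Vec.fromList u)) (toList-fromList u)

  ∈-breakpoints⁺ : ∀ {i} b → Breakpoint i (letters b) → i ∈ breakpoints (word b)
  ∈-breakpoints⁺ {i} b bp = ∈-filter⁺ (λ b′ → lettersUpTo b′ (word b) ≟ b′)
    (∈-upTo⁺ (s≤s (subst (i ≤_) (length-letters b) (break≤length (letters-parking b) bp))))
    (trans (lettersUpTo≡cnt i (word b)) (break bp))

  ∈-breakpoints⁻ : ∀ {i} b → i ∈ breakpoints (word b) → Breakpoint i (letters b)
  ∈-breakpoints⁻ {i} b i∈ = mkBreakpoint (trans (sym (lettersUpTo≡cnt i (word b)))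
    (proj₂ (∈-filter⁻ (λ b′ → lettersUpTo b′ (word b) ≟ b′) {xs = upTo (suc (size b))} i∈)))

  breakpoints-unique : ∀ (b : B) → Unique (breakpoints (word b))
  breakpoints-unique b = Unique.filter⁺ (λ i → lettersUpTo i (word b) ≟ i) (Unique.upTo⁺ (suc (size b)))

  private
    between : ℕ → ℕ → ℕ → Bool
    between i j x = does ((i ≤? x) ×-dec (x ≤? j))

    map-proj₁-subword : ∀ i j (w : Vec ℕ κ) (u : Vec A κ) →
      map proj₁ (subword i j w u) ≡ sel true (map (between i j) (toList w)) (toList w)
    map-proj₁-subword i j []      []      = refl
    map-proj₁-subword i j (x ∷ w) (_ ∷ u) with between i j x
    ... | true  = cong (x ∷_) (map-proj₁-subword i j w u)
    ... | false = map-proj₁-subword i j w u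

    map-proj₂-subword : ∀ i j (w : Vec ℕ κ) (u : Vec A κ) →
      map proj₂ (subword i j w u) ≡ sel true (map (between i j) (toList w)) (toList u)
    map-proj₂-subword i j []      []      = refl
    map-proj₂-subword i j (x ∷ w) (c ∷ u) with between i j x
    ... | true  = cong (c ∷_) (map-proj₂-subword i j w u)
    ... | false = map-proj₂-subword i j w u

    toList-map-fromList : (f : X → Y) (w : List X) → toList (Vec.map f (Vec.fromList w)) ≡ map f w
    toList-map-fromList f w = trans (Vec.toList-map f (Vec.fromList w)) (cong (map f) (toList-fromList w))

    Parks-restrict : ∀ i j b → Parks (sel true (map (between i j) (letters b)) (letters b))
        (letters (restrict i j b))
    Parks-restrict i j b = subst (λ v → Parks v (letters (restrict i j b)))
      (trans (toList-map-fromList proj₁ (subword i j (word b) (colours b)))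
          (map-proj₁-subword i j (word b) (colours b)))
      (Park-Parks _ (subword-positive i j (word b) (colours b)
          (VecAll.toList⁻ (positive (letters-parking b)))))

    hues-restrict : ∀ i j b → hues (restrict i j b) ≡ sel true (map (between i j) (letters b)) (hues b)
    hues-restrict i j b = trans (toList-map-fromList proj₂ (subword i j (word b) (colours b)))
      (map-proj₂-subword i j (word b) (colours b))

    between-1 : ∀ i → All (1 ≤_) w → map (between 1 i) w ≡ mask i w
    between-1 i []             = refl
    between-1 i (_∷_ {x} p ps) = cong₂ _∷_ (does-⇔ (mk⇔ proj₂ (p ,_)) ((1 ≤? x) ×-dec (x ≤? i))
        (x ≤? i)) (between-1 i ps)

    between-suc : ∀ i {n} → All (_≤ n) w → map (between (suc i) n) w ≡ map not (mask i w)
    between-suc i         []             = refl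
    between-suc i {n} (_∷_ {x} p ps) = cong₂ _∷_
      (does-⇔ (mk⇔ (λ (i<x , _) → <⇒≱ i<x) (λ x≰i → ≰⇒> x≰i , p)) ((suc i ≤? x) ×-dec (x ≤? n))
          (¬? (x ≤? i))) (between-suc i ps)

    sel-not : ∀ s (w : List X) → sel true (map not s) w ≡ sel false s w
    sel-not []          w       = refl
    sel-not (true ∷ s)  []      = refl
    sel-not (false ∷ s) []      = refl
    sel-not (true ∷ s)  (x ∷ w) = sel-not s w
    sel-not (false ∷ s) (x ∷ w) = cong (x ∷_) (sel-not s w)

    between-high : ∀ i b → map (between (suc i) (size b)) (letters b) ≡ map not (mask i (letters b))
    between-high i b = between-suc i (All.map (λ p → subst (_ ≤_) (length-letters b) p)
        (bounded (letters-parking b)))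

  module _ (b : B) {i : ℕ} (bp : Breakpoint i (letters b)) where
    letters-low : letters (restrict 1 i b) ≡ lowPart i (letters b)
    letters-low = Parks-unique
      (subst (λ s → Parks (sel true s (letters b)) (letters (restrict 1 i b)))
          (between-1 i (positive (letters-parking b))) (Parks-restrict 1 i b))
      (Parks-refl (lowPart-parking (letters-parking b) bp))

    hues-low : hues (restrict 1 i b) ≡ sel true (mask i (letters b)) (hues b)
    hues-low = trans (hues-restrict 1 i b)
      (cong (λ s → sel true s (hues b)) (between-1 i (positive (letters-parking b))))

    letters-high : letters (restrict (suc i) (size b) b) ≡ highPart i (letters b)
    letters-high = Parks-unique
      (subst (λ w → Parks w (letters (restrict (suc i) (size b) b)))
          (trans (cong (λ s → sel true s (letters b)) (between-high i b))
          (sel-not (mask i (letters b)) (letters b))) (Parks-restrict (suc i) (size b) b))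
      (highPart-Parks (letters-parking b) bp)

    hues-high : hues (restrict (suc i) (size b) b) ≡ sel false (mask i (letters b)) (hues b)
    hues-high = trans (hues-restrict (suc i) (size b) b)
      (trans (cong (λ s → sel true s (hues b)) (between-high i b)) (sel-not (mask i (letters b)) (hues b)))

    size-low : size (restrict 1 i b) ≡ i
    size-low = trans (sym (length-letters (restrict 1 i b)))
      (trans (cong length letters-low) (length-lowPart (letters-parking b) bp))

    size-high : i + size (restrict (suc i) (size b) b) ≡ size b
    size-high = trans (cong (i +_) (trans (sym (length-letters (restrict (suc i) (size b) b)))
        (cong length letters-high)))
      (trans (length-highPart (letters-parking b) bp) (length-letters b))

  -- Members of a convolution

  products : B → B → List B
  products (coloured _ a′ u′) (coloured _ a″ u″) = map (λ a → coloured _ a (u′ Vec.++ u″)) (a′ ✶ a″)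

  -- Membership in the convolution, with the values of `Park` replaced by the relation `Parks` on
  -- lists so that confluence applies.
  record Product (b′ b″ b : B) : Set where
    constructor mkProduct
    field
      sizes   : size b ≡ size b′ + size b″
      first   : Parks (take (size b′) (letters b)) (letters b′)
      second  : Parks (drop (size b′) (letters b)) (letters b″)
      colours : hues b ≡ hues b′ ++ hues b″

  ParkingFunction-≡ : ∀ {κ} {a a′ : ParkingFunction κ} → ParkingFunction.word a ≡
      ParkingFunction.word a′ → a ≡ a′
  ParkingFunction-≡ refl = refl

  toParkingFunction-just : ∀ {κ} (w : Vec ℕ κ) (p : IsParking w) → toParkingFunction w ≡ just (parking w p)
  toParkingFunction-just w p with isParking? w
  ... | yes _ = refl
  ... | no ¬p = contradiction p ¬p

  toParkingFunction-nothing : ∀ {κ} (w : Vec ℕ κ) → ¬ IsParking w → toParkingFunction w ≡ nothing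
  toParkingFunction-nothing w ¬p with isParking? w
  ... | yes p = contradiction p ¬p
  ... | no  _ = refl

  mapMaybe-step : ∀ {p} {P : Set p} {Q : Set p} (f : P → Maybe Q) x xs {m} → f x ≡ m →
                  mapMaybe f (x ∷ xs) ≡ maybe′ _∷_ id m (mapMaybe f xs)
  mapMaybe-step f x xs refl = refl

  -- Forgetting the proofs turns the enumeration into a filtered list of words, where membership and
  -- absence of duplicates are standard.
  map-word-mapMaybe : ∀ {κ} (ws : List (Vec ℕ κ)) →
    map ParkingFunction.word (mapMaybe toParkingFunction ws) ≡ filter isParking? ws
  map-word-mapMaybe []       = refl
  map-word-mapMaybe (w ∷ ws) = case (isParking? w)
    where
    open ≡-Reasoning
    case : Dec (IsParking w) → map ParkingFunction.word (mapMaybe toParkingFunction (w ∷ ws)) ≡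
        filter isParking? (w ∷ ws)
    case (yes p) = begin
      map ParkingFunction.word (mapMaybe toParkingFunction (w ∷ ws))
        ≡⟨ cong (map ParkingFunction.word) (mapMaybe-step toParkingFunction w ws
            (toParkingFunction-just w p)) ⟩
      w ∷ map ParkingFunction.word (mapMaybe toParkingFunction ws)
        ≡⟨ cong (w ∷_) (map-word-mapMaybe ws) ⟩
      w ∷ filter isParking? ws
        ≡⟨ filter-accept isParking? p ⟨
      filter isParking? (w ∷ ws) ∎
    case (no ¬p) = begin
      map ParkingFunction.word (mapMaybe toParkingFunction (w ∷ ws))
        ≡⟨ cong (map ParkingFunction.word) (mapMaybe-step toParkingFunction w ws
            (toParkingFunction-nothing w ¬p)) ⟩
      map ParkingFunction.word (mapMaybe toParkingFunction ws)
        ≡⟨ map-word-mapMaybe ws ⟩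
      filter isParking? ws
        ≡⟨ filter-reject isParking? ¬p ⟨
      filter isParking? (w ∷ ws) ∎

  words-unique : ∀ κ {alphabet} → Unique alphabet → Unique (words κ alphabet)
  words-unique zero    u = [] AllPairs.∷ AllPairs.[]
    where import Data.List.Relation.Unary.AllPairs as AllPairs
  words-unique (suc κ) u = Unique.cartesianProductWith⁺ _∷_ (λ { refl → refl , refl }) u (words-unique κ u)

  ∈-words : ∀ {κ alphabet} (w : Vec ℕ κ) → VecAll.All (_∈ alphabet) w → w ∈ words κ alphabet
  ∈-words []      VecAll.[]       = here refl
  ∈-words (x ∷ w) (p VecAll.∷ ps) = ∈-cartesianProductWith⁺ _∷_ p (∈-words w ps)

  parkingFunctions-unique : ∀ κ → Unique (parkingFunctions κ)
  parkingFunctions-unique κ = Unique.map⁻ (subst Unique (sym (map-word-mapMaybe (words κ _)))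
    (Unique.filter⁺ isParking? (words-unique κ (Unique.map⁺ suc-injective (Unique.upTo⁺ κ)))))

  ∈-parkingFunctions : ∀ {κ} (a : ParkingFunction κ) → a ∈ parkingFunctions κ
  ∈-parkingFunctions {κ} (parking w q) with ∈-map⁻ ParkingFunction.word
      (subst (w ∈_) (sym (map-word-mapMaybe (words κ (map suc (upTo κ)))))
        (∈-filter⁺ isParking? (∈-words w (VecAll.map letter (proj₁ p))) p))
    where
    p : IsParking w
    p = recompute (isParking? w) q
    letter : ∀ {x} → 1 ≤ x × x ≤ κ → x ∈ map suc (upTo κ)
    letter (s≤s z≤n , x≤κ) = ∈-map⁺ suc (∈-upTo⁺ x≤κ)
  ... | a′ , a′∈ , eq = subst (_∈ parkingFunctions κ) (sym (ParkingFunction-≡ {a = parking w q} {a′} eq)) a′∈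

  products-unique : ∀ b′ b″ → Unique (products b′ b″)
  products-unique (coloured i _ _) (coloured j _ _) = Unique.map⁺ (λ { refl → refl })
      (Unique.filter⁺ _ (parkingFunctions-unique (i + j)))

  ∈-products⁻ : ∀ b′ b″ {b} → b ∈ products b′ b″ → Product b′ b″ b
  ∈-products⁻ (coloured i a′ u′) (coloured j a″ u″) b∈ with ∈-map⁻ _ b∈
  ... | a@(parking w _) , a∈ , refl with ∈-filter⁻ _ {xs = parkingFunctions (i + j)} a∈
  ...   | _ , eq′ , eq″ = mkProduct refl
      (subst₂ Parks (toList-take i w) (cong toList eq′) (Park-Parks (Vec.take i w) (VecAll.toList⁻
        (subst (All (1 ≤_)) (sym (toList-take i w)) (All.take⁺ i pos)))))
      (subst₂ Parks (toList-drop i w) (cong toList eq″) (Park-Parks (Vec.drop i w) (VecAll.toList⁻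
        (subst (All (1 ≤_)) (sym (toList-drop i w)) (All.drop⁺ i pos)))))
      (Vec.toList-++ u′ u″)
    where
    pos : All (1 ≤_) (toList w)
    pos = positive (letters-parking (coloured (i + j) a (u′ Vec.++ u″)))

  ∈-products⁺ : ∀ b′ b″ {b} → Product b′ b″ b → b ∈ products b′ b″
  ∈-products⁺ b′@(coloured i a′ u′) b″@(coloured j a″ u″) {b@(coloured n a@(parking w _) u)}
      (mkProduct refl l r c) =
    subst (_∈ products b′ b″) (coloured-≡ refl (trans (Vec.toList-++ u′ u″) (sym c)))
      (∈-map⁺ (λ a → coloured (i + j) a (u′ Vec.++ u″)) (∈-filter⁺ _ (∈-parkingFunctions a)
        ( toList-injective _ _ (Parks-unique (Park-Parks (Vec.take i w) (VecAll.toList⁻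
            (subst (All (1 ≤_)) (sym (toList-take i w)) (All.take⁺ i pos))))
                (subst (λ v → Parks v (toList (ParkingFunction.word a′))) (sym (toList-take i w))
                l))
        , toList-injective _ _ (Parks-unique (Park-Parks (Vec.drop i w) (VecAll.toList⁻
            (subst (All (1 ≤_)) (sym (toList-drop i w)) (All.drop⁺ i pos))))
                (subst (λ v → Parks v (toList (ParkingFunction.word a″))) (sym (toList-drop i w))
                r)))))
    where
    pos : All (1 ≤_) (toList w)
    pos = positive (letters-parking b)

-- Convolutions and breakpoints

∈-concatMap-intro : ∀ (f : X → List Y) {xs x y} → x ∈ xs → y ∈ f x → y ∈ concatMap f xs
∈-concatMap-intro f x∈ y∈ = ∈-concatMap⁺ f (lose x∈ y∈)

∈-concatMap-elim : ∀ (f : X → List Y) xs {y} → y ∈ concatMap f xs → ∃[ x ] x ∈ xs × y ∈ f x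
∈-concatMap-elim f xs y∈ = find (∈-concatMap⁻ f {xs = xs} y∈)

concatMap-unique : ∀ (f : X → List Y) {xs} → Unique xs → (∀ {x} → x ∈ xs → Unique (f x)) →
  (∀ {x x′ y} → x ∈ xs → x′ ∈ xs → y ∈ f x → y ∈ f x′ → x ≡ x′) → Unique (concatMap f xs)
concatMap-unique f {[]}     _            _ _   = []
concatMap-unique f {x ∷ xs} (x∉ ∷ u) uf disj = Unique.++⁺ (uf (here refl))
  (concatMap-unique f u (uf ∘ there) (λ p q → disj (there p) (there q)))
  λ (y∈ , y∈′) → let x′ , x′∈ , y∈f = ∈-concatMap-elim f xs y∈′ in
    All.lookup x∉ x′∈ (disj (here refl) (there x′∈) y∈ y∈f)

pairs : List X → (X → List Y) → List (X × Y)
pairs xs f = concatMap (λ x → map (x ,_) (f x)) xs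

∈-pairs⁺ : ∀ {f : X → List Y} {xs x y} → x ∈ xs → y ∈ f x → (x , y) ∈ pairs xs f
∈-pairs⁺ {x = x} x∈ y∈ = ∈-concatMap-intro _ x∈ (∈-map⁺ (x ,_) y∈)

∈-pairs⁻ : ∀ {f : X → List Y} xs {x y} → (x , y) ∈ pairs xs f → x ∈ xs × y ∈ f x
∈-pairs⁻ xs xy∈ with ∈-concatMap-elim _ xs xy∈
... | x , x∈ , p with ∈-map⁻ (x ,_) p
...   | y , y∈ , refl = x∈ , y∈

pairs-unique : ∀ {f : X → List Y} {xs} → Unique xs → (∀ {x} → x ∈ xs → Unique (f x)) → Unique (pairs xs f)
pairs-unique {f = f} u uf = concatMap-unique _ u (λ x∈ → Unique.map⁺ (cong proj₂) (uf x∈)) (λ _ _ → same)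
  where
  same : ∀ {x x′ y} → y ∈ map (x ,_) (f x) → y ∈ map (x′ ,_) (f x′) → x ≡ x′
  same {x} {x′} p q with ∈-map⁻ (x ,_) p | ∈-map⁻ (x′ ,_) q
  ... | _ , _ , refl | _ , _ , refl = refl

unique-↭ : {xs ys : List X} → Unique xs → Unique ys →
           (∀ {x} → x ∈ xs → x ∈ ys) → (∀ {x} → x ∈ ys → x ∈ xs) → xs ↭ ys
unique-↭ u u′ f g = ∼bag⇒↭ (unique∧set⇒bag u u′ (mk⇔ f g))

map-unique : ∀ (φ : X → Y) {xs} → Unique xs →
  (∀ {x x′} → x ∈ xs → x′ ∈ xs → φ x ≡ φ x′ → x ≡ x′) → Unique (map φ xs)
map-unique φ {[]}     _        _   = []
map-unique φ {x ∷ xs} (x∉ ∷ u) inj =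
  All.map⁺ (All.tabulate λ x′∈ eq → All.lookup x∉ x′∈ (inj (here refl) (there x′∈) eq)) ∷
  map-unique φ u (λ p q → inj (there p) (there q))

-- Duplicate-free lists with the same members are permutations of each other, so injectivity and
-- surjectivity on members suffice for reindexing a sum.
bijection-↭ : ∀ (φ : X → Y) {xs ys} → Unique xs → Unique ys →
  (∀ {x} → x ∈ xs → φ x ∈ ys) →
  (∀ {x x′} → x ∈ xs → x′ ∈ xs → φ x ≡ φ x′ → x ≡ x′) →
  (∀ {y} → y ∈ ys → ∃[ x ] x ∈ xs × y ≡ φ x) → map φ xs ↭ ys
bijection-↭ φ u u′ into inj onto = unique-↭ (map-unique φ u inj) u′
  (λ y∈ → let x , x∈ , eq = ∈-map⁻ φ y∈ in subst (_∈ _) (sym eq) (into x∈))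
  (λ y∈ → let x , x∈ , eq = onto y∈ in subst (_∈ _) (sym eq) (∈-map⁺ φ x∈))

take-length-++ : ∀ {n} (v w : List X) → length v ≡ n → take n (v ++ w) ≡ v
take-length-++ []      w refl = refl
take-length-++ (x ∷ v) w refl = cong (x ∷_) (take-length-++ v w refl)

drop-length-++ : ∀ {n} (v w : List X) → length v ≡ n → drop n (v ++ w) ≡ w
drop-length-++ []      w refl = refl
drop-length-++ (x ∷ v) w refl = drop-length-++ v w refl

lowPart-++ : ∀ i v w → lowPart i (v ++ w) ≡ lowPart i v ++ lowPart i w
lowPart-++ i v w = trans (cong (λ s → sel true s (v ++ w)) (map-++ (_≤ᵇ i) v w))
  (sel-++ true (mask i v) (mask i w) v w (mask-length i v))

highPart-++ : ∀ i v w → highPart i (v ++ w) ≡ highPart i v ++ highPart i w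
highPart-++ i v w = trans (cong (map (_∸ i)) (trans (cong (λ s → sel false s (v ++ w)) (map-++ (_≤ᵇ i) v w))
  (sel-++ false (mask i v) (mask i w) v w (mask-length i v)))) (map-++ (_∸ i) (sel false (mask i v) v) _)

-- The positions of the letters in (j , i] can be selected in either order.
module _ {i j : ℕ} where
  sel-low-low : ∀ w (u : List X) → j ≤ i →
    sel true (mask j (lowPart i w)) (sel true (mask i w) u) ≡ sel true (mask j w) u
  sel-low-low []      u       j≤i = refl
  sel-low-low (x ∷ w) []      j≤i with x ≤ᵇ i
  ... | true  = refl
  ... | false = sel-[] true (mask j (lowPart i w))
    where
    sel-[] : ∀ b s → sel {X = X} b s [] ≡ []
    sel-[] b []      = refl
    sel-[] b (_ ∷ _) = refl
  sel-low-low (x ∷ w) (y ∷ u) j≤i with x ≤ᵇ i | ≤ᵇ-reflects-≤ x i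
  sel-low-low (x ∷ w) (y ∷ u) j≤i | true | _ with x ≤ᵇ j
  ... | true  = cong (y ∷_) (sel-low-low w u j≤i)
  ... | false = sel-low-low w u j≤i
  sel-low-low (x ∷ w) (y ∷ u) j≤i | false | ofⁿ x≰i with x ≤ᵇ j | ≤ᵇ-reflects-≤ x j
  ... | true  | ofʸ x≤j = contradiction (≤-trans x≤j j≤i) x≰i
  ... | false | _       = sel-low-low w u j≤i

  sel-high-low : ∀ w (u : List X) → length u ≡ length w → j ≤ i →
    sel false (mask j (lowPart i w)) (sel true (mask i w) u) ≡
    sel true (mask i (sel false (mask j w) w)) (sel false (mask j w) u)
  sel-high-low []      []      _  j≤i = refl
  sel-high-low (x ∷ w) (y ∷ u) eq j≤i
    with x ≤ᵇ i in p | ≤ᵇ-reflects-≤ x i | x ≤ᵇ j in q | ≤ᵇ-reflects-≤ x j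
  ... | true  | _       | true  | _       rewrite q = sel-high-low w u (suc-injective eq) j≤i
  ... | true  | _       | false | _       rewrite p | q = cong (y ∷_)
      (sel-high-low w u (suc-injective eq) j≤i)
  ... | false | ofⁿ x≰i | true  | ofʸ x≤j = contradiction (≤-trans x≤j j≤i) x≰i
  ... | false | _       | false | _       rewrite p = sel-high-low w u (suc-injective eq) j≤i

  sel-high-high : ∀ w (u : List X) → length u ≡ length w → j ≤ i →
    sel false (mask i (sel false (mask j w) w)) (sel false (mask j w) u) ≡ sel false (mask i w) u
  sel-high-high []      []      _  j≤i = refl
  sel-high-high (x ∷ w) (y ∷ u) eq j≤i
    with x ≤ᵇ i in p | ≤ᵇ-reflects-≤ x i | x ≤ᵇ j in q | ≤ᵇ-reflects-≤ x j
  ... | true  | _       | true  | _       = sel-high-high w u (suc-injective eq) j≤i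
  ... | true  | _       | false | _       rewrite p = sel-high-high w u (suc-injective eq) j≤i
  ... | false | ofⁿ x≰i | true  | ofʸ x≤j = contradiction (≤-trans x≤j j≤i) x≰i
  ... | false | _       | false | _       rewrite p = cong (y ∷_) (sel-high-high w u (suc-injective eq) j≤i)

Parks-length : ∀ {w z} → Parks w z → length z ≡ length w
Parks-length p = ↠-length (reduces p)

-- The part of a product word lying over one factor: c and c′ are the preimages of
-- the parts of a, spread out along the positions of these parts.
module _ {i k : ℕ} {a c c′ : List ℕ} (pa : Parking a) (bp : Breakpoint i a)
         (c≤k : All (_≤ k) c) (posc : All (1 ≤_) c) (posc′ : All (1 ≤_) c′)
         (pc : Parks c (lowPart i a)) (pc′ : Parks c′ (highPart i a)) where
  private
    s = mask i a
    c″ = map (k +_) c′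
    block = merge s c c″

  block-trues : trues s ≡ length c
  block-trues = trans (sym (length-sel-true s a (mask-length i a))) (Parks-length pc)

  block-falses : falses s ≡ length c′
  block-falses = trans (sym (length-sel-false s a (mask-length i a)))
    (trans (sym (length-map (_∸ i) (sel false s a))) (Parks-length pc′))

  private
    block-falses″ : falses s ≡ length c″
    block-falses″ = trans block-falses (sym (length-map (k +_) c′))

  block-mask : mask k block ≡ s
  block-mask = mask-merge s c≤k (above-positive k posc′) block-trues block-falses″

  -- Cutting `block` at `k` returns `c` and the shift of `c′`, which park to the two parts of `a` on
  -- the positions marked by `a`. The room makes the parkization of `block` determined by these
  -- data.
  Parks-block : Room 0 k block → Parks block a
  Parks-block room = Parks-from-parts {i = k} {j = i} (proj₂ (park block pos)) room pa bp block-mask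
    (subst (λ v → Parks v (lowPart i a)) (sym low≡) pc)
    (subst (λ v → Parks v (highPart i a)) (sym high≡) (↠-Parks (shift-↠ k posc′) pc′))
    where
    pos : All (1 ≤_) block
    pos = All-merge s posc (All.map (≤-trans (s≤s z≤n)) (above-positive k posc′))
    low≡ : lowPart k block ≡ c
    low≡ = trans (cong (λ m → sel true m block) block-mask) (sel-true-merge s c c″ block-trues block-falses″)
    high≡ : sel false (mask k block) block ≡ c″
    high≡ = trans (cong (λ m → sel false m block) block-mask)
        (sel-false-merge s c c″ block-trues block-falses″)

-- Associativity and unit of the convolution

module _ {l : ℕ} where
  private
    B = ColouredParkingFunction l
  open ColouredParkingFunction using (size; word)

  low high : ℕ → B → B
  low  i b = restrict 1 i b
  high i b = restrict (suc i) (size b) b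

  breaks : B → List ℕ
  breaks b = breakpoints (word b)

  product-intro : ∀ (b′ b″ b : B) {v w} → letters b ≡ v ++ w → Parks v (letters b′) → Parks w (letters b″) →
                  hues b ≡ hues b′ ++ hues b″ → Product b′ b″ b
  product-intro b′ b″ b {v} {w} eq pv pw = mkProduct
    (trans (sym (length-letters b)) (trans (cong length eq) (trans (length-++ v)
      (cong₂ _+_ len (trans (sym (Parks-length pw)) (length-letters b″))))))
    (subst (λ v → Parks v (letters b′)) (sym (trans (cong (take (size b′)) eq) (take-length-++ v w len))) pv)
    (subst (λ v → Parks v (letters b″)) (sym (trans (cong (drop (size b′)) eq) (drop-length-++ v w len))) pw)
    where
    len : length v ≡ size b′
    len = trans (sym (Parks-length pv)) (length-letters b′)

  open Product

  -- Both bracketings of a triple product describe the words that park to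
  -- a, b and c on three consecutive blocks of positions.
  record Product₃ (a b c e : B) : Set where
    constructor mkProduct₃
    field
      {block₁ block₂ block₃} : List ℕ
      blocks : letters e ≡ block₁ ++ block₂ ++ block₃
      parks₁ : Parks block₁ (letters a)
      parks₂ : Parks block₂ (letters b)
      parks₃ : Parks block₃ (letters c)
      hues₃  : hues e ≡ hues a ++ hues b ++ hues c

  -- Reduction preserves positions, so a cut of the reduct is also a cut of the word. In a triple
  -- product this exposes the blocks hidden inside the intermediate product.
  ↠-split : ∀ {w z x y} → w ↠ z → z ≡ x ++ y → ∃[ x′ ] ∃[ y′ ] w ≡ x′ ++ y′ × x′ ↠ x × y′ ↠ y
  ↠-split {w} {z} {x} {y} t refl = take n w , drop n w , sym (take++drop≡id n w)
    , subst (take n w ↠_) (take-length-++ x y refl) (↠-take n t)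
    , subst (drop n w ↠_) (drop-length-++ x y refl) (↠-drop n t)
    where n = length x

  ↠-++ : ∀ {x y z} → x ++ y ↠ z → ∃[ x′ ] ∃[ y′ ] z ≡ x′ ++ y′ × x ↠ x′ × y ↠ y′
  ↠-++ {x} {y} {z} t = take n z , drop n z , sym (take++drop≡id n z)
    , subst (_↠ take n z) (take-length-++ x y refl) (↠-take n t)
    , subst (_↠ drop n z) (drop-length-++ x y refl) (↠-drop n t)
    where n = length x

  halves : ∀ {b′ b″ b : B} → Product b′ b″ b → letters b ≡ take (size b′) (letters b) ++ drop
      (size b′) (letters b)
  halves {b′} {b = b} p = sym (take++drop≡id (size b′) (letters b))

  assocˡ⁻ : ∀ {a b c d e : B} → Product a b d → Product d c e → Product₃ a b c e
  assocˡ⁻ {a} {b} {c} {d} {e} p q with ↠-split (reduces (first q)) (halves p)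
  ... | x , y , eq , tx , ty = mkProduct₃
    (trans (halves q) (trans (cong (_++ _) eq) (++-assoc x y _)))
    (↠-Parks tx (first p)) (↠-Parks ty (second p)) (second q)
    (trans (colours q) (trans (cong (_++ hues c) (colours p)) (++-assoc (hues a) (hues b) (hues c))))

  assocʳ⁻ : ∀ {a b c f e : B} → Product b c f → Product a f e → Product₃ a b c e
  assocʳ⁻ {a} {b} {c} {f} {e} p q with ↠-split (reduces (second q)) (halves p)
  ... | x , y , eq , tx , ty = mkProduct₃
    (trans (halves q) (cong (take (size a) (letters e) ++_) eq)) (first q)
    (↠-Parks tx (first p)) (↠-Parks ty (second p))
    (trans (colours q) (cong (hues a ++_) (colours p)))

  -- The intermediate factor of a triple product is the parkization of two adjacent blocks taken
  -- together. Its halves are reducts of `v` and `w`, so by confluence they still park to the given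
  -- factors.
  product-exists : ∀ (b′ b″ : B) {v w} → All (1 ≤_) (v ++ w) → Parks v (letters b′) → Parks w (letters b″) →
    ∃[ b ] Product b′ b″ b × Parks (v ++ w) (letters b) × hues b ≡ hues b′ ++ hues b″
  product-exists b′ b″ {v} {w} pos pv pw with park (v ++ w) pos
  ... | z , pz with ↠-++ {v} {w} (reduces pz)
  ...   | v′ , w′ , eq , tv , tw = b
          , product-intro b′ b″ b (trans letters≡ eq)
              (absorb tv (reduces pv) (parked pv) ,ᵖ parked pv)
                  (absorb tw (reduces pw) (parked pw) ,ᵖ parked pw) hues≡
          , subst (Parks (v ++ w)) (sym letters≡) pz , hues≡
    where
    u = hues b′ ++ hues b″
    len : length u ≡ length z
    len = begin
      length u                               ≡⟨ length-++ (hues b′) ⟩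
      length (hues b′) + length (hues b″)    ≡⟨ cong₂ _+_ (length-hues b′) (length-hues b″) ⟩
      length (letters b′) + length (letters b″) ≡⟨ cong₂ _+_ (Parks-length pv) (Parks-length pw) ⟩
      length v + length w                    ≡⟨ length-++ v ⟨
      length (v ++ w)                        ≡⟨ Parks-length pz ⟨
      length z                               ∎
      where open ≡-Reasoning
    b = fromLists z u len (parked pz)
    letters≡ = letters-fromLists z u len (parked pz)
    hues≡ = hues-fromLists z u len (parked pz)

  assocˡ⁺ : ∀ {a b c e : B} → Product₃ a b c e → ∃[ d ] Product a b d × Product d c e
  assocˡ⁺ {a} {b} {c} {e} (mkProduct₃ {x} {y} {t} eq px py pt eqʰ) with product-exists a b {x} {y} pos px py
    where
    pos : All (1 ≤_) (x ++ y)
    pos = All.++⁻ˡ (x ++ y) (subst (All (1 ≤_)) (trans eq (sym (++-assoc x y t)))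
        (positive (letters-parking e)))
  ... | d , p , pd , eqᵈ = d , p , product-intro d c e (trans eq (sym (++-assoc x y t))) pd pt
    (trans eqʰ (trans (sym (++-assoc (hues a) (hues b) (hues c))) (cong (_++ hues c) (sym eqᵈ))))

  assocʳ⁺ : ∀ {a b c e : B} → Product₃ a b c e → ∃[ f ] Product b c f × Product a f e
  assocʳ⁺ {a} {b} {c} {e} (mkProduct₃ {x} {y} {t} eq px py pt eqʰ) with product-exists b c {y} {t} pos py pt
    where
    pos : All (1 ≤_) (y ++ t)
    pos = All.++⁻ʳ x (subst (All (1 ≤_)) eq (positive (letters-parking e)))
  ... | f , p , pf , eqᶠ = f , p , product-intro a f e eq px pf (trans eqʰ (cong (hues a ++_) (sym eqᶠ)))

  -- The intermediate factor is the parkization of a prefix of `e` whose length is known; hence no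
  -- word occurs twice in the expanded triple product.
  first-unique : ∀ {a b c d d′ e : B} → Product a b d → Product a b d′ → Product d c e → Product d′
      c e → d ≡ d′
  first-unique {d = d} {d′} {e} p p′ q q′ = coloured-≡
    (Parks-unique (first q) (subst (λ n → Parks (take n (letters e)) (letters d′))
        (trans (sizes p′) (sym (sizes p))) (first q′)))
    (trans (colours p) (sym (colours p′)))

  second-unique : ∀ {a b c f f′ e : B} → Product b c f → Product b c f′ → Product a f e → Product a
      f′ e → f ≡ f′
  second-unique p p′ q q′ = coloured-≡ (Parks-unique (second q) (second q′))
      (trans (colours p) (sym (colours p′)))

  products-assoc : ∀ (a b c : B) → concatMap (λ d → products d c) (products a b) ↭ concatMap
      (products a) (products b c)
  products-assoc a b c = unique-↭
    (concatMap-unique (λ d → products d c) (products-unique a b) (λ {d} _ → products-unique d c)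
      (λ {d} {d′} d∈ d′∈ e∈ e∈′ → first-unique (∈-products⁻ a b d∈) (∈-products⁻ a b d′∈)
          (∈-products⁻ d c e∈) (∈-products⁻ d′ c e∈′)))
    (concatMap-unique (products a) (products-unique b c) (λ {f} _ → products-unique a f)
      (λ {f} {f′} f∈ f′∈ e∈ e∈′ → second-unique (∈-products⁻ b c f∈) (∈-products⁻ b c f′∈)
          (∈-products⁻ a f e∈) (∈-products⁻ a f′ e∈′)))
    (λ e∈ → let d , d∈ , e∈d = ∈-concatMap-elim (λ d → products d c) (products a b) e∈
                f , p , q = assocʳ⁺ (assocˡ⁻ (∈-products⁻ a b d∈) (∈-products⁻ d c e∈d))
            in ∈-concatMap-intro (products a) (∈-products⁺ b c p) (∈-products⁺ a f q))
    (λ e∈ → let f , f∈ , e∈f = ∈-concatMap-elim (products a) (products b c) e∈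
                d , p , q = assocˡ⁺ (assocʳ⁻ (∈-products⁻ b c f∈) (∈-products⁻ a f e∈f))
            in ∈-concatMap-intro (λ d → products d c) (∈-products⁺ a b p) (∈-products⁺ d c q))

  singleton-↭ : ∀ {x : X} {xs} → Unique xs → x ∈ xs → (∀ {y} → y ∈ xs → y ≡ x) → xs ↭ x ∷ []
  singleton-↭ u x∈ only = unique-↭ u ([] ∷ []) (here ∘ only) (λ { (here refl) → x∈ })

  Parks-[] : Parks [] []
  Parks-[] = Parks-refl (letters-parking (∅ {l}))

  products-identityˡ : ∀ (b : B) → products ∅ b ↭ b ∷ []
  products-identityˡ b = singleton-↭ (products-unique ∅ b)
    (∈-products⁺ ∅ b (product-intro ∅ b b refl Parks-[] (Parks-refl (letters-parking b)) refl))
    λ {b′} b′∈ → let p = ∈-products⁻ ∅ b b′∈ in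
      coloured-≡ (Parks-unique (Parks-refl (letters-parking b′)) (second p)) (colours p)

  products-identityʳ : ∀ (b : B) → products b ∅ ↭ b ∷ []
  products-identityʳ b = singleton-↭ (products-unique b ∅)
    (∈-products⁺ b ∅ (product-intro b ∅ b (sym (++-identityʳ _)) (Parks-refl (letters-parking b))
        Parks-[] (sym (++-identityʳ _))))
    λ {b′} b′∈ → let p = ∈-products⁻ b ∅ b′∈ in
      coloured-≡ (Parks-unique (Parks-refl (letters-parking b′))
          (subst (λ v → Parks v (letters b)) (take-all (size b) (letters b′)
              (≤-reflexive (trans (length-letters b′) (trans (sizes p) (+-identityʳ _)))))
              (first p)))
        (trans (colours p) (++-identityʳ _))

-- Cutting twice, and cutting a product

module _ {l : ℕ} where
  private
    B = ColouredParkingFunction l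
  open ColouredParkingFunction using (size)

  breaks-unique : ∀ (b : B) → Unique (breaks b)
  breaks-unique = breakpoints-unique

  module _ {b : B} {i j : ℕ} where
    private
      ω = letters b
      pw = letters-parking b

    break-low⁻ : Breakpoint i ω → Breakpoint j (letters (low i b)) → j ≤ i × Breakpoint j ω
    break-low⁻ bi bj = j≤i , mkBreakpoint (trans (sym (cnt-lowPart pw bi j≤i)) (break bj′))
      where
      bj′ : Breakpoint j (lowPart i ω)
      bj′ = subst (Breakpoint j) (letters-low b bi) bj
      j≤i : j ≤ i
      j≤i = subst (j ≤_) (length-lowPart pw bi) (break≤length (lowPart-parking pw bi) bj′)

    break-low⁺ : Breakpoint i ω → Breakpoint j ω → j ≤ i → Breakpoint j (letters (low i b))
    break-low⁺ bi bj j≤i = subst (Breakpoint j) (sym (letters-low b bi))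
      (mkBreakpoint (trans (cnt-lowPart pw bi j≤i) (break bj)))

    break-high⁻ : Breakpoint i ω → Breakpoint j (letters (high i b)) → Breakpoint (i + j) ω
    break-high⁻ bi bj = mkBreakpoint (trans (sym (cnt-highPart pw bi j))
      (cong (i +_) (break (subst (Breakpoint j) (letters-high b bi) bj))))

    break-high⁺ : Breakpoint i ω → Breakpoint (i + j) ω → Breakpoint j (letters (high i b))
    break-high⁺ bi bij = subst (Breakpoint j) (sym (letters-high b bi))
      (mkBreakpoint (+-cancelˡ-≡ i _ _ (trans (cnt-highPart pw bi j) (break bij))))

  module _ {b : B} {i j : ℕ} (bi : Breakpoint i (letters b)) (bj : Breakpoint j (letters b))
      (j≤i : j ≤ i) where
    private
      ω = letters b
      u = hues b
      k = i ∸ j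
      blow : Breakpoint j (letters (low i b))
      blow = break-low⁺ {b} {i} {j} bi bj j≤i
      bhigh : Breakpoint k (letters (high j b))
      bhigh = break-high⁺ {b} {j} {k} bj (subst (λ n → Breakpoint n ω) (sym (m+[n∸m]≡n j≤i)) bi)
      mask-k : mask k (highPart j ω) ≡ mask i (sel false (mask j ω) ω)
      mask-k = trans (mask-∸ j k (sel false (mask j ω) ω))
          (cong (λ n → mask n (sel false (mask j ω) ω)) (m+[n∸m]≡n j≤i))

    low-low : low j (low i b) ≡ low j b
    low-low = coloured-≡
      (trans (letters-low (low i b) blow) (trans (cong (lowPart j) (letters-low b bi))
        (trans (sel-low-low ω ω j≤i) (sym (letters-low b bj)))))
      (trans (hues-low (low i b) blow) (trans
          (cong₂ (λ x y → sel true (mask j x) y) (letters-low b bi) (hues-low b bi))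
        (trans (sel-low-low ω u j≤i) (sym (hues-low b bj)))))

    -- Both sides are the letters in (j , i], numbered from 1: the middle factor of the iterated
    -- coproduct.
    high-low : high j (low i b) ≡ low k (high j b)
    high-low = coloured-≡
      (begin
        letters (high j (low i b))                     ≡⟨ letters-high (low i b) blow ⟩
        highPart j (letters (low i b))                 ≡⟨ cong (highPart j) (letters-low b bi) ⟩
        highPart j (lowPart i ω)                       ≡⟨ cong (map (_∸ j)) (sel-high-low ω ω refl j≤i) ⟩
        map (_∸ j) (sel true (mask i (sel false (mask j ω) ω)) (sel false (mask j ω) ω))
                                                       ≡⟨ sel-map true (mask i
                                                           (sel false (mask j ω) ω)) (_∸ j) _ ⟨
        sel true (mask i (sel false (mask j ω) ω)) (highPart j ω)
                                                       ≡⟨ cong (λ m → sel true m (highPart j ω)) mask-k ⟨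
        lowPart k (highPart j ω)                       ≡⟨ cong (lowPart k) (letters-high b bj) ⟨
        lowPart k (letters (high j b))                 ≡⟨ letters-low (high j b) bhigh ⟨
        letters (low k (high j b))                     ∎)
      (begin
        hues (high j (low i b))                        ≡⟨ hues-high (low i b) blow ⟩
        sel false (mask j (letters (low i b))) (hues (low i b))
                                                       ≡⟨ cong₂ (λ x y → sel false (mask j x) y)
                                                           (letters-low b bi) (hues-low b bi) ⟩
        sel false (mask j (lowPart i ω)) (sel true (mask i ω) u)
                                                       ≡⟨ sel-high-low ω u (length-hues b) j≤i ⟩
        sel true (mask i (sel false (mask j ω) ω)) (sel false (mask j ω) u)
                                                       ≡⟨ cong (λ m → sel true m
                                                           (sel false (mask j ω) u)) mask-k ⟨
        sel true (mask k (highPart j ω)) (sel false (mask j ω) u)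
                                                       ≡⟨ cong₂ (λ x y → sel true (mask k x) y)
                                                           (letters-high b bj) (hues-high b bj) ⟨
        sel true (mask k (letters (high j b))) (hues (high j b))
                                                       ≡⟨ hues-low (high j b) bhigh ⟨
        hues (low k (high j b))                        ∎)
      where open ≡-Reasoning

    high-high : high i b ≡ high k (high j b)
    high-high = coloured-≡
      (begin
        letters (high i b)                             ≡⟨ letters-high b bi ⟩
        map (_∸ i) (sel false (mask i ω) ω)            ≡⟨ cong (map (_∸ i)) (sel-high-high ω ω refl j≤i) ⟨
        map (_∸ i) υ
            ≡⟨ map-cong (λ x → trans (∸-+-assoc x j k) (cong (x ∸_) (m+[n∸m]≡n j≤i))) υ ⟨
        map (λ x → x ∸ j ∸ k) υ                        ≡⟨ map-∘ υ ⟩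
        map (_∸ k) (map (_∸ j) υ)
            ≡⟨ cong (map (_∸ k)) (sel-map false (mask i (sel false (mask j ω) ω)) (_∸ j) _) ⟨
        map (_∸ k) (sel false (mask i (sel false (mask j ω) ω)) (highPart j ω))
                                                       ≡⟨ cong (λ m → map (_∸ k)
                                                           (sel false m (highPart j ω))) mask-k ⟨
        highPart k (highPart j ω)                      ≡⟨ cong (highPart k) (letters-high b bj) ⟨
        highPart k (letters (high j b))                ≡⟨ letters-high (high j b) bhigh ⟨
        letters (high k (high j b))                    ∎)
      (begin
        hues (high i b)                                ≡⟨ hues-high b bi ⟩
        sel false (mask i ω) u                         ≡⟨ sel-high-high ω u (length-hues b) j≤i ⟨
        sel false (mask i (sel false (mask j ω) ω)) (sel false (mask j ω) u)
                                                       ≡⟨ cong (λ m → sel false m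
                                                           (sel false (mask j ω) u)) mask-k ⟨
        sel false (mask k (highPart j ω)) (sel false (mask j ω) u)
                                                       ≡⟨ cong₂ (λ x y → sel false (mask k x) y)
                                                           (letters-high b bj) (hues-high b bj) ⟨
        sel false (mask k (letters (high j b))) (hues (high j b))
                                                       ≡⟨ hues-high (high j b) bhigh ⟨
        hues (high k (high j b))                       ∎)
      where
      open ≡-Reasoning
      υ = sel false (mask i (sel false (mask j ω) ω)) (sel false (mask j ω) ω)

  breaks² : B → List (ℕ × ℕ)
  breaks² b = pairs (breaks b) (λ i → breaks (low i b))

  ∈-breaks²⁻ : ∀ (b : B) {i j} → (i , j) ∈ breaks² b →
               Breakpoint i (letters b) × Breakpoint j (letters b) × j ≤ i
  ∈-breaks²⁻ b {i} {j} ij∈ =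
    let i∈ , j∈ = ∈-pairs⁻ {f = λ i → breaks (low i b)} (breaks b) ij∈
        bi = ∈-breakpoints⁻ b i∈
        j≤i , bj = break-low⁻ {b} {i} {j} bi (∈-breakpoints⁻ (low i b) j∈)
    in bi , bj , j≤i

  -- A cut at `i` followed by a cut of the low part at `j` is a cut at `j` followed by a cut of the
  -- high part at i - j. The inverse sends (j , k) to (j + k , j).
  breaks-coassoc : ∀ (b : B) → map (λ (i , j) → (j , i ∸ j)) (breaks² b) ↭
                               pairs (breaks b) (λ j → breaks (high j b))
  breaks-coassoc b = bijection-↭ _
    (pairs-unique (breaks-unique b) (λ {i} _ → breaks-unique (low i b)))
    (pairs-unique (breaks-unique b) (λ {j} _ → breaks-unique (high j b)))
    (λ { {i , j} ij∈ → let bi , bj , j≤i = ∈-breaks²⁻ b ij∈ in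
       ∈-pairs⁺ {f = λ j → breaks (high j b)} (∈-breakpoints⁺ b bj) (∈-breakpoints⁺ (high j b)
         (break-high⁺ {b} {j} {i ∸ j} bj (subst (λ n → Breakpoint n (letters b))
             (sym (m+[n∸m]≡n j≤i)) bi))) })
    (λ { {i , j} {i′ , j′} p q eq → inj (proj₂ (proj₂ (∈-breaks²⁻ b p)))
        (proj₂ (proj₂ (∈-breaks²⁻ b q))) (cong proj₁ eq) (cong proj₂ eq) })
    (λ { {j , k} jk∈ →
      let j∈ , k∈ = ∈-pairs⁻ {f = λ j → breaks (high j b)} (breaks b) jk∈
          bj = ∈-breakpoints⁻ b j∈
          bjk = break-high⁻ {b} {j} {k} bj (∈-breakpoints⁻ (high j b) k∈)
      in (j + k , j)
         , ∈-pairs⁺ {f = λ i → breaks (low i b)} (∈-breakpoints⁺ b bjk)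
             (∈-breakpoints⁺ (low (j + k) b) (break-low⁺ {b} {j + k} {j} bjk bj (m≤m+n j k)))
         , cong (j ,_) (sym (m+n∸m≡n j k)) })
    where
    inj : ∀ {i j i′ j′} → j ≤ i → j′ ≤ i′ → j ≡ j′ → i ∸ j ≡ i′ ∸ j′ → (i , j) ≡ (i′ , j′)
    inj {j = j} p q refl eq = cong (_, j) (trans (sym (m+[n∸m]≡n p)) (trans (cong (j +_) eq) (m+[n∸m]≡n q)))

  module _ {a b e : B} {k : ℕ} (p : Product a b e) (bk : Breakpoint k (letters e)) where
    open Product
    private
      ω = letters e
      x = take (size a) ω
      y = drop (size a) ω
      w≡ : x ++ y ≡ ω
      w≡ = take++drop≡id (size a) ω
      room : Room 0 k (x ++ y)
      room = subst (Room 0 k) (sym w≡) (Breakpoint⇒Room (letters-parking e) bk)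
      roomˣ : Room 0 k x
      roomˣ = Room-++ˡ x y room
      roomʸ : Room 0 k y
      roomʸ = Room-++ʳ x y room

    -- The blocks `x` and `y` need not be parking, and `k` need not be a breakpoint of their
    -- parkizations `a` and `b`; the induced breakpoints are the numbers of letters up to `k` in
    -- each block.
    leftBreak rightBreak : ℕ
    leftBreak  = cnt k x
    rightBreak = cnt k y

    leftBreak+rightBreak : leftBreak + rightBreak ≡ k
    leftBreak+rightBreak = trans (sym (cnt-++ k x y)) (trans (cong (cnt k) w≡) (break bk))

    left-break : Breakpoint leftBreak (letters a)
    left-break = Parks-break (first p) roomˣ

    right-break : Breakpoint rightBreak (letters b)
    right-break = Parks-break (second p) roomʸ

    private
      i = leftBreak
      j = rightBreak

    -- The positions of the low letters of `e` depend only on the two induced breakpoints, so the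
    -- interleaving pattern is known without `e`.
    mask-product : mask k ω ≡ mask i (letters a) ++ mask j (letters b)
    mask-product = trans (cong (mask k) (sym w≡)) (trans (map-++ (_≤ᵇ k) x y)
      (cong₂ _++_ (sym (mask-Parks (first p) roomˣ)) (sym (mask-Parks (second p) roomʸ))))

    private
      hues-product : ∀ c → sel c (mask k ω) (hues e) ≡
                           sel c (mask i (letters a)) (hues a) ++ sel c (mask j (letters b)) (hues b)
      hues-product c = trans (cong₂ (sel c) mask-product (colours p))
        (sel-++ c (mask i (letters a)) (mask j (letters b)) (hues a) (hues b)
          (trans (mask-length i (letters a)) (sym (length-hues a))))

    product-low : Product (low i a) (low j b) (low k e)
    product-low = product-intro (low i a) (low j b) (low k e)
      (trans (letters-low e bk) (trans (cong (lowPart k) (sym w≡)) (lowPart-++ k x y)))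
      (subst (Parks (lowPart k x)) (sym (letters-low a left-break)) (Parks-lowPart (first p) roomˣ))
      (subst (Parks (lowPart k y)) (sym (letters-low b right-break)) (Parks-lowPart (second p) roomʸ))
      (trans (hues-low e bk) (trans (hues-product true)
        (sym (cong₂ _++_ (hues-low a left-break) (hues-low b right-break)))))

    product-high : Product (high i a) (high j b) (high k e)
    product-high = product-intro (high i a) (high j b) (high k e)
      (trans (letters-high e bk) (trans (cong (highPart k) (sym w≡)) (highPart-++ k x y)))
      (subst (Parks (highPart k x)) (sym (letters-high a left-break)) (Parks-highPart (first p) roomˣ))
      (subst (Parks (highPart k y)) (sym (letters-high b right-break)) (Parks-highPart (second p) roomʸ))
      (trans (hues-high e bk) (trans (hues-product false)
        (sym (cong₂ _++_ (hues-high a left-break) (hues-high b right-break)))))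

-- The bijection behind multiplicativity of the coproduct

module _ {l : ℕ} where
  private
    B = ColouredParkingFunction l
  open ColouredParkingFunction using (size)
  open Product

  splittings : B → B → List (B × ℕ)
  splittings a b = pairs (products a b) breaks

  factorisationsAt : B → B → ℕ → ℕ → List (B × B)
  factorisationsAt a b i j = pairs (products (low i a) (low j b)) λ _ → products (high i a) (high j b)

  -- A tensor term shows only `c` and `c′`; the breakpoints are recorded as well because they fix
  -- the mask along which the two words are interleaved.
  factorisations : B → B → List (ℕ × ℕ × B × B)
  factorisations a b = pairs (breaks a) λ i → pairs (breaks b) (factorisationsAt a b i)

  factorise : B → B × ℕ → ℕ × ℕ × B × B
  factorise a (e , k) = cnt k (take (size a) (letters e)) , cnt k (drop (size a) (letters e)) , low
      k e , high k e

  ∈-splittings⁻ : ∀ a b {e k} → (e , k) ∈ splittings a b → Product a b e × Breakpoint k (letters e)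
  ∈-splittings⁻ a b {e} ek∈ = let e∈ , k∈ = ∈-pairs⁻ {f = breaks} (products a b) ek∈ in
    ∈-products⁻ a b e∈ , ∈-breakpoints⁻ e k∈

  ∈-factorisations⁺ : ∀ a b {i j c c′} → Breakpoint i (letters a) → Breakpoint j (letters b) →
    Product (low i a) (low j b) c → Product (high i a) (high j b) c′ → (i , j , c , c′) ∈ factorisations a b
  ∈-factorisations⁺ a b {i} {j} bi bj pc pc′ =
    ∈-pairs⁺ {f = λ i → pairs (breaks b) (factorisationsAt a b i)}
      (∈-breakpoints⁺ a bi) (∈-pairs⁺ {f = factorisationsAt a b i}
      (∈-breakpoints⁺ b bj) (∈-pairs⁺ {f = λ _ → products (high i a) (high j b)}
      (∈-products⁺ (low i a) (low j b) pc) (∈-products⁺ (high i a) (high j b) pc′)))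

  ∈-factorisations⁻ : ∀ a b {i j c c′} → (i , j , c , c′) ∈ factorisations a b →
    Breakpoint i (letters a) × Breakpoint j (letters b) × Product (low i a) (low j b) c × Product
        (high i a) (high j b) c′
  ∈-factorisations⁻ a b {i} {j} {c} {c′} t∈ =
    let i∈ , t∈ = ∈-pairs⁻ {f = λ i → pairs (breaks b) (factorisationsAt a b i)} (breaks a) t∈
        j∈ , t∈ = ∈-pairs⁻ {f = factorisationsAt a b i} (breaks b) t∈
        c∈ , c′∈ = ∈-pairs⁻ {f = λ _ → products (high i a) (high j b)} (products (low i a) (low j b)) t∈
    in ∈-breakpoints⁻ a i∈ , ∈-breakpoints⁻ b j∈ , ∈-products⁻ (low i a) (low j b) c∈ , ∈-products⁻
        (high i a) (high j b) c′∈

  factorise-into : ∀ a b {e k} → Product a b e → Breakpoint k (letters e) → factorise a (e , k) ∈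
      factorisations a b
  factorise-into a b {e} {k} p bk = ∈-factorisations⁺ a b (left-break p bk) (right-break p bk)
      (product-low p bk) (product-high p bk)

  -- The two breakpoints give `k` as their sum and the mask of `e`; merging the low part with the
  -- shifted high part along this mask returns `e`.
  factorise-injective : ∀ a b {e k e′ k′} → Product a b e → Breakpoint k (letters e) → Product a b
      e′ → Breakpoint k′ (letters e′) →
    factorise a (e , k) ≡ factorise a (e′ , k′) → (e , k) ≡ (e′ , k′)
  factorise-injective a b {e} {k} {e′} {k′} p bk p′ bk′ eq = cong₂ _,_
      (coloured-≡ letters≡ (trans (colours p) (sym (colours p′)))) k≡
    where
    i≡ = cong proj₁ eq
    j≡ = cong (proj₁ ∘ proj₂) eq
    k≡ : k ≡ k′
    k≡ = trans (sym (leftBreak+rightBreak p bk)) (trans (cong₂ _+_ i≡ j≡) (leftBreak+rightBreak p′ bk′))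
    s≡ : mask k (letters e) ≡ mask k′ (letters e′)
    s≡ = trans (mask-product p bk) (trans (cong₂ (λ i j → mask i (letters a) ++ mask j (letters b))
        i≡ j≡) (sym (mask-product p′ bk′)))
    lows : lowPart k (letters e) ≡ lowPart k′ (letters e′)
    lows = trans (sym (letters-low e bk)) (trans (cong (letters ∘ proj₁ ∘ proj₂ ∘ proj₂) eq)
        (letters-low e′ bk′))
    highs : highPart k (letters e) ≡ highPart k′ (letters e′)
    highs = trans (sym (letters-high e bk)) (trans (cong (letters ∘ proj₂ ∘ proj₂ ∘ proj₂) eq)
        (letters-high e′ bk′))
    rebuild : ∀ k (w : List ℕ) → merge (mask k w) (lowPart k w) (map (k +_) (highPart k w)) ≡ w
    rebuild k w = trans (cong (merge (mask k w) (lowPart k w)) (highPart-+ k w))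
        (merge-sel (mask k w) w (mask-length k w))
    letters≡ : letters e ≡ letters e′
    letters≡ = trans (sym (rebuild k (letters e))) (trans
      (trans (cong₂ (λ s x → merge s x (map (k +_) (highPart k (letters e)))) s≡ lows)
             (cong₂ (λ k x → merge (mask k′ (letters e′)) (lowPart k′ (letters e′)) (map (k +_) x)) k≡ highs))
      (rebuild k′ (letters e′)))

  -- Builds the preimage of (i , j , c , c′): the words `c` and `c′`, the latter shifted, are
  -- interleaved along the masks of `a` and `b` placed side by side. The breakpoint can only be the
  -- length of `c`.
  module Unfactorise (a b : B) {i j : ℕ} {c c′ : B}
           (bi : Breakpoint i (letters a)) (bj : Breakpoint j (letters b))
           (p : Product (low i a) (low j b) c) (p′ : Product (high i a) (high j b) c′) where
    private
      k  = length (letters c)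
      n₁ = size (low i a)
      n₂ = size (high i a)
      x  = take n₁ (letters c)
      y  = drop n₁ (letters c)
      x′ = take n₂ (letters c′)
      y′ = drop n₂ (letters c′)
      s  = mask i (letters a)
      t  = mask j (letters b)
      pc  = letters-parking c
      pc′ = letters-parking c′
      px : Parks x (lowPart i (letters a))
      px = subst (Parks x) (letters-low a bi) (first p)
      py : Parks y (lowPart j (letters b))
      py = subst (Parks y) (letters-low b bj) (second p)
      px′ : Parks x′ (highPart i (letters a))
      px′ = subst (Parks x′) (letters-high a bi) (first p′)
      py′ : Parks y′ (highPart j (letters b))
      py′ = subst (Parks y′) (letters-high b bj) (second p′)
      blockˣ = merge s x (map (k +_) x′)
      blockʸ = merge t y (map (k +_) y′)
      pa = letters-parking a
      pb = letters-parking b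
      x≤k : All (_≤ k) x
      x≤k = All.take⁺ n₁ (bounded pc)
      y≤k : All (_≤ k) y
      y≤k = All.drop⁺ n₁ (bounded pc)
      posˣ : All (1 ≤_) x
      posˣ = All.take⁺ n₁ (positive pc)
      posʸ : All (1 ≤_) y
      posʸ = All.drop⁺ n₁ (positive pc)
      posˣ′ : All (1 ≤_) x′
      posˣ′ = All.take⁺ n₂ (positive pc′)
      posʸ′ : All (1 ≤_) y′
      posʸ′ = All.drop⁺ n₂ (positive pc′)
      tsˣ = block-trues pa bi x≤k posˣ posˣ′ px px′
      tsʸ = block-trues pb bj y≤k posʸ posʸ′ py py′
      fsˣ = block-falses pa bi x≤k posˣ posˣ′ px px′
      fsʸ = block-falses pb bj y≤k posʸ posʸ′ py py′
      split : ∀ n (w : List ℕ) → length (take n w) + length (drop n w) ≡ length w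
      split n w = trans (sym (length-++ (take n w))) (cong length (take++drop≡id n w))
      ts : trues (s ++ t) ≡ length (letters c)
      ts = trans (trues-++ s t) (trans (cong₂ _+_ tsˣ tsʸ) (split n₁ (letters c)))
      fs : falses (s ++ t) ≡ length (letters c′)
      fs = trans (falses-++ s t) (trans (cong₂ _+_ fsˣ fsʸ) (split n₂ (letters c′)))
      word′ = join pc pc′ (s ++ t) ts fs
      word≡ : word′ ≡ blockˣ ++ blockʸ
      word≡ = trans (cong₂ (merge (s ++ t)) (sym (take++drop≡id n₁ (letters c)))
          (trans (cong (map (k +_)) (sym (take++drop≡id n₂ (letters c′)))) (map-++ (k +_) x′ y′)))
        (merge-++ s t x y (map (k +_) x′) (map (k +_) y′) tsˣ (trans fsˣ (sym (length-map (k +_) x′))))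
      break′ = join-break pc pc′ (s ++ t) ts fs
      parking′ = join-parking pc pc′ (s ++ t) ts fs
      -- The room of each block comes from the whole word, which is parking with breakpoint `k`, and
      -- is then inherited by its prefix and suffix.
      room : Room 0 k (blockˣ ++ blockʸ)
      room = subst (Room 0 k) word≡ (Breakpoint⇒Room parking′ break′)
      parksˣ : Parks blockˣ (letters a)
      parksˣ = Parks-block pa bi x≤k posˣ posˣ′ px px′ (Room-++ˡ blockˣ blockʸ room)
      parksʸ : Parks blockʸ (letters b)
      parksʸ = Parks-block pb bj y≤k posʸ posʸ′ py py′ (Room-++ʳ blockˣ blockʸ room)
      u = hues a ++ hues b
      len : length u ≡ length word′
      len = begin
        length u                                ≡⟨ length-++ (hues a) ⟩
        length (hues a) + length (hues b)
            ≡⟨ cong₂ _+_ (trans (length-hues a) (Parks-length parksˣ))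
            (trans (length-hues b) (Parks-length parksʸ)) ⟩
        length blockˣ + length blockʸ           ≡⟨ length-++ blockˣ ⟨
        length (blockˣ ++ blockʸ)               ≡⟨ cong length word≡ ⟨
        length word′                            ∎
        where open ≡-Reasoning

    unfactorise : B
    unfactorise = fromLists word′ u len parking′

    private
      e = unfactorise
      letters≡ : letters e ≡ word′
      letters≡ = letters-fromLists word′ u len parking′
      hues≡ : hues e ≡ u
      hues≡ = hues-fromLists word′ u len parking′
      bk : Breakpoint k (letters e)
      bk = subst (Breakpoint k) (sym letters≡) break′
      mask≡ : mask k (letters e) ≡ s ++ t
      mask≡ = trans (cong (mask k) letters≡) (mask-join pc pc′ (s ++ t) ts fs)
      lenˣ : length blockˣ ≡ size a
      lenˣ = trans (sym (Parks-length parksˣ)) (length-letters a)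
      blocks≡ : letters e ≡ blockˣ ++ blockʸ
      blocks≡ = trans letters≡ word≡
      sel-hues : ∀ o → sel o (mask k (letters e)) (hues e) ≡ sel o s (hues a) ++ sel o t (hues b)
      sel-hues o = trans (cong₂ (sel o) mask≡ hues≡)
        (sel-++ o s t (hues a) (hues b) (trans (mask-length i (letters a)) (sym (length-hues a))))

    unfactorise-product : Product a b unfactorise
    unfactorise-product = product-intro a b e blocks≡ parksˣ parksʸ hues≡

    unfactorise-break : Breakpoint k (letters unfactorise)
    unfactorise-break = bk

    unfactorise-low : low k unfactorise ≡ c
    unfactorise-low = coloured-≡
      (trans (letters-low e bk) (trans (cong (lowPart k) letters≡) (lowPart-join pc pc′ (s ++ t) ts fs)))
      (trans (hues-low e bk) (trans (sel-hues true)
        (trans (sym (cong₂ _++_ (hues-low a bi) (hues-low b bj))) (sym (colours p)))))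

    unfactorise-high : high k unfactorise ≡ c′
    unfactorise-high = coloured-≡
      (trans (letters-high e bk) (trans (cong (highPart k) letters≡) (highPart-join pc pc′ (s ++ t) ts fs)))
      (trans (hues-high e bk) (trans (sel-hues false)
        (trans (sym (cong₂ _++_ (hues-high a bi) (hues-high b bj))) (sym (colours p′)))))

    factorise-unfactorise : (i , j , c , c′) ≡ factorise a (unfactorise , k)
    factorise-unfactorise = cong₂ _,_
      (sym (trans (cong (cnt k) (trans (cong (take (size a)) blocks≡) (take-length-++ blockˣ blockʸ lenˣ)))
        (trans (cong trues (block-mask pa bi x≤k posˣ posˣ′ px px′)) (break bi))))
      (cong₂ _,_
        (sym (trans (cong (cnt k) (trans (cong (drop (size a)) blocks≡) (drop-length-++ blockˣ blockʸ lenˣ)))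
          (trans (cong trues (block-mask pb bj y≤k posʸ posʸ′ py py′)) (break bj))))
        (cong₂ _,_ (sym unfactorise-low) (sym unfactorise-high)))

  factorise-↭ : ∀ a b → map (factorise a) (splittings a b) ↭ factorisations a b
  factorise-↭ a b = bijection-↭ (factorise a)
    (pairs-unique (products-unique a b) (λ {e} _ → breaks-unique e))
    (pairs-unique (breaks-unique a) (λ {i} _ → pairs-unique (breaks-unique b) (λ {j} _ →
      pairs-unique (products-unique (low i a) (low j b)) (λ _ → products-unique (high i a) (high j b)))))
    (λ { {e , k} ek∈ → let p , bk = ∈-splittings⁻ a b ek∈ in factorise-into a b p bk })
    (λ { {e , k} {e′ , k′} ek∈ ek∈′ → let p , bk = ∈-splittings⁻ a b ek∈
                                          p′ , bk′ = ∈-splittings⁻ a b ek∈′ in factorise-injective a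
                                              b p bk p′ bk′ })
    (λ { {i , j , c , c′} t∈ →
      let bi , bj , p , p′ = ∈-factorisations⁻ a b t∈
          open Unfactorise a b bi bj p p′
      in (unfactorise , length (letters c))
         , ∈-pairs⁺ {f = breaks} (∈-products⁺ a b unfactorise-product)
             (∈-breakpoints⁺ unfactorise unfactorise-break)
         , factorise-unfactorise })

-- Sums and linear maps

module Sums {K : CommutativeRing c ℓ} (N : Module K o ℓo) where
  open Module N
  open CommutativeSemigroupProperties (CommutativeMonoid.commutativeSemigroup +ᴹ-commutativeMonoid)
    using (interchange; x∙yz≈y∙xz)

  private
    Σ⟨_⟩ : List X → (X → Carrierᴹ) → Carrierᴹ
    Σ⟨ xs ⟩ = sumOver N xs

  sum-cong : ∀ (xs : List X) {f h} → (∀ {x} → x ∈ xs → f x ≈ᴹ h x) → Σ⟨ xs ⟩ f ≈ᴹ Σ⟨ xs ⟩ h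
  sum-cong []       eq = ≈ᴹ-refl
  sum-cong (x ∷ xs) eq = +ᴹ-cong (eq (here refl)) (sum-cong xs (eq ∘ there))

  sum-map : ∀ (φ : X → Y) xs {f} → Σ⟨ map φ xs ⟩ f ≡ Σ⟨ xs ⟩ (f ∘ φ)
  sum-map φ []       = refl
  sum-map φ (x ∷ xs) = cong (_ +ᴹ_) (sum-map φ xs)

  sum-++ : ∀ (xs ys : List X) {f} → Σ⟨ xs ++ ys ⟩ f ≈ᴹ Σ⟨ xs ⟩ f +ᴹ Σ⟨ ys ⟩ f
  sum-++ []       ys = ≈ᴹ-sym (+ᴹ-identityˡ _)
  sum-++ (x ∷ xs) ys = ≈ᴹ-trans (+ᴹ-congˡ (sum-++ xs ys)) (≈ᴹ-sym (+ᴹ-assoc _ _ _))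

  sum-concatMap : ∀ (F : X → List Y) xs {f} → Σ⟨ concatMap F xs ⟩ f ≈ᴹ Σ⟨ xs ⟩ (λ x → Σ⟨ F x ⟩ f)
  sum-concatMap F []       = ≈ᴹ-refl
  sum-concatMap F (x ∷ xs) = ≈ᴹ-trans (sum-++ (F x) (concatMap F xs)) (+ᴹ-congˡ (sum-concatMap F xs))

  sum-pairs : ∀ (F : X → List Y) xs {f} → Σ⟨ pairs xs F ⟩ f ≈ᴹ Σ⟨ xs ⟩ (λ x → Σ⟨ F x ⟩ (λ y → f (x , y)))
  sum-pairs F xs = ≈ᴹ-trans (sum-concatMap (λ x → map (x ,_) (F x)) xs)
    (sum-cong xs (λ {x} _ → ≈ᴹ-reflexive (sum-map (x ,_) (F x))))

  sum-↭ : ∀ {xs ys : List X} {f} → xs ↭ ys → Σ⟨ xs ⟩ f ≈ᴹ Σ⟨ ys ⟩ f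
  sum-↭ Perm.refl          = ≈ᴹ-refl
  sum-↭ (Perm.prep x p)    = +ᴹ-congˡ (sum-↭ p)
  sum-↭ (Perm.swap x y p)  = ≈ᴹ-trans (x∙yz≈y∙xz _ _ _) (+ᴹ-congˡ (+ᴹ-congˡ (sum-↭ p)))
  sum-↭ (Perm.trans p q)   = ≈ᴹ-trans (sum-↭ p) (sum-↭ q)

  sum-0 : ∀ (xs : List X) {f} → (∀ {x} → x ∈ xs → f x ≈ᴹ 0ᴹ) → Σ⟨ xs ⟩ f ≈ᴹ 0ᴹ
  sum-0 []       eq = ≈ᴹ-refl
  sum-0 (x ∷ xs) eq = ≈ᴹ-trans (+ᴹ-cong (eq (here refl)) (sum-0 xs (eq ∘ there))) (+ᴹ-identityˡ 0ᴹ)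

  sum-+ : ∀ (xs : List X) {f h} → Σ⟨ xs ⟩ (λ x → f x +ᴹ h x) ≈ᴹ Σ⟨ xs ⟩ f +ᴹ Σ⟨ xs ⟩ h
  sum-+ []       = ≈ᴹ-sym (+ᴹ-identityˡ 0ᴹ)
  sum-+ (x ∷ xs) = ≈ᴹ-trans (+ᴹ-congˡ (sum-+ xs)) (interchange _ _ _ _)

  sum-single : ∀ {xs : List X} {f x} → Unique xs → x ∈ xs → (∀ {y} → y ∈ xs → y ≢ x → f y ≈ᴹ 0ᴹ) →
      Σ⟨ xs ⟩ f ≈ᴹ f x
  sum-single {xs = x ∷ xs} (x∉ ∷ u) (here refl) z = ≈ᴹ-trans
    (+ᴹ-congˡ (sum-0 xs (λ y∈ → z (there y∈) (λ { refl → All.lookup x∉ y∈ refl })))) (+ᴹ-identityʳ _)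
  sum-single {xs = x ∷ xs} (x∉ ∷ u) (there y∈) z = ≈ᴹ-trans
    (+ᴹ-cong (z (here refl) (λ { refl → All.lookup x∉ y∈ refl })) (sum-single u y∈ (z ∘ there)))
        (+ᴹ-identityˡ _)

module Negation {K : CommutativeRing c ℓ} (N : Module K o ℓo) where
  private module K = CommutativeRing K
  open Module N
  open SetoidReasoning ≈ᴹ-setoid
  open AbelianGroupProperties +ᴹ-abelianGroup public using () renaming (⁻¹-∙-comm to -ᴹ-+-comm)
  open GroupProperties +ᴹ-group public using () renaming (ε⁻¹≈ε to -0≈0; inverseˡ-unique to -ᴹ-uniqueˡ)

  -- `Span` has no constructor for negation; through this identity it is closed under it.
  -1*≈- : ∀ x → (K.- K.1#) *ₗ x ≈ᴹ -ᴹ x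
  -1*≈- x = -ᴹ-uniqueˡ _ x (begin
    (K.- K.1#) *ₗ x +ᴹ x             ≈⟨ +ᴹ-congˡ (*ₗ-identityˡ x) ⟨
    (K.- K.1#) *ₗ x +ᴹ K.1# *ₗ x     ≈⟨ *ₗ-distribʳ x _ _ ⟨
    (K.- K.1# K.+ K.1#) *ₗ x         ≈⟨ *ₗ-cong (K.-‿inverseˡ K.1#) ≈ᴹ-refl ⟩
    K.0# *ₗ x                        ≈⟨ *ₗ-zeroˡ x ⟩
    0ᴹ                               ∎)

  -*≈ : ∀ k x → (K.- k) *ₗ x ≈ᴹ -ᴹ (k *ₗ x)
  -*≈ k x = -ᴹ-uniqueˡ _ _ (begin
    (K.- k) *ₗ x +ᴹ k *ₗ x  ≈⟨ *ₗ-distribʳ x _ _ ⟨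
    (K.- k K.+ k) *ₗ x      ≈⟨ *ₗ-cong (K.-‿inverseˡ k) ≈ᴹ-refl ⟩
    K.0# *ₗ x               ≈⟨ *ₗ-zeroˡ x ⟩
    0ᴹ                      ∎)

  *-≈ : ∀ k x → k *ₗ (-ᴹ x) ≈ᴹ -ᴹ (k *ₗ x)
  *-≈ k x = -ᴹ-uniqueˡ _ _ (begin
    k *ₗ (-ᴹ x) +ᴹ k *ₗ x  ≈⟨ *ₗ-distribˡ k _ _ ⟨
    k *ₗ ((-ᴹ x) +ᴹ x)     ≈⟨ *ₗ-cong K.refl (-ᴹ‿inverseˡ x) ⟩
    k *ₗ 0ᴹ                ≈⟨ *ₗ-zeroʳ k ⟩
    0ᴹ                     ∎)

module _ {K : CommutativeRing c ℓ} {G : Set g} (N : Module K o ℓo) where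
  private module K = CommutativeRing K
  open Module N

  -- Combinations are syntax trees, so these four equations determine a map from its values on
  -- generators by induction on the tree.
  record Linear (F : Combination K.Carrier G → Carrierᴹ) : Set (c ⊔ g ⊔ ℓo) where
    field
      +-homo : ∀ x y → F (x +ᶜ y) ≈ᴹ F x +ᴹ F y
      0-homo : F 0ᶜ ≈ᴹ 0ᴹ
      neg-homo : ∀ x → F (-ᶜ x) ≈ᴹ -ᴹ F x
      •-homo : ∀ k x → F (k • x) ≈ᴹ k *ₗ F x

module _ {K : CommutativeRing c ℓ} {G : Set g} {N : Module K o ℓo} where
  private module K = CommutativeRing K
  open Module N
  open Linear

  linear-ext : ∀ {F H : Combination K.Carrier G → Carrierᴹ} → Linear N F → Linear N H →
               (∀ x → F (gen x) ≈ᴹ H (gen x)) → ∀ x → F x ≈ᴹ H x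
  linear-ext lf lh eq (gen x)  = eq x
  linear-ext lf lh eq 0ᶜ       = ≈ᴹ-trans (0-homo lf) (≈ᴹ-sym (0-homo lh))
  linear-ext lf lh eq (x +ᶜ y) = ≈ᴹ-trans (+-homo lf x y)
    (≈ᴹ-trans (+ᴹ-cong (linear-ext lf lh eq x) (linear-ext lf lh eq y)) (≈ᴹ-sym (+-homo lh x y)))
  linear-ext lf lh eq (-ᶜ x)   = ≈ᴹ-trans (neg-homo lf x)
    (≈ᴹ-trans (-ᴹ‿cong (linear-ext lf lh eq x)) (≈ᴹ-sym (neg-homo lh x)))
  linear-ext lf lh eq (k • x)  = ≈ᴹ-trans (•-homo lf k x)
    (≈ᴹ-trans (*ₗ-cong K.refl (linear-ext lf lh eq x)) (≈ᴹ-sym (•-homo lh k x)))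

  lift-linear : ∀ {f : G → Carrierᴹ} → Linear N (lift N f)
  lift-linear = record { +-homo = λ _ _ → ≈ᴹ-refl ; 0-homo = ≈ᴹ-refl ; neg-homo = λ _ → ≈ᴹ-refl ;
      •-homo = λ _ _ → ≈ᴹ-refl }

  lift-≈ : ∀ {f h : G → Carrierᴹ} → (∀ x → f x ≈ᴹ h x) → ∀ x → lift N f x ≈ᴹ lift N h x
  lift-≈ = linear-ext lift-linear lift-linear

  lift-cong : ∀ {rel : Rel (Combination K.Carrier G) r} {f : G → Carrierᴹ} →
              (∀ {x y} → rel x y → lift N f x ≈ᴹ lift N f y) →
              ∀ {x y} → Congruence K rel x y → lift N f x ≈ᴹ lift N f y
  lift-cong resp (relation p)       = resp p
  lift-cong resp ≈-refl             = ≈ᴹ-refl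
  lift-cong resp (≈-sym p)          = ≈ᴹ-sym (lift-cong resp p)
  lift-cong resp (≈-trans p q)      = ≈ᴹ-trans (lift-cong resp p) (lift-cong resp q)
  lift-cong resp (+ᶜ-cong p q)      = +ᴹ-cong (lift-cong resp p) (lift-cong resp q)
  lift-cong resp (-ᶜ‿cong p)        = -ᴹ‿cong (lift-cong resp p)
  lift-cong resp (•-cong k p)       = *ₗ-cong k (lift-cong resp p)
  lift-cong resp (+ᶜ-assoc x y z)   = +ᴹ-assoc _ _ _
  lift-cong resp (+ᶜ-comm x y)      = +ᴹ-comm _ _
  lift-cong resp (+ᶜ-identityˡ x)   = +ᴹ-identityˡ _
  lift-cong resp (-ᶜ‿inverseˡ x)    = -ᴹ‿inverseˡ _
  lift-cong resp (•-zeroˡ x)        = *ₗ-zeroˡ _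
  lift-cong resp (•-zeroʳ k)        = *ₗ-zeroʳ _
  lift-cong resp (•-distribʳ x k k′) = *ₗ-distribʳ _ _ _
  lift-cong resp (•-distribˡ k x y) = *ₗ-distribˡ _ _ _
  lift-cong resp (•-identityˡ x)    = *ₗ-identityˡ _
  lift-cong resp (•-assoc k k′ x)   = *ₗ-assoc _ _ _

  lift-free-cong : ∀ {f : G → Carrierᴹ} {x y} → Module._≈ᴹ_ (Free K G) x y → lift N f x ≈ᴹ lift N f y
  lift-free-cong = lift-cong λ ()

  lift-isLinear : ∀ {f : G → Carrierᴹ} → IsLinear (Free K G) N (lift N f)
  lift-isLinear {f} = record
    { isBimoduleHomomorphism = record
      { +ᴹ-isGroupHomomorphism = record
        { isMonoidHomomorphism = record
          { isMagmaHomomorphism = record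
            { isRelHomomorphism = record { cong = lift-free-cong }
            ; homo = λ _ _ → ≈ᴹ-refl
            }
          ; ε-homo = ≈ᴹ-refl
          }
        ; ⁻¹-homo = λ _ → ≈ᴹ-refl
        }
      ; *ₗ-homo = λ _ _ → ≈ᴹ-refl
      ; *ᵣ-homo = λ k x → *ₗ-*ᵣ-coincident k (lift N f x)
      }
    }

  lift-sum : ∀ {f : G → Carrierᴹ} (xs : List X) {h : X → Combination K.Carrier G} →
             lift N f (sumOver (Free K G) xs h) ≡ sumOver N xs (λ x → lift N f (h x))
  lift-sum         []           = refl
  lift-sum {f = f} (x ∷ xs) {h} = cong (lift N f (h x) +ᴹ_) (lift-sum xs)

module _ {K : CommutativeRing c ℓ} {G : Set g} {N : Module K o ℓo} where
  private module K = CommutativeRing K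
  open Module N
  open Negation N
  open Linear

  private
    C = Combination K.Carrier G

  +-linear : {F H : C → Carrierᴹ} → Linear N F → Linear N H → Linear N (λ x → F x +ᴹ H x)
  +-linear lf lh = record
    { +-homo = λ x y → ≈ᴹ-trans (+ᴹ-cong (+-homo lf x y) (+-homo lh x y)) (interchange _ _ _ _)
    ; 0-homo = ≈ᴹ-trans (+ᴹ-cong (0-homo lf) (0-homo lh)) (+ᴹ-identityˡ 0ᴹ)
    ; neg-homo = λ x → ≈ᴹ-trans (+ᴹ-cong (neg-homo lf x) (neg-homo lh x)) (-ᴹ-+-comm _ _)
    ; •-homo = λ k x → ≈ᴹ-trans (+ᴹ-cong (•-homo lf k x) (•-homo lh k x)) (≈ᴹ-sym (*ₗ-distribˡ k _ _))
    }
    where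
    open CommutativeSemigroupProperties (CommutativeMonoid.commutativeSemigroup +ᴹ-commutativeMonoid)
      using (interchange)

  0-linear : Linear N (λ (_ : C) → 0ᴹ)
  0-linear = record
    { +-homo = λ _ _ → ≈ᴹ-sym (+ᴹ-identityˡ 0ᴹ)
    ; 0-homo = ≈ᴹ-refl
    ; neg-homo = λ _ → ≈ᴹ-sym -0≈0
    ; •-homo = λ k _ → ≈ᴹ-sym (*ₗ-zeroʳ k)
    }

  neg-linear : {F : C → Carrierᴹ} → Linear N F → Linear N (λ x → -ᴹ F x)
  neg-linear lf = record
    { +-homo = λ x y → ≈ᴹ-trans (-ᴹ‿cong (+-homo lf x y)) (≈ᴹ-sym (-ᴹ-+-comm _ _))
    ; 0-homo = ≈ᴹ-trans (-ᴹ‿cong (0-homo lf)) -0≈0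
    ; neg-homo = λ x → -ᴹ‿cong (neg-homo lf x)
    ; •-homo = λ k x → ≈ᴹ-trans (-ᴹ‿cong (•-homo lf k x)) (≈ᴹ-sym (*-≈ k _))
    }

  •-linear : ∀ k {F : C → Carrierᴹ} → Linear N F → Linear N (λ x → k *ₗ F x)
  •-linear k lf = record
    { +-homo = λ x y → ≈ᴹ-trans (*ₗ-cong K.refl (+-homo lf x y)) (*ₗ-distribˡ k _ _)
    ; 0-homo = ≈ᴹ-trans (*ₗ-cong K.refl (0-homo lf)) (*ₗ-zeroʳ k)
    ; neg-homo = λ x → ≈ᴹ-trans (*ₗ-cong K.refl (neg-homo lf x)) (*-≈ k _)
    ; •-homo = λ k′ x → ≈ᴹ-trans (*ₗ-cong K.refl (•-homo lf k′ x)) (≈ᴹ-trans (≈ᴹ-sym (*ₗ-assoc k k′ _))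
        (≈ᴹ-trans (*ₗ-cong (K.*-comm k k′) ≈ᴹ-refl) (*ₗ-assoc k′ k _)))
    }

  lift-linearʳ : ∀ {H : Set m} {F : H → C → Carrierᴹ} → (∀ h → Linear N (F h)) →
                 ∀ x → Linear N (λ y → lift N (λ h → F h y) x)
  lift-linearʳ lf (gen h)  = lf h
  lift-linearʳ lf 0ᶜ       = 0-linear
  lift-linearʳ lf (x +ᶜ y) = +-linear (lift-linearʳ lf x) (lift-linearʳ lf y)
  lift-linearʳ lf (-ᶜ x)   = neg-linear (lift-linearʳ lf x)
  lift-linearʳ lf (k • x)  = •-linear k (lift-linearʳ lf x)

module _ {K : CommutativeRing c ℓ} (M : Module K m ℓm) (N : Module K o ℓo) where
  private
    module K = CommutativeRing K
    module M = Module M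
    module N = Module N
    module M⊗N = Module (M ⊗ᴹ N)
  open SetoidReasoning M⊗N.≈ᴹ-setoid
  open Sums (M ⊗ᴹ N)

  -- `Bilinearity` has no relation for zero, so zero is rewritten as a multiple by the scalar 0,
  -- which is then pulled out of the tensor.
  ⊗-zeroˡ : ∀ y → M.0ᴹ ⊗ y M⊗N.≈ᴹ M⊗N.0ᴹ
  ⊗-zeroˡ y = begin
    M.0ᴹ ⊗ y               ≈⟨ relation (⊗-cong (M.*ₗ-zeroˡ M.0ᴹ) N.≈ᴹ-refl) ⟨
    (K.0# M.*ₗ M.0ᴹ) ⊗ y   ≈⟨ relation (⊗-*ₗ-assocˡ K.0# M.0ᴹ y) ⟩
    K.0# • (M.0ᴹ ⊗ y)      ≈⟨ •-zeroˡ _ ⟩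
    0ᶜ                     ∎

  ⊗-zeroʳ : ∀ x → x ⊗ N.0ᴹ M⊗N.≈ᴹ M⊗N.0ᴹ
  ⊗-zeroʳ x = begin
    x ⊗ N.0ᴹ               ≈⟨ relation (⊗-cong M.≈ᴹ-refl (N.*ₗ-zeroˡ N.0ᴹ)) ⟨
    x ⊗ (K.0# N.*ₗ N.0ᴹ)   ≈⟨ relation (⊗-*ₗ-assocʳ K.0# x N.0ᴹ) ⟩
    K.0# • (x ⊗ N.0ᴹ)      ≈⟨ •-zeroˡ _ ⟩
    0ᶜ                     ∎

  ⊗-sumˡ : ∀ (xs : List X) {f} y → sumOver M xs f ⊗ y M⊗N.≈ᴹ sumOver (M ⊗ᴹ N) xs (λ x → f x ⊗ y)
  ⊗-sumˡ []       y = ⊗-zeroˡ y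
  ⊗-sumˡ (x ∷ xs) y = ≈-trans (relation (⊗-distribʳ _ _ y)) (+ᶜ-cong ≈-refl (⊗-sumˡ xs y))

  ⊗-sumʳ : ∀ x (ys : List Y) {f} → x ⊗ sumOver N ys f M⊗N.≈ᴹ sumOver (M ⊗ᴹ N) ys (λ y → x ⊗ f y)
  ⊗-sumʳ x []       = ⊗-zeroʳ x
  ⊗-sumʳ x (y ∷ ys) = ≈-trans (relation (⊗-distribˡ x _ _)) (+ᶜ-cong ≈-refl (⊗-sumʳ x ys))

  ⊗-sum : ∀ (xs : List X) (ys : List Y) {f h} → sumOver M xs f ⊗ sumOver N ys h M⊗N.≈ᴹ
          sumOver (M ⊗ᴹ N) xs (λ x → sumOver (M ⊗ᴹ N) ys (λ y → f x ⊗ h y))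
  ⊗-sum xs ys = ≈-trans (⊗-sumˡ xs _) (sum-cong xs (λ _ → ⊗-sumʳ _ ys))

-- The bialgebra

linear-sum : ∀ {K : CommutativeRing c ℓ} {G : Set g} {N : Module K o ℓo}
    {F : Combination (CommutativeRing.Carrier K) G → Module.Carrierᴹ N} →
             Linear N F → ∀ (xs : List X) {h} →
             Module._≈ᴹ_ N (F (sumOver (Free K G) xs h)) (sumOver N xs (F ∘ h))
linear-sum         lf []       = Linear.0-homo lf
linear-sum {N = N} lf (x ∷ xs) = ≈ᴹ-trans (Linear.+-homo lf _ _) (+ᴹ-congˡ (linear-sum lf xs))
  where open Module N

id-linear : ∀ {K : CommutativeRing c ℓ} {G : Set g} → Linear (Free K G) id
id-linear {K = K} {G} = record { +-homo = λ _ _ → ≈ᴹ-refl ; 0-homo = ≈ᴹ-refl ; neg-homo = λ _ →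
    ≈ᴹ-refl ; •-homo = λ _ _ → ≈ᴹ-refl }
  where open Module (Free K G)

module _ {l : ℕ} where
  private
    B = ColouredParkingFunction l
  open ColouredParkingFunction using (size)

  break-0 : ∀ (b : B) → Breakpoint 0 (letters b)
  break-0 b = mkBreakpoint (cnt-0 (positive (letters-parking b)))

  break-size : ∀ (b : B) → Breakpoint (size b) (letters b)
  break-size b = subst (λ n → Breakpoint n (letters b)) (length-letters b)
      (mkBreakpoint (cnt-All-≤ (bounded (letters-parking b))))

  private
    mask-0 : ∀ {w} (u : List X) → All (1 ≤_) w → length u ≡ length w → mask 0 w ≡ replicate (length u) false
    mask-0 []      []           _  = refl
    mask-0 (_ ∷ u) (s≤s _ ∷ ps) eq = cong (false ∷_) (mask-0 u ps (suc-injective eq))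

    mask-all : ∀ {i w} (u : List X) → All (_≤ i) w → length u ≡ length w → mask i w ≡ replicate
        (length u) true
    mask-all []      []       _  = refl
    mask-all {i = i} (_ ∷ u) (_∷_ {x} p ps) eq = cong₂ _∷_ (dec-true (x ≤? i) p)
        (mask-all u ps (suc-injective eq))

  high-0 : ∀ (b : B) → high 0 b ≡ b
  high-0 b = coloured-≡
    (trans (letters-high b (break-0 b)) (trans (map-id _)
        (trans (cong (λ s → sel false s (letters b)) (mask-0 (letters b) pos refl))
        (sel-all false (letters b)))))
    (trans (hues-high b (break-0 b)) (trans (cong (λ s → sel false s (hues b))
        (mask-0 (hues b) pos (length-hues b))) (sel-all false (hues b))))
    where pos = positive (letters-parking b)

  low-size : ∀ (b : B) → low (size b) b ≡ b
  low-size b = coloured-≡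
    (trans (letters-low b (break-size b)) (trans
        (cong (λ s → sel true s (letters b)) (mask-all (letters b) bnd refl))
        (sel-all true (letters b))))
    (trans (hues-low b (break-size b)) (trans
        (cong (λ s → sel true s (hues b)) (mask-all (hues b) bnd (length-hues b)))
        (sel-all true (hues b))))
    where
    bnd : All (_≤ size b) (letters b)
    bnd = subst (λ n → All (_≤ n) (letters b)) (length-letters b) (bounded (letters-parking b))

  empty-≡ : ∀ {b b′ : B} → size b ≡ 0 → size b′ ≡ 0 → b ≡ b′
  empty-≡ {b} {b′} p q = coloured-≡
    (trans (nil (letters b) (trans (length-letters b) p))
        (sym (nil (letters b′) (trans (length-letters b′) q))))
    (trans (nil (hues b) (trans (length-hues b) (trans (length-letters b) p)))
        (sym (nil (hues b′) (trans (length-hues b′) (trans (length-letters b′) q)))))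
    where
    nil : ∀ (xs : List X) → length xs ≡ 0 → xs ≡ []
    nil [] _ = refl

module Bialgebra (K : CommutativeRing c ℓ) (l : ℕ) where
  private
    module K = CommutativeRing K
    B = ColouredParkingFunction l
    V = PQSymSpace K l
    V² = V ⊗ᴹ V
    V³ = V ⊗ᴹ V²
    U = ⟨module⟩ {R = K}
    module V² = Module V²
    module V³ = Module V³
  open ColouredParkingFunction using (size)
  open RawBialgebra (PQSym K l)
  open Sums V
  open Product

  module _ {o ℓo} (N : Module K o ℓo) where
    private module N = Module N
    open SetoidReasoning N.≈ᴹ-setoid

    -- The summand is arbitrary because the identity serves twice: for coassociativity of the
    -- coproduct and for associativity of the convolution of maps.
    coassoc-sum : ∀ (T : B → B → B → N.Carrierᴹ) b →
      sumOver N (breaks b) (λ i → sumOver N (breaks (low i b))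
          (λ j → T (low j (low i b)) (high j (low i b)) (high i b))) N.≈ᴹ
      sumOver N (breaks b) (λ j → sumOver N (breaks (high j b))
          (λ k → T (low j b) (low k (high j b)) (high k (high j b))))
    coassoc-sum T b = begin
      sumOver N (breaks b) (λ i → sumOver N (breaks (low i b))
          (λ j → T (low j (low i b)) (high j (low i b)) (high i b)))
        ≈⟨ Sums.sum-pairs N (λ i → breaks (low i b)) (breaks b) ⟨
      sumOver N (breaks² b) (λ (i , j) → T (low j (low i b)) (high j (low i b)) (high i b))
        ≈⟨ Sums.sum-cong N (breaks² b) (λ { {i , j} ij∈ → let bi , bj , j≤i = ∈-breaks²⁻ b ij∈ in
             N.≈ᴹ-reflexive (cong₃ (low-low {b = b} {i} {j} bi bj j≤i)
                 (high-low {b = b} {i} {j} bi bj j≤i) (high-high {b = b} {i} {j} bi bj j≤i)) }) ⟩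
      sumOver N (breaks² b) (λ (i , j) → T (low j b) (low (i ∸ j) (high j b)) (high (i ∸ j) (high j b)))
        ≡⟨ Sums.sum-map N (λ (i , j) → (j , i ∸ j)) (breaks² b) ⟨
      sumOver N (map (λ (i , j) → (j , i ∸ j)) (breaks² b))
          (λ (j , k) → T (low j b) (low k (high j b)) (high k (high j b)))
        ≈⟨ Sums.sum-↭ N (breaks-coassoc b) ⟩
      sumOver N (pairs (breaks b) (λ j → breaks (high j b)))
          (λ (j , k) → T (low j b) (low k (high j b)) (high k (high j b)))
        ≈⟨ Sums.sum-pairs N (λ j → breaks (high j b)) (breaks b) ⟩
      sumOver N (breaks b) (λ j → sumOver N (breaks (high j b))
          (λ k → T (low j b) (low k (high j b)) (high k (high j b)))) ∎
      where
      cong₃ : ∀ {x x′ y y′ z z′} → x ≡ x′ → y ≡ y′ → z ≡ z′ → T x y z ≡ T x′ y′ z′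
      cong₃ refl refl refl = refl

    -- The low part at a breakpoint `i` has size `i`, so only the breakpoint 0 survives.
    first-term : ∀ (f : B → B → N.Carrierᴹ) b → (∀ {b′} b″ → size b′ ≢ 0 → f b′ b″ N.≈ᴹ N.0ᴹ) →
                 sumOver N (breaks b) (λ i → f (low i b) (high i b)) N.≈ᴹ f (low 0 b) b
    first-term f b z = begin
      sumOver N (breaks b) (λ i → f (low i b) (high i b))
        ≈⟨ Sums.sum-single N (breaks-unique b) (∈-breakpoints⁺ b (break-0 b))
             (λ {i} i∈ i≢0 → z (high i b) (λ p → i≢0 (trans (sym (size-low b (∈-breakpoints⁻ b i∈))) p))) ⟩
      f (low 0 b) (high 0 b)  ≡⟨ cong (f (low 0 b)) (high-0 b) ⟩
      f (low 0 b) b           ∎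

    last-term : ∀ (f : B → B → N.Carrierᴹ) b → (∀ b′ {b″} → size b″ ≢ 0 → f b′ b″ N.≈ᴹ N.0ᴹ) →
                sumOver N (breaks b) (λ i → f (low i b) (high i b)) N.≈ᴹ f b (high (size b) b)
    last-term f b z = begin
      sumOver N (breaks b) (λ i → f (low i b) (high i b))
        ≈⟨ Sums.sum-single N (breaks-unique b) (∈-breakpoints⁺ b (break-size b))
             (λ {i} i∈ i≢n → z (low i b) (λ p → i≢n (trans (sym (+-identityʳ i))
                (trans (cong (i +_) (sym p)) (size-high b (∈-breakpoints⁻ b i∈)))))) ⟩
      f (low (size b) b) (high (size b) b)  ≡⟨ cong (λ b′ → f b′ (high (size b) b)) (low-size b) ⟩
      f b (high (size b) b)                 ∎

  size-low-0 : ∀ (b : B) → size (low 0 b) ≡ 0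
  size-low-0 b = size-low b (break-0 b)

  size-high-size : ∀ (b : B) → size (high (size b) b) ≡ 0
  size-high-size b = +-cancelˡ-≡ (size b) _ 0
      (trans (size-high b (break-size b)) (sym (+-identityʳ (size b))))

  counit-0 : ∀ {b : B} → size b ≡ 0 → 𝐆-counit K l b ≡ K.1#
  counit-0 {b} p = cong (if_then K.1# else K.0#) (dec-true (size b ≟ 0) p)

  counit-≢0 : ∀ {b : B} → size b ≢ 0 → 𝐆-counit K l b ≡ K.0#
  counit-≢0 {b} p = cong (if_then K.1# else K.0#) (dec-false (size b ≟ 0) p)

  product≡ : ∀ a b → 𝐆-product K l a b ≡ sumOver V (products a b) gen
  product≡ (coloured _ a′ u′) (coloured _ a″ u″) = sym (sum-map _ (a′ ✶ a″))

  ·-linearˡ : ∀ y → Linear V (_· y)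
  ·-linearˡ y = lift-linear {N = V}

  ·-linearʳ : ∀ x → Linear V (x ·_)
  ·-linearʳ x = lift-linearʳ {N = V} (λ _ → lift-linear {N = V}) x

  ·-cong : ∀ {x x′ y y′} → x ≈ᴹ x′ → y ≈ᴹ y′ → (x · y) ≈ᴹ (x′ · y′)
  ·-cong {x} {x′} {y} {y′} p q = ≈ᴹ-trans (lift-free-cong {N = V} p)
      (lift-≈ {N = V} (λ _ → lift-free-cong {N = V} q) x′)

  ·-sumˡ : ∀ (xs : List X) {f} y → (sumOver V xs f · y) ≈ᴹ sumOver V xs (λ x → f x · y)
  ·-sumˡ xs y = linear-sum {N = V} (·-linearˡ y) xs

  ·-sumʳ : ∀ x (ys : List Y) {f} → (x · sumOver V ys f) ≈ᴹ sumOver V ys (λ y → x · f y)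
  ·-sumʳ x ys = linear-sum {N = V} (·-linearʳ x) ys

  product-singleton : ∀ a b {x} → products a b ↭ x ∷ [] → (gen a · gen b) ≈ᴹ gen x
  product-singleton a b p = ≈ᴹ-trans (≈ᴹ-reflexive (product≡ a b)) (≈ᴹ-trans (sum-↭ p) (+ᴹ-identityʳ _))

  gen-assoc : ∀ a b c → ((gen a · gen b) · gen c) ≈ᴹ (gen a · (gen b · gen c))
  gen-assoc a b c = begin
    (gen a · gen b) · gen c
      ≡⟨ cong (_· gen c) (product≡ a b) ⟩
    sumOver V (products a b) gen · gen c
      ≈⟨ ·-sumˡ (products a b) (gen c) ⟩
    sumOver V (products a b) (λ d → gen d · gen c)
      ≈⟨ sum-cong (products a b) (λ {d} _ → ≈ᴹ-reflexive (product≡ d c)) ⟩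
    sumOver V (products a b) (λ d → sumOver V (products d c) gen)
      ≈⟨ sum-concatMap (λ d → products d c) (products a b) ⟨
    sumOver V (concatMap (λ d → products d c) (products a b)) gen
      ≈⟨ sum-↭ (products-assoc a b c) ⟩
    sumOver V (concatMap (products a) (products b c)) gen
      ≈⟨ sum-concatMap (products a) (products b c) ⟩
    sumOver V (products b c) (λ f → sumOver V (products a f) gen)
      ≈⟨ sum-cong (products b c) (λ {f} _ → ≈ᴹ-reflexive (product≡ a f)) ⟨
    sumOver V (products b c) (λ f → gen a · gen f)
      ≈⟨ ·-sumʳ (gen a) (products b c) ⟨
    gen a · sumOver V (products b c) gen
      ≡⟨ cong (gen a ·_) (product≡ b c) ⟨
    gen a · (gen b · gen c) ∎
    where open SetoidReasoning ≈ᴹ-setoid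

  ∘-linear : ∀ {o ℓo} {N : Module K o ℓo} {f : B → Module.Carrierᴹ N} {F : Carrierᴹ → Carrierᴹ} →
             Linear V F → Linear N (λ x → lift N f (F x))
  ∘-linear {N = N} lf = record
    { +-homo = λ x y → lift-free-cong {N = N} (Linear.+-homo lf x y)
    ; 0-homo = lift-free-cong {N = N} (Linear.0-homo lf)
    ; neg-homo = λ x → lift-free-cong {N = N} (Linear.neg-homo lf x)
    ; •-homo = λ k x → lift-free-cong {N = N} (Linear.•-homo lf k x)
    }

  ·-∘-linear : ∀ x {F : Carrierᴹ → Carrierᴹ} → Linear V F → Linear V (λ y → x · F y)
  ·-∘-linear x lf = lift-linearʳ {N = V} (λ _ → ∘-linear {N = V} lf) x

  ·-assoc : ∀ x y z → ((x · y) · z) ≈ᴹ (x · (y · z))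
  ·-assoc x y z = linear-ext {N = V} {F = λ x → (x · y) · z} {H = λ x → x · (y · z)}
    (record { +-homo = λ _ _ → ≈ᴹ-refl ; 0-homo = ≈ᴹ-refl ; neg-homo = λ _ → ≈ᴹ-refl ; •-homo = λ _
        _ → ≈ᴹ-refl })
    (·-linearˡ (y · z))
    (λ a → linear-ext {N = V} {F = λ y → (gen a · y) · z} {H = λ y → gen a · (y · z)}
      (∘-linear {N = V} (·-linearʳ (gen a)))
      (·-∘-linear (gen a) (·-linearˡ z))
      (λ b → linear-ext {N = V} (·-linearʳ (gen a · gen b)) (·-∘-linear (gen a) (·-linearʳ (gen b)))
          (gen-assoc a b) z) y) x

  ·-identityˡ : ∀ x → (𝟙 · x) ≈ᴹ x
  ·-identityˡ = linear-ext {N = V} (·-linearʳ 𝟙) id-linear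
      (λ b → product-singleton ∅ b (products-identityˡ b))

  ·-identityʳ : ∀ x → (x · 𝟙) ≈ᴹ x
  ·-identityʳ = linear-ext {N = V} (·-linearˡ 𝟙) id-linear
      (λ b → product-singleton b ∅ (products-identityʳ b))

  isAlgebra : IsAlgebra algebra
  isAlgebra = record
    { isRing = record
      { +-isAbelianGroup = +ᴹ-isAbelianGroup
      ; *-cong = ·-cong
      ; *-assoc = ·-assoc
      ; *-identity = ·-identityˡ , ·-identityʳ
      ; distrib = (λ x y z → Linear.+-homo (·-linearʳ x) y z) , (λ x y z → Linear.+-homo (·-linearˡ x) y z)
      }
    ; *ₗ-·-assoc = λ k x y → Linear.•-homo (·-linearˡ y) k x
    ; ·-*ₗ-comm = λ k x y → Linear.•-homo (·-linearʳ x) k y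
    }

  isCoalgebra : IsCoalgebra space Δ ε
  isCoalgebra = record
    { Δ-isLinear = lift-isLinear
    ; ε-isLinear = lift-isLinear
    ; coassoc = linear-ext {N = V³}
        (record { +-homo = λ _ _ → V³.≈ᴹ-refl ; 0-homo = V³.≈ᴹ-refl ; neg-homo = λ _ → V³.≈ᴹ-refl ;
            •-homo = λ _ _ → V³.≈ᴹ-refl })
        (record { +-homo = λ _ _ → V³.≈ᴹ-refl ; 0-homo = V³.≈ᴹ-refl ; neg-homo = λ _ → V³.≈ᴹ-refl ;
            •-homo = λ _ _ → V³.≈ᴹ-refl })
        gen-coassoc
    ; counitˡ = linear-ext {N = V}
        (record { +-homo = λ _ _ → ≈ᴹ-refl ; 0-homo = ≈ᴹ-refl ; neg-homo = λ _ → ≈ᴹ-refl ; •-homo =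
            λ _ _ → ≈ᴹ-refl })
        id-linear gen-counitˡ
    ; counitʳ = linear-ext {N = V}
        (record { +-homo = λ _ _ → ≈ᴹ-refl ; 0-homo = ≈ᴹ-refl ; neg-homo = λ _ → ≈ᴹ-refl ; •-homo =
            λ _ _ → ≈ᴹ-refl })
        id-linear gen-counitʳ
    }
    where
    gen-counitˡ : ∀ b → lift V (λ (x₁ , x₂) → ε x₁ *ₗ x₂) (Δ (gen b)) ≈ᴹ gen b
    gen-counitˡ b = begin
      lift V (λ (x₁ , x₂) → ε x₁ *ₗ x₂) (Δ (gen b))
        ≡⟨ lift-sum (breaks b) ⟩
      sumOver V (breaks b) (λ i → 𝐆-counit K l (low i b) *ₗ gen (high i b))
        ≈⟨ first-term V (λ b′ b″ → 𝐆-counit K l b′ *ₗ gen b″) b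
             (λ {b′} b″ p → ≈ᴹ-trans (*ₗ-cong (K.reflexive (counit-≢0 {b′} p)) ≈ᴹ-refl) (*ₗ-zeroˡ (gen b″))) ⟩
      𝐆-counit K l (low 0 b) *ₗ gen b  ≈⟨ *ₗ-cong (K.reflexive (counit-0 {low 0 b} (size-low-0 b))) ≈ᴹ-refl ⟩
      K.1# *ₗ gen b                    ≈⟨ *ₗ-identityˡ (gen b) ⟩
      gen b                            ∎
      where open SetoidReasoning ≈ᴹ-setoid

    gen-counitʳ : ∀ b → lift V (λ (x₁ , x₂) → ε x₂ *ₗ x₁) (Δ (gen b)) ≈ᴹ gen b
    gen-counitʳ b = begin
      lift V (λ (x₁ , x₂) → ε x₂ *ₗ x₁) (Δ (gen b))
        ≡⟨ lift-sum (breaks b) ⟩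
      sumOver V (breaks b) (λ i → 𝐆-counit K l (high i b) *ₗ gen (low i b))
        ≈⟨ last-term V (λ b′ b″ → 𝐆-counit K l b″ *ₗ gen b′) b
             (λ b′ {b″} p → ≈ᴹ-trans (*ₗ-cong (K.reflexive (counit-≢0 {b″} p)) ≈ᴹ-refl) (*ₗ-zeroˡ (gen b′))) ⟩
      𝐆-counit K l (high (size b) b) *ₗ gen b
          ≈⟨ *ₗ-cong (K.reflexive (counit-0 {high (size b) b} (size-high-size b))) ≈ᴹ-refl ⟩
      K.1# *ₗ gen b                            ≈⟨ *ₗ-identityˡ (gen b) ⟩
      gen b                                    ∎
      where open SetoidReasoning ≈ᴹ-setoid

    gen-coassoc : ∀ b →
      lift V³ (λ (x , y) → lift V³ (λ (x₁ , x₂) → x₁ ⊗ (x₂ ⊗ y)) (Δ x)) (Δ (gen b)) V³.≈ᴹ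
      lift V³ (λ (x , y) → x ⊗ Δ y) (Δ (gen b))
    gen-coassoc b = begin
      lift V³ (λ (x , y) → lift V³ (λ (x₁ , x₂) → x₁ ⊗ (x₂ ⊗ y)) (Δ x)) (Δ (gen b))
        ≡⟨ lift-sum (breaks b) ⟩
      sumOver V³ (breaks b) (λ i → lift V³ (λ (x₁ , x₂) → x₁ ⊗ (x₂ ⊗ gen (high i b))) (Δ (gen (low i b))))
        ≈⟨ Sums.sum-cong V³ (breaks b) (λ {i} _ → V³.≈ᴹ-reflexive (lift-sum (breaks (low i b)))) ⟩
      sumOver V³ (breaks b) (λ i → sumOver V³ (breaks (low i b)) (λ j →
        gen (low j (low i b)) ⊗ (gen (high j (low i b)) ⊗ gen (high i b))))
        ≈⟨ coassoc-sum V³ (λ x y z → gen x ⊗ (gen y ⊗ gen z)) b ⟩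
      sumOver V³ (breaks b) (λ j → sumOver V³ (breaks (high j b)) (λ k →
        gen (low j b) ⊗ (gen (low k (high j b)) ⊗ gen (high k (high j b)))))
        ≈⟨ Sums.sum-cong V³ (breaks b) (λ {j} _ → ⊗-sumʳ V V² (gen (low j b)) (breaks (high j b))) ⟨
      sumOver V³ (breaks b) (λ j → gen (low j b) ⊗ Δ (gen (high j b)))
        ≡⟨ lift-sum (breaks b) ⟨
      lift V³ (λ (x , y) → x ⊗ Δ y) (Δ (gen b)) ∎
      where open SetoidReasoning V³.≈ᴹ-setoid

  private
    infixl 7 _·²_
    _·²_ = RawAlgebra._·_ algebra²

  gen-compat : ∀ a b → Δ (gen a · gen b) V².≈ᴹ (Δ (gen a) ·² Δ (gen b))
  gen-compat a b = begin
    Δ (gen a · gen b)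
      ≡⟨ cong Δ (product≡ a b) ⟩
    Δ (sumOver V (products a b) gen)
      ≡⟨ lift-sum (products a b) ⟩
    sumOver V² (products a b) (λ e → sumOver V² (breaks e) (λ k → gen (low k e) ⊗ gen (high k e)))
      ≈⟨ Sums.sum-pairs V² breaks (products a b) ⟨
    sumOver V² (splittings a b) (λ (e , k) → gen (low k e) ⊗ gen (high k e))
      -- Only the last two entries of a factorisation enter the summand; the first two are carried
      -- along for the reindexing.
      ≡⟨ Sums.sum-map V² (factorise a) (splittings a b) ⟨
    sumOver V² (map (factorise a) (splittings a b)) (λ (_ , _ , c , c′) → gen c ⊗ gen c′)
      ≈⟨ Sums.sum-↭ V² (factorise-↭ a b) ⟩
    sumOver V² (factorisations a b) (λ (_ , _ , c , c′) → gen c ⊗ gen c′)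
      ≈⟨ Sums.sum-pairs V² _ (breaks a) ⟩
    sumOver V² (breaks a) (λ i → sumOver V² (pairs (breaks b)
        (λ j → pairs (products (low i a) (low j b)) λ _ → products (high i a) (high j b)))
      (λ (_ , c , c′) → gen c ⊗ gen c′))
      ≈⟨ Sums.sum-cong V² (breaks a) (λ {i} _ → V².≈ᴹ-trans (Sums.sum-pairs V² _ (breaks b))
           (Sums.sum-cong V² (breaks b) (λ {j} _ → inner i j))) ⟩
    sumOver V² (breaks a) (λ i → sumOver V² (breaks b)
        (λ j → (gen (low i a) · gen (low j b)) ⊗ (gen (high i a) · gen (high j b))))
      ≈⟨ Sums.sum-cong V² (breaks a) (λ {i} _ → V².≈ᴹ-reflexive (lift-sum (breaks b))) ⟨
    sumOver V² (breaks a) (λ i → lift V² (λ (x′ , y′) → (gen (low i a) · x′) ⊗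
        (gen (high i a) · y′)) (Δ (gen b)))
      ≡⟨ lift-sum (breaks a) ⟨
    Δ (gen a) ·² Δ (gen b) ∎
    where
    open SetoidReasoning V².≈ᴹ-setoid
    inner : ∀ i j → sumOver V² (pairs (products (low i a) (low j b))
        (λ _ → products (high i a) (high j b))) (λ (c , c′) → gen c ⊗ gen c′) V².≈ᴹ
                    (gen (low i a) · gen (low j b)) ⊗ (gen (high i a) · gen (high j b))
    inner i j = begin
      sumOver V² (pairs (products (low i a) (low j b)) (λ _ → products (high i a) (high j b)))
          (λ (c , c′) → gen c ⊗ gen c′)
        ≈⟨ Sums.sum-pairs V² (λ _ → products (high i a) (high j b)) (products (low i a) (low j b)) ⟩
      sumOver V² (products (low i a) (low j b))
          (λ c → sumOver V² (products (high i a) (high j b)) (λ c′ → gen c ⊗ gen c′))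
        ≈⟨ ⊗-sum V V (products (low i a) (low j b)) (products (high i a) (high j b)) ⟨
      sumOver V (products (low i a) (low j b)) gen ⊗ sumOver V (products (high i a) (high j b)) gen
        ≡⟨ cong₂ _⊗_ (product≡ (low i a) (low j b)) (product≡ (high i a) (high j b)) ⟨
      (gen (low i a) · gen (low j b)) ⊗ (gen (high i a) · gen (high j b)) ∎

  Δ-isAlgebraHomomorphism : IsAlgebraHomomorphism algebra algebra² Δ
  Δ-isAlgebraHomomorphism = record
    { isLinear = lift-isLinear
    ; ·-homo = λ x y → linear-ext {N = V²} {F = λ x → Δ (x · y)} {H = λ x → Δ x ·² Δ y}
        (record { +-homo = λ _ _ → V².≈ᴹ-refl ; 0-homo = V².≈ᴹ-refl ; neg-homo = λ _ → V².≈ᴹ-refl ;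
            •-homo = λ _ _ → V².≈ᴹ-refl })
        (record { +-homo = λ _ _ → V².≈ᴹ-refl ; 0-homo = V².≈ᴹ-refl ; neg-homo = λ _ → V².≈ᴹ-refl ;
            •-homo = λ _ _ → V².≈ᴹ-refl })
        (λ a → linear-ext {N = V²} {F = λ y → Δ (gen a · y)} {H = λ y → Δ (gen a) ·² Δ y}
            (∘-linear {N = V²} (·-linearʳ (gen a)))
          (lift-linearʳ {N = V²} (λ _ → record
              { +-homo = λ _ _ → V².≈ᴹ-refl ; 0-homo = V².≈ᴹ-refl ; neg-homo = λ _ → V².≈ᴹ-refl ;
              •-homo = λ _ _ → V².≈ᴹ-refl }) (Δ (gen a)))
          (gen-compat a) y) x
    ; 𝟙-homo = V².≈ᴹ-trans (V².+ᴹ-identityʳ _) (V².≈ᴹ-reflexive (cong₂ (λ b b′ → gen b ⊗ gen b′)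
        (empty-≡ {b = low 0 ∅} {∅} refl refl) (empty-≡ {b = high 0 ∅} {∅} refl refl)))
    }

  -- If `a` is nonempty, so is every word of the product, and both sides vanish; otherwise `a` is
  -- `∅` and acts as the identity.
  gen-ε-homo : ∀ a b → ε (gen a · gen b) K.≈ ε (gen a) K.* ε (gen b)
  gen-ε-homo a b = begin
    ε (gen a · gen b)                             ≡⟨ cong ε (product≡ a b) ⟩
    ε (sumOver V (products a b) gen)              ≡⟨ lift-sum (products a b) ⟩
    sumOver U (products a b) (𝐆-counit K l) ≈⟨ case ⟩
    𝐆-counit K l a K.* 𝐆-counit K l b             ∎
    where
    open SetoidReasoning K.setoid
    case : sumOver U (products a b) (𝐆-counit K l) K.≈ 𝐆-counit K l a K.* 𝐆-counit K l b
    case with size a ≟ 0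
    ... | no a≢0 = K.trans (Sums.sum-0 U (products a b) (λ {e} e∈ → K.reflexive (counit-≢0 {e}
                     (λ p → a≢0 (m+n≡0⇒m≡0 (size a) (trans (sym (sizes (∈-products⁻ a b e∈))) p))))))
                   (K.trans (K.sym (K.zeroˡ _)) (K.*-cong (K.sym (K.reflexive (counit-≢0 {a} a≢0))) K.refl))
    ... | yes a≡0 with empty-≡ {b = a} {b′ = ∅} a≡0 refl
    ...   | refl = K.trans (Sums.sum-↭ U (products-identityˡ b))
        (K.trans (K.+-identityʳ _) (K.sym (K.*-identityˡ _)))

  ε-isAlgebraHomomorphism : IsAlgebraHomomorphism algebra groundAlgebra ε
  ε-isAlgebraHomomorphism = record
    { isLinear = lift-isLinear
    ; ·-homo = λ x y → linear-ext {N = U} {F = λ x → ε (x · y)} {H = λ x → ε x K.* ε y}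
        (record { +-homo = λ _ _ → K.refl ; 0-homo = K.refl ; neg-homo = λ _ → K.refl ; •-homo = λ _
            _ → K.refl })
        (record { +-homo = λ _ _ → K.distribʳ _ _ _ ; 0-homo = K.zeroˡ _
                ; neg-homo = λ _ → K.sym (RingProperties.-‿distribˡ-* K.ring _ _) ; •-homo = λ _ _ →
                    K.*-assoc _ _ _ })
        (λ a → linear-ext {N = U} {F = λ y → ε (gen a · y)} {H = λ y → ε (gen a) K.* ε y}
            (∘-linear {N = U} (·-linearʳ (gen a)))
          (record { +-homo = λ _ _ → K.distribˡ _ _ _ ; 0-homo = K.zeroʳ _
                  ; neg-homo = λ _ → K.sym (RingProperties.-‿distribʳ-* K.ring _ _)
                  ; •-homo = λ k y → K.trans (K.sym (K.*-assoc _ _ _))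
                      (K.trans (K.*-cong (K.*-comm _ k) K.refl) (K.*-assoc _ _ _)) })
          (gen-ε-homo a) y) x
    ; 𝟙-homo = K.refl
    }
    where import Algebra.Properties.Ring as RingProperties

  isBialgebra : IsBialgebra (PQSym K l)
  isBialgebra = record
    { isAlgebra = isAlgebra
    ; isCoalgebra = isCoalgebra
    ; Δ-isAlgebraHomomorphism = Δ-isAlgebraHomomorphism
    ; ε-isAlgebraHomomorphism = ε-isAlgebraHomomorphism
    }

-- The antipode

module Hopf (K : CommutativeRing c ℓ) (l : ℕ) where
  private
    module K = CommutativeRing K
    B = ColouredParkingFunction l
    V = PQSymSpace K l
  open ColouredParkingFunction using (size)
  open RawBialgebra (PQSym K l)
  open Bialgebra K l
  open Sums V
  open Negation V
  open SetoidReasoning ≈ᴹ-setoid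

  ·-zeroˡ : ∀ x → (0ᴹ · x) ≈ᴹ 0ᴹ
  ·-zeroˡ x = Linear.0-homo (·-linearˡ x)

  ·-zeroʳ : ∀ x → (x · 0ᴹ) ≈ᴹ 0ᴹ
  ·-zeroʳ x = Linear.0-homo (·-linearʳ x)

  private
    Fun = B → Carrierᴹ
    variable
      f f′ h h′ k : Fun

  infix  4 _≋_
  infixl 7 _⋆_
  infixl 6 _⊞_

  _≋_ : Fun → Fun → Set _
  f ≋ h = ∀ b → f b ≈ᴹ h b

  _⊞_ : Fun → Fun → Fun
  (f ⊞ h) b = f b +ᴹ h b

  -- The convolution of two linear maps, given by their values on the basis.
  _⋆_ : Fun → Fun → Fun
  (f ⋆ h) b = sumOver V (breaks b) (λ i → f (low i b) · h (high i b))

  -- Unit after counit on the basis, the neutral element for `_⋆_`.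
  η : Fun
  η b = if does (size b ≟ 0) then 𝟙 else 0ᴹ

  η-0 : ∀ {b} → size b ≡ 0 → η b ≡ 𝟙
  η-0 {b} p = cong (if_then 𝟙 else 0ᴹ) (dec-true (size b ≟ 0) p)

  η-≢0 : ∀ {b} → size b ≢ 0 → η b ≡ 0ᴹ
  η-≢0 {b} p = cong (if_then 𝟙 else 0ᴹ) (dec-false (size b ≟ 0) p)

  ≋-trans : f ≋ h → h ≋ k → f ≋ k
  ≋-trans p q b = ≈ᴹ-trans (p b) (q b)

  ≋-sym : f ≋ h → h ≋ f
  ≋-sym p b = ≈ᴹ-sym (p b)

  ≋-refl : f ≋ f
  ≋-refl b = ≈ᴹ-refl

  ⊞-cong : f ≋ f′ → h ≋ h′ → f ⊞ h ≋ f′ ⊞ h′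
  ⊞-cong p q b = +ᴹ-cong (p b) (q b)

  ⋆-cong : f ≋ f′ → h ≋ h′ → f ⋆ h ≋ f′ ⋆ h′
  ⋆-cong {f} {f′} {h} {h′} p q b = sum-cong (breaks b)
    (λ {i} _ → ·-cong {f (low i b)} {f′ (low i b)} {h (high i b)} {h′ (high i b)} (p (low i b))
        (q (high i b)))

  ⋆-distribˡ : ∀ f h k → f ⋆ (h ⊞ k) ≋ (f ⋆ h) ⊞ (f ⋆ k)
  ⋆-distribˡ f h k b = ≈ᴹ-trans
    (sum-cong (breaks b) (λ {i} _ → Linear.+-homo (·-linearʳ (f (low i b))) (h (high i b)) (k (high i b))))
    (sum-+ (breaks b))

  ⋆-distribʳ : ∀ f h k → (f ⊞ h) ⋆ k ≋ (f ⋆ k) ⊞ (h ⋆ k)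
  ⋆-distribʳ f h k b = sum-+ (breaks b)

  ⋆-assoc : ∀ f h k → (f ⋆ h) ⋆ k ≋ f ⋆ (h ⋆ k)
  ⋆-assoc f h k b = begin
    sumOver V (breaks b) (λ i → (f ⋆ h) (low i b) · k (high i b))
      ≈⟨ sum-cong (breaks b) (λ {i} _ → ·-sumˡ (breaks (low i b)) (k (high i b))) ⟩
    sumOver V (breaks b) (λ i → sumOver V (breaks (low i b))
        (λ j → (f (low j (low i b)) · h (high j (low i b))) · k (high i b)))
      ≈⟨ coassoc-sum V (λ x y z → (f x · h y) · k z) b ⟩
    sumOver V (breaks b) (λ j → sumOver V (breaks (high j b))
        (λ m → (f (low j b) · h (low m (high j b))) · k (high m (high j b))))
      ≈⟨ sum-cong (breaks b) (λ {j} _ → sum-cong (breaks (high j b))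
          (λ {m} _ → ·-assoc (f (low j b)) (h (low m (high j b))) (k (high m (high j b))))) ⟩
    sumOver V (breaks b) (λ j → sumOver V (breaks (high j b))
        (λ m → f (low j b) · (h (low m (high j b)) · k (high m (high j b)))))
      ≈⟨ sum-cong (breaks b) (λ {j} _ → ·-sumʳ (f (low j b)) (breaks (high j b))) ⟨
    sumOver V (breaks b) (λ j → f (low j b) · (h ⋆ k) (high j b)) ∎

  ⋆-identityˡ : ∀ f → η ⋆ f ≋ f
  ⋆-identityˡ f b = begin
    (η ⋆ f) b           ≈⟨ first-term V (λ b′ b″ → η b′ · f b″) b
                             (λ {b′} b″ p → ≈ᴹ-trans (≈ᴹ-reflexive (cong (_· f b″) (η-≢0 {b′} p)))
                                 (·-zeroˡ (f b″))) ⟩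
    η (low 0 b) · f b   ≡⟨ cong (_· f b) (η-0 {low 0 b} (size-low-0 b)) ⟩
    𝟙 · f b             ≈⟨ ·-identityˡ (f b) ⟩
    f b                 ∎

  ⋆-identityʳ : ∀ f → f ⋆ η ≋ f
  ⋆-identityʳ f b = begin
    (f ⋆ η) b                   ≈⟨ last-term V (λ b′ b″ → f b′ · η b″) b
                                     (λ b′ {b″} p → ≈ᴹ-trans
                                         (≈ᴹ-reflexive (cong (f b′ ·_) (η-≢0 {b″} p)))
                                         (·-zeroʳ (f b′))) ⟩
    f b · η (high (size b) b)   ≡⟨ cong (f b ·_) (η-0 {high (size b) b} (size-high-size b)) ⟩
    f b · 𝟙                     ≈⟨ ·-identityʳ (f b) ⟩
    f b                         ∎

  -- η − id, which vanishes in degree 0; hence its convolution powers applied to b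
  -- vanish from the exponent size b + 1 on, and their sum is the inverse of id.
  ν : Fun
  ν b = if does (size b ≟ 0) then 0ᴹ else (-ᴹ gen b)

  ν-0 : ∀ {b} → size b ≡ 0 → ν b ≡ 0ᴹ
  ν-0 {b} p = cong (if_then 0ᴹ else (-ᴹ gen b)) (dec-true (size b ≟ 0) p)

  id+ν : ∀ b → gen b +ᴹ ν b ≈ᴹ η b
  id+ν b with size b ≟ 0
  ... | yes p = begin
    gen b +ᴹ ν b     ≡⟨ cong (gen b +ᴹ_) (ν-0 {b} p) ⟩
    gen b +ᴹ 0ᴹ      ≈⟨ +ᴹ-identityʳ (gen b) ⟩
    gen b            ≡⟨ cong gen (empty-≡ {b = b} {∅} p refl) ⟩
    𝟙                ≡⟨ η-0 {b} p ⟨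
    η b              ∎
  ... | no ¬p = begin
    gen b +ᴹ ν b        ≡⟨ cong (λ t → gen b +ᴹ (if t then 0ᴹ else (-ᴹ gen b))) (dec-false (size b ≟ 0) ¬p) ⟩
    gen b +ᴹ (-ᴹ gen b) ≈⟨ -ᴹ‿inverseʳ (gen b) ⟩
    0ᴹ                  ≡⟨ η-≢0 {b} ¬p ⟨
    η b                 ∎

  -- Horner form of the sum of the convolution powers of `ν` with exponents 0 to n.
  partialInverse : ℕ → Fun
  partialInverse zero    = η
  partialInverse (suc n) = η ⊞ (partialInverse n ⋆ ν)

  -- The definition splits off a factor `ν` on the right. Powers of `ν` commute, so it may also be
  -- split off on the left, as the right inverse law requires.
  partialInverse-suc : ∀ n → partialInverse (suc n) ≋ η ⊞ (ν ⋆ partialInverse n)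
  partialInverse-suc zero    = ⊞-cong {η} {η} ≋-refl
      (≋-trans {η ⋆ ν} {ν} {ν ⋆ η} (⋆-identityˡ ν) (≋-sym {ν ⋆ η} {ν} (⋆-identityʳ ν)))
  partialInverse-suc (suc n) = ⊞-cong {η} {η} ≋-refl λ b → begin
    (partialInverse (suc n) ⋆ ν) b                ≈⟨ ⋆-cong {h = ν} (partialInverse-suc n) ≋-refl b ⟩
    ((η ⊞ (ν ⋆ p)) ⋆ ν) b                         ≈⟨ ⋆-distribʳ η (ν ⋆ p) ν b ⟩
    (η ⋆ ν) b +ᴹ ((ν ⋆ p) ⋆ ν) b                  ≈⟨ +ᴹ-cong (⋆-identityˡ ν b) (⋆-assoc ν p ν b) ⟩
    ν b +ᴹ (ν ⋆ (p ⋆ ν)) b                        ≈⟨ +ᴹ-congʳ (⋆-identityʳ ν b) ⟨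
    (ν ⋆ η) b +ᴹ (ν ⋆ (p ⋆ ν)) b                  ≈⟨ ⋆-distribˡ ν η (p ⋆ ν) b ⟨
    (ν ⋆ partialInverse (suc n)) b                ∎
    where p = partialInverse n

  private
    size-low-< : ∀ {i} (b : B) → Breakpoint i (letters b) → size (high i b) ≢ 0 → size (low i b) < size b
    size-low-< {i} b bi p = subst (size (low i b) <_)
      (trans (cong (_+ size (high i b)) (size-low b bi)) (size-high b bi))
          (m<m+n (size (low i b)) (n≢0⇒n>0 p))

    ·-ν-0 : ∀ x b → size b ≡ 0 → (x · ν b) ≈ᴹ 0ᴹ
    ·-ν-0 x b p = ≈ᴹ-trans (≈ᴹ-reflexive (cong (x ·_) (ν-0 {b} p))) (·-zeroʳ x)

    -- Where the high part is empty, `ν` kills the term; in every other term the low part is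
    -- strictly smaller than `b`.
    ⋆ν-cong : ∀ {f h} b → (∀ b′ → size b′ < size b → f b′ ≈ᴹ h b′) → (f ⋆ ν) b ≈ᴹ (h ⋆ ν) b
    ⋆ν-cong {f} {h} b eq = sum-cong (breaks b) term
      where
      term : ∀ {i} → i ∈ breaks b → (f (low i b) · ν (high i b)) ≈ᴹ (h (low i b) · ν (high i b))
      term {i} i∈ with size (high i b) ≟ 0
      ... | yes p = ≈ᴹ-trans (·-ν-0 (f (low i b)) (high i b) p) (≈ᴹ-sym (·-ν-0 (h (low i b)) (high i b) p))
      ... | no ¬p = ·-cong {f (low i b)} {h (low i b)} {ν (high i b)}
          (eq (low i b) (size-low-< {i} b (∈-breakpoints⁻ b i∈) ¬p)) ≈ᴹ-refl

    -- Agreement up to and including the size of `b` is available here, since the partial inverse of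
    -- index `size b` equals the antipode on all these sizes.
    ν⋆-cong : ∀ {f h} b → (∀ b′ → size b′ ≤ size b → f b′ ≈ᴹ h b′) → (ν ⋆ f) b ≈ᴹ (ν ⋆ h) b
    ν⋆-cong {f} {h} b eq = sum-cong (breaks b)
        (λ {i} i∈ → ·-cong {ν (low i b)} {ν (low i b)} {f (high i b)} {h (high i b)} ≈ᴹ-refl
      (eq (high i b) (subst (size (high i b) ≤_) (size-high b (∈-breakpoints⁻ b i∈)) (m≤n+m _ i))))

  -- The additional power of `ν` vanishes at `b`: every factor `ν` consumes at least one unit of
  -- size.
  partialInverse-stable : ∀ n b → size b ≤ n → partialInverse (suc n) b ≈ᴹ partialInverse n b
  partialInverse-stable zero    b le = ≈ᴹ-trans (+ᴹ-congˡ (sum-0 (breaks b) (λ {i} i∈ →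
    ·-ν-0 (η (low i b)) (high i b) (n≤0⇒n≡0 (≤-trans
        (subst (size (high i b) ≤_) (size-high b (∈-breakpoints⁻ b i∈)) (m≤n+m _ i)) le)))))
    (+ᴹ-identityʳ (η b))
  partialInverse-stable (suc n) b le = +ᴹ-congˡ (⋆ν-cong {partialInverse (suc n)} {partialInverse n} b
    (λ b′ lt → partialInverse-stable n b′ (s≤s⁻¹ (≤-trans lt le))))

  antipode : Fun
  antipode b = partialInverse (size b) b

  partialInverse-antipode : ∀ n b → size b ≤ n → partialInverse n b ≈ᴹ antipode b
  partialInverse-antipode n b le with m≤n⇒m<n∨m≡n le
  ... | inj₂ refl = ≈ᴹ-refl
  partialInverse-antipode (suc n) b le | inj₁ (s≤s lt) =
    ≈ᴹ-trans (partialInverse-stable n b lt) (partialInverse-antipode n b lt)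

  antipode-recˡ : antipode ≋ η ⊞ (antipode ⋆ ν)
  antipode-recˡ b = ≈ᴹ-trans (≈ᴹ-sym (partialInverse-antipode (suc (size b)) b (n≤1+n _)))
    (+ᴹ-congˡ (⋆ν-cong {partialInverse (size b)} {antipode} b
        (λ b′ lt → partialInverse-antipode (size b) b′ (<⇒≤ lt))))

  antipode-recʳ : antipode ≋ η ⊞ (ν ⋆ antipode)
  antipode-recʳ b = ≈ᴹ-trans (≈ᴹ-sym (partialInverse-antipode (suc (size b)) b (n≤1+n _)))
    (≈ᴹ-trans (partialInverse-suc (size b) b)
    (+ᴹ-congˡ (ν⋆-cong {partialInverse (size b)} {antipode} b
        (λ b′ le → partialInverse-antipode (size b) b′ le))))

  private
    +-cancelʳ : ∀ {x y} z → x +ᴹ z ≈ᴹ y +ᴹ z → x ≈ᴹ y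
    +-cancelʳ z eq = GroupProperties.∙-cancelʳ +ᴹ-group z _ _ eq

  -- As id + ν = η, adding `antipode ⋆ ν` to both sides turns the claim into the recursion of the
  -- antipode.
  antipode-inverseˡ : antipode ⋆ gen ≋ η
  antipode-inverseˡ b = +-cancelʳ ((antipode ⋆ ν) b) (begin
    (antipode ⋆ gen) b +ᴹ (antipode ⋆ ν) b  ≈⟨ ⋆-distribˡ antipode gen ν b ⟨
    (antipode ⋆ (gen ⊞ ν)) b                ≈⟨ ⋆-cong {antipode} ≋-refl id+ν b ⟩
    (antipode ⋆ η) b                        ≈⟨ ⋆-identityʳ antipode b ⟩
    antipode b                              ≈⟨ antipode-recˡ b ⟩
    η b +ᴹ (antipode ⋆ ν) b                 ∎)

  antipode-inverseʳ : gen ⋆ antipode ≋ η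
  antipode-inverseʳ b = +-cancelʳ ((ν ⋆ antipode) b) (begin
    (gen ⋆ antipode) b +ᴹ (ν ⋆ antipode) b  ≈⟨ ⋆-distribʳ gen ν antipode b ⟨
    ((gen ⊞ ν) ⋆ antipode) b                ≈⟨ ⋆-cong {h = antipode} id+ν ≋-refl b ⟩
    (η ⋆ antipode) b                        ≈⟨ ⋆-identityˡ antipode b ⟩
    antipode b                              ≈⟨ antipode-recʳ b ⟩
    η b +ᴹ (ν ⋆ antipode) b                 ∎)

  η≈ε𝟙 : ∀ b → η b ≈ᴹ (ε (gen b) *ₗ 𝟙)
  η≈ε𝟙 b with size b ≟ 0
  ... | yes p = ≈ᴹ-trans (≈ᴹ-reflexive (η-0 {b} p))
      (≈ᴹ-trans (≈ᴹ-sym (*ₗ-identityˡ 𝟙)) (*ₗ-cong (K.reflexive (sym (counit-0 {b} p))) ≈ᴹ-refl))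
  ... | no ¬p = ≈ᴹ-trans (≈ᴹ-reflexive (η-≢0 {b} ¬p))
      (≈ᴹ-trans (≈ᴹ-sym (*ₗ-zeroˡ 𝟙)) (*ₗ-cong (K.reflexive (sym (counit-≢0 {b} ¬p))) ≈ᴹ-refl))

  ε𝟙-linear : Linear V (λ x → ε x *ₗ 𝟙)
  ε𝟙-linear = record
    { +-homo = λ x y → *ₗ-distribʳ 𝟙 (ε x) (ε y)
    ; 0-homo = *ₗ-zeroˡ 𝟙
    ; neg-homo = λ x → -*≈ (ε x) 𝟙
    ; •-homo = λ k x → *ₗ-assoc k (ε x) 𝟙
    }

  isAntipode : IsAntipode (PQSym K l) (lift V antipode)
  isAntipode = record
    { isLinear = lift-isLinear
    ; inverseˡ = linear-ext {N = V} {F = λ x → lift V (λ (x₁ , x₂) → lift V antipode x₁ · x₂) (Δ x)}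
        (record { +-homo = λ _ _ → ≈ᴹ-refl ; 0-homo = ≈ᴹ-refl ; neg-homo = λ _ → ≈ᴹ-refl ; •-homo =
            λ _ _ → ≈ᴹ-refl })
        ε𝟙-linear
        (λ b → ≈ᴹ-trans (≈ᴹ-reflexive (lift-sum (breaks b))) (≈ᴹ-trans (antipode-inverseˡ b) (η≈ε𝟙 b)))
    ; inverseʳ = linear-ext {N = V} {F = λ x → lift V (λ (x₁ , x₂) → x₁ · lift V antipode x₂) (Δ x)}
        (record { +-homo = λ _ _ → ≈ᴹ-refl ; 0-homo = ≈ᴹ-refl ; neg-homo = λ _ → ≈ᴹ-refl ; •-homo =
            λ _ _ → ≈ᴹ-refl })
        ε𝟙-linear
        (λ b → ≈ᴹ-trans (≈ᴹ-reflexive (lift-sum (breaks b))) (≈ᴹ-trans (antipode-inverseʳ b) (η≈ε𝟙 b)))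
    }

  isHopfAlgebra : IsHopfAlgebra (PQSym K l)
  isHopfAlgebra = record { isBialgebra = isBialgebra ; antipode = lift V antipode ; isAntipode = isAntipode }

-- The grading

module Grading (K : CommutativeRing c ℓ) (l : ℕ) where
  private
    module K = CommutativeRing K
    B = ColouredParkingFunction l
    V = PQSymSpace K l
    V² = V ⊗ᴹ V
    Deg = PQSymDegree K l
  open ColouredParkingFunction using (size)
  open RawBialgebra (PQSym K l)
  open Bialgebra K l
  open Negation V
  open FinSum +ᴹ-commutativeMonoid using (sum)
  open SetoidReasoning ≈ᴹ-setoid

  span-submodule : ∀ {m ℓm p} {M : Module K m ℓm} {S : Pred (Module.Carrierᴹ M) p} → IsSubmodule M (Span M S)
  span-submodule = record { 0-closed = 0-Span ; +-closed = +-Span ; *-closed = *-Span ; ≈-closed = ≈-Span }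

  sum-Span : ∀ {m ℓm p} {M : Module K m ℓm} {S : Pred (Module.Carrierᴹ M) p} (xs : List X) {f} →
             (∀ {x} → x ∈ xs → f x Unary.∈ Span M S) → sumOver M xs f Unary.∈ Span M S
  sum-Span []       q = 0-Span
  sum-Span (x ∷ xs) q = +-Span (q (here refl)) (sum-Span xs (λ x∈ → q (there x∈)))

  component : ℕ → B → Carrierᴹ
  component n b = if does (size b ≟ n) then gen b else 0ᴹ

  component-≡ : ∀ {n b} → size b ≡ n → component n b ≡ gen b
  component-≡ {n} {b} p = cong (if_then gen b else 0ᴹ) (dec-true (size b ≟ n) p)

  component-≢ : ∀ {n b} → size b ≢ n → component n b ≡ 0ᴹ
  component-≢ {n} {b} p = cong (if_then gen b else 0ᴹ) (dec-false (size b ≟ n) p)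

  -- Equality in the free module is a generated congruence without normal forms to compare.
  -- Independence of the degrees is tested by these projections, which respect it.
  π : ℕ → Carrierᴹ → Carrierᴹ
  π n = lift V (component n)

  π-Deg : ∀ n x → π n x Unary.∈ Deg n
  π-Deg n (gen b) with size b ≟ n
  ... | yes p = subst (Unary._∈ Deg n) (sym (component-≡ {n} {b} p)) (member (b , p , refl))
  ... | no ¬p = subst (Unary._∈ Deg n) (sym (component-≢ {n} {b} ¬p)) 0-Span
  π-Deg n 0ᶜ       = 0-Span
  π-Deg n (x +ᶜ y) = +-Span (π-Deg n x) (π-Deg n y)
  π-Deg n (-ᶜ x)   = ≈-Span (-1*≈- (π n x)) (*-Span _ (π-Deg n x))
  π-Deg n (k • x)  = *-Span k (π-Deg n x)

  π-fix : ∀ {n x} → x Unary.∈ Deg n → π n x ≈ᴹ x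
  π-fix (member (b , refl , refl)) = ≈ᴹ-reflexive (component-≡ {b = b} refl)
  π-fix 0-Span         = ≈ᴹ-refl
  π-fix (+-Span p q)   = +ᴹ-cong (π-fix p) (π-fix q)
  π-fix (*-Span k p)   = *ₗ-cong K.refl (π-fix p)
  π-fix (≈-Span eq p)  = ≈ᴹ-trans (lift-free-cong {N = V} (≈ᴹ-sym eq)) (≈ᴹ-trans (π-fix p) eq)

  π-kill : ∀ {m n x} → m ≢ n → x Unary.∈ Deg m → π n x ≈ᴹ 0ᴹ
  π-kill m≢n (member (b , refl , refl)) = ≈ᴹ-reflexive (component-≢ {b = b} m≢n)
  π-kill m≢n 0-Span        = ≈ᴹ-refl
  π-kill m≢n (+-Span p q)  = ≈ᴹ-trans (+ᴹ-cong (π-kill m≢n p) (π-kill m≢n q)) (+ᴹ-identityˡ 0ᴹ)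
  π-kill m≢n (*-Span k p)  = ≈ᴹ-trans (*ₗ-cong K.refl (π-kill m≢n p)) (*ₗ-zeroʳ k)
  π-kill m≢n (≈-Span eq p) = ≈ᴹ-trans (lift-free-cong {N = V} (≈ᴹ-sym eq)) (π-kill m≢n p)

  finSum-0 : ∀ n {xs : Fin n → Carrierᴹ} → (∀ i → xs i ≈ᴹ 0ᴹ) → sum xs ≈ᴹ 0ᴹ
  finSum-0 zero    z = ≈ᴹ-refl
  finSum-0 (suc n) z = ≈ᴹ-trans (+ᴹ-cong (z Fin.zero) (finSum-0 n (λ i → z (Fin.suc i)))) (+ᴹ-identityˡ 0ᴹ)

  finSum-single : ∀ {n} {xs : Fin n → Carrierᴹ} i → (∀ j → j ≢ i → xs j ≈ᴹ 0ᴹ) → sum xs ≈ᴹ xs i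
  finSum-single {suc n} Fin.zero    z = ≈ᴹ-trans (+ᴹ-congˡ (finSum-0 n (λ j → z (Fin.suc j) λ ())))
      (+ᴹ-identityʳ _)
  finSum-single {suc n} (Fin.suc i) z = ≈ᴹ-trans
    (+ᴹ-cong (z Fin.zero λ ()) (finSum-single i (λ j j≢i → z (Fin.suc j) (λ { refl → j≢i refl }))))
        (+ᴹ-identityˡ _)

  finSum-linear : ∀ n {F : Fin n → Carrierᴹ → Carrierᴹ} → (∀ i → Linear V (F i)) → Linear V
      (λ x → sum (λ i → F i x))
  finSum-linear zero    lf = 0-linear {N = V}
  finSum-linear (suc n) lf = +-linear {N = V} (lf Fin.zero) (finSum-linear n (λ i → lf (Fin.suc i)))

  -- Read off from the syntax tree, not from its class. The successor makes the bound exceed the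
  -- size of every generator, as indices in `Fin n` stay below `n`.
  degreeBound : Carrierᴹ → ℕ
  degreeBound (gen b)  = suc (size b)
  degreeBound 0ᶜ       = 0
  degreeBound (x +ᶜ y) = degreeBound x ℕ.⊔ degreeBound y
  degreeBound (-ᶜ x)   = degreeBound x
  degreeBound (k • x)  = degreeBound x

  -- Any `n` above the bound is allowed, so that both summands of a sum can be decomposed with the
  -- same number of degrees.
  ≈sum-π : ∀ {n} x → degreeBound x ≤ n → x ≈ᴹ sum {n} (λ i → π (toℕ i) x)
  ≈sum-π {n} x le = go x le
    where
    lin : Linear V (λ x → sum {n} (λ i → π (toℕ i) x))
    lin = finSum-linear n (λ _ → lift-linear {N = V})
    go : ∀ x → degreeBound x ≤ n → x ≈ᴹ sum {n} (λ i → π (toℕ i) x)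
    go (gen b) lt = ≈ᴹ-sym (≈ᴹ-trans
      (finSum-single (fromℕ< lt) (λ j j≢ → ≈ᴹ-reflexive (component-≢ {toℕ j} {b}
        (λ p → j≢ (toℕ-injective (trans (sym p) (sym (toℕ-fromℕ< lt))))))))
      (≈ᴹ-reflexive (component-≡ {toℕ (fromℕ< lt)} {b} (sym (toℕ-fromℕ< lt)))))
    go 0ᶜ       le = ≈ᴹ-sym (Linear.0-homo lin)
    go (x +ᶜ y) le = ≈ᴹ-trans (+ᴹ-cong (go x (m⊔n≤o⇒m≤o _ _ le))
        (go y (m⊔n≤o⇒n≤o (degreeBound x) _ le))) (≈ᴹ-sym (Linear.+-homo lin x y))
    go (-ᶜ x)   le = ≈ᴹ-trans (-ᴹ‿cong (go x le)) (≈ᴹ-sym (Linear.neg-homo lin x))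
    go (k • x)  le = ≈ᴹ-trans (*ₗ-cong K.refl (go x le)) (≈ᴹ-sym (Linear.•-homo lin k x))

  π-finSum : ∀ d n {xs : Fin n → Carrierᴹ} → π d (sum xs) ≡ sum (λ i → π d (xs i))
  π-finSum d zero         = refl
  π-finSum d (suc n) {xs} = cong (π d (xs Fin.zero) +ᴹ_) (π-finSum d n)

  isGrading : IsGrading space Deg
  isGrading = record
    { isSubmodule = λ _ → span-submodule
    ; spanning    = λ x → degreeBound x , (λ i → π (toℕ i) x) , (λ i → π-Deg (toℕ i) x) , ≈sum-π x ≤-refl
    ; independent = independent
    }
    where
    independent : ∀ n (xs : Fin n → Carrierᴹ) → (∀ i → xs i Unary.∈ Deg (toℕ i)) → sum xs ≈ᴹ 0ᴹ →
        ∀ i → xs i ≈ᴹ 0ᴹ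
    independent n xs deg eq i = begin
      xs i                              ≈⟨ π-fix (deg i) ⟨
      π (toℕ i) (xs i)                  ≈⟨ finSum-single i
          (λ j j≢i → π-kill (λ p → j≢i (toℕ-injective p)) (deg j)) ⟨
      sum (λ j → π (toℕ i) (xs j))      ≡⟨ π-finSum (toℕ i) n ⟨
      π (toℕ i) (sum xs)                ≈⟨ lift-free-cong {N = V} eq ⟩
      0ᴹ                                ∎

  ·-graded : ∀ {i j x y} → x Unary.∈ Deg i → y Unary.∈ Deg j → (x · y) Unary.∈ Deg (i + j)
  ·-graded 0-Span        q = 0-Span
  ·-graded (+-Span p p′) q = +-Span (·-graded p q) (·-graded p′ q)
  ·-graded (*-Span k p)  q = *-Span k (·-graded p q)
  ·-graded {x = x} {y} (≈-Span {x = x′} eq p) q = ≈-Span (·-cong {x′} {x} {y} {y} eq ≈ᴹ-refl) (·-graded p q)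
  ·-graded {j = j} (member (a , refl , refl)) q = go q
    where
    go : ∀ {y} → y Unary.∈ Deg j → (gen a · y) Unary.∈ Deg (size a + j)
    go (member (b , refl , refl)) = subst (Unary._∈ Deg _) (sym (product≡ a b)) (sum-Span (products a b)
      (λ {e} e∈ → member (e , Product.sizes (∈-products⁻ a b e∈) , refl)))
    go 0-Span        = 0-Span
    go (+-Span q q′) = +-Span (go q) (go q′)
    go (*-Span k q)  = *-Span k (go q)
    go {y} (≈-Span {x = y′} eq q) = ≈-Span (·-cong {gen a} {gen a} {y′} {y} ≈ᴹ-refl eq) (go q)

  Δ-graded : ∀ {n x} → x Unary.∈ Deg n → Δ x Unary.∈ TensorDegree space Deg n
  Δ-graded (member (b , refl , refl)) = sum-Span (breaks b) (λ {i} i∈ →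
    let bi = ∈-breakpoints⁻ b i∈ in
    member ( size (low i b) , size (high i b) , gen (low i b) , gen (high i b)
           , trans (cong (_+ size (high i b)) (size-low b bi)) (size-high b bi)
           , member (low i b , refl , refl) , member (high i b , refl , refl) , refl))
  Δ-graded 0-Span        = 0-Span
  Δ-graded (+-Span p q)  = +-Span (Δ-graded p) (Δ-graded q)
  Δ-graded (*-Span k p)  = *-Span k (Δ-graded p)
  Δ-graded (≈-Span eq p) = ≈-Span (lift-free-cong {N = V²} eq) (Δ-graded p)

  ε-graded : ∀ {n x} → n ≢ 0 → x Unary.∈ Deg n → ε x K.≈ K.0#
  ε-graded n≢0 (member (b , refl , refl)) = K.reflexive (counit-≢0 {b} n≢0)
  ε-graded n≢0 0-Span        = K.refl
  ε-graded n≢0 (+-Span p q)  = K.trans (K.+-cong (ε-graded n≢0 p) (ε-graded n≢0 q)) (K.+-identityˡ K.0#)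
  ε-graded n≢0 (*-Span k p)  = K.trans (K.*-cong K.refl (ε-graded n≢0 p)) (K.zeroʳ k)
  ε-graded n≢0 (≈-Span eq p) = K.trans (lift-free-cong {N = ⟨module⟩ {R = K}} (≈ᴹ-sym eq)) (ε-graded n≢0 p)

  isGradedBialgebra : IsGradedBialgebra (PQSym K l) Deg
  isGradedBialgebra = record
    { isBialgebra = isBialgebra
    ; isGrading   = isGrading
    ; ·-graded    = ·-graded
    ; 𝟙-graded    = member (∅ , refl , refl)
    ; Δ-graded    = Δ-graded
    ; ε-graded    = ε-graded
    }

theorem6p1 : ∀ {c ℓ : Level} (K : CommutativeRing c ℓ) (l : ℕ) → 1 ≤ l →
    IsAlgebraHomomorphism (RawBialgebra.algebra (PQSym K l)) (RawBialgebra.algebra² (PQSym K l)) (RawBialgebra.Δ (PQSym K l))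
    × IsGradedBialgebra (PQSym K l) (PQSymDegree K l)
    × IsHopfAlgebra (PQSym K l)
theorem6p1 K l _ =
  Bialgebra.Δ-isAlgebraHomomorphism K l , Grading.isGradedBialgebra K l , Hopf.isHopfAlgebra K l
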